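{- The following decision problem is NP-complete: given a 4-regular graph $G$, decide whether $\overleftrightarrow{\chi}(G) \leq 2$.
   Context: All graphs are finite and simple. An orientation $D$ of a graph $G$ is a digraph obtained by replacing each edge of $G$ by exactly one of the two possible arcs with the same endvertices. For a vertex $v$, $d_D^-(v)$ (in-degree) is the number of arcs with head $v$, $d_D^+(v)$ (out-degree) is the number of arcs with tail $v$, and the in-out-degree is $d_D^{\pm}(v) = d_D^-(v) - d_D^+(v)$. An orientation $D$ of $G$ is in-out-proper if $d_D^{\pm}(u) \neq d_D^{\pm}(v)$ for any two adjacent vertices $u,v$. The in-out-proper orientation number of $G$ is $\overleftrightarrow{\chi}(G) = \min_{D\in\Gamma}\max_{v\in V(G)} |d_D^{\pm}(v)|$, where $\Gamma$ is the set of in-out-proper orientations of $G$ (it is known that $\Gamma$ is nonempty for every graph $G$). -}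

module Defs where

open import Level using (0ℓ)
open import Data.Bool.Base using (Bool; true; false; _xor_)
open import Data.Fin.Base using (Fin; zero)
open import Data.Fin.Subset using (∣_∣)
open import Data.Integer.Base using (ℤ; _⊖_) renaming (∣_∣ to abs)
open import Data.List.Base using (List; []; _∷_; _++_; length; map; concatMap; replicate; allFin)
open import Data.List.Extrema.Nat using (max)
open import Data.Maybe.Base using (Maybe; just; nothing)
open import Data.Nat.Base using (ℕ; suc; _+_; _*_; _≤_)
open import Data.Product.Base using (Σ-syntax; ∃-syntax; _×_; _,_)
open import Data.Vec.Base as Vec using (Vec; lookup; zipWith)
open import Function.Bundles using (_⇔_)
open import Relation.Binary.PropositionalEquality.Core using (_≡_; _≢_)
open import Relation.Unary using (Pred)

------------------------------------------------------------------------
-- Deterministic multi-tape Turing machines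

-- The tape alphabet: the blank, the input alphabet {0,1} and s further
-- symbols.
data Symbol (s : ℕ) : Set where
  blank : Symbol s
  bit   : Bool → Symbol s
  extra : Fin s → Symbol s

data Move : Set where
  left stay right : Move

-- A two-way infinite tape that is blank outside the part recorded.
-- Both lists start with the cell next to the head.
record Tape (s : ℕ) : Set where
  constructor tape
  field
    leftward  : List (Symbol s)
    scanned   : Symbol s
    rightward : List (Symbol s)

move : ∀ {s} → Move → Tape s → Tape s
move left  (tape []       h rs)       = tape [] blank (h ∷ rs)
move left  (tape (l ∷ ls) h rs)       = tape ls l (h ∷ rs)
move stay  t                          = t
move right (tape ls       h [])       = tape (h ∷ ls) blank []
move right (tape ls       h (r ∷ rs)) = tape (h ∷ ls) r rs

writeMove : ∀ {s} → Symbol s × Move → Tape s → Tape s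
writeMove (a , m) (tape ls _ rs) = move m (tape ls a rs)

emptyTape : ∀ {s} → Tape s
emptyTape = tape [] blank []

inputTape : ∀ {s} → List Bool → Tape s
inputTape []       = emptyTape
inputTape (b ∷ bs) = tape [] (bit b) (map bit bs)

leadingBits : ∀ {s} → List (Symbol s) → List Bool
leadingBits (bit b ∷ as) = b ∷ leadingBits as
leadingBits _            = []

-- The maximal bit string that starts at the head and extends to the
-- right.
outputOf : ∀ {s} → Tape s → List Bool
outputOf (tape _ h rs) = leadingBits (h ∷ rs)

-- The machine halts when δ returns nothing.
record TM : Set where
  field
    states       : ℕ
    extraSymbols : ℕ
    workTapes    : ℕ

  State : Set
  State = Fin states

  Sym : Set
  Sym = Symbol extraSymbols

  tapes : ℕ
  tapes = suc workTapes

  field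
    start     : State
    accepting : State → Bool
    δ         : State → Vec Sym tapes → Maybe (State × Vec (Sym × Move) tapes)

module Run (M : TM) where
  open TM M

  record Config : Set where
    constructor config
    field
      state    : State
      contents : Vec (Tape extraSymbols) tapes

  initial : List Bool → Config
  initial w = config start (inputTape w Vec.∷ Vec.replicate workTapes emptyTape)

  next : Config → Maybe Config
  next (config q ts) with δ q (Vec.map Tape.scanned ts)
  ... | nothing       = nothing
  ... | just (q′ , a) = just (config q′ (zipWith writeMove a ts))

  -- c ⇓[ t ] d : started from c, the machine halts after exactly t steps,
  -- in configuration d.
  data _⇓[_]_ : Config → ℕ → Config → Set where
    halt : ∀ {c} → next c ≡ nothing → c ⇓[ 0 ] c
    step : ∀ {c c′ d t} → next c ≡ just c′ → c′ ⇓[ t ] d → c ⇓[ suc t ] d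

  Accepts : Config → Set
  Accepts c = accepting (Config.state c) ≡ true

  output : Config → List Bool
  output c = outputOf (lookup (Config.contents c) zero)

------------------------------------------------------------------------
-- Polynomial time and NP-completeness

-- Univariate polynomials with coefficients in ℕ, as expressions.
data Polynomial : Set where
  X         : Polynomial
  con       : ℕ → Polynomial
  _:+_ _:*_ : Polynomial → Polynomial → Polynomial

⟦_⟧ : Polynomial → ℕ → ℕ
⟦ X      ⟧ n = n
⟦ con k  ⟧ n = k
⟦ p :+ q ⟧ n = ⟦ p ⟧ n + ⟦ q ⟧ n
⟦ p :* q ⟧ n = ⟦ p ⟧ n * ⟦ q ⟧ n

Language : Set₁
Language = Pred (List Bool) 0ℓ

-- M halts on every input w within p(|w|) steps, in a configuration
-- that satisfies Q w.
HaltsInTime : (M : TM) → Polynomial → (List Bool → Run.Config M → Set) → Set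
HaltsInTime M p Q =
  ∀ w → ∃[ t ] ∃[ c ] initial w ⇓[ t ] c × t ≤ ⟦ p ⟧ (length w) × Q w c
  where open Run M

InP : Language → Set
InP L = Σ[ M ∈ TM ] Σ[ p ∈ Polynomial ]
  HaltsInTime M p (λ w c → Run.Accepts M c ⇔ L w)

PolyTimeComputable : (List Bool → List Bool) → Set
PolyTimeComputable f = Σ[ M ∈ TM ] Σ[ p ∈ Polynomial ]
  HaltsInTime M p (λ w c → Run.output M c ≡ f w)

-- Self-delimiting pairing: every bit of the first component is preceded
-- by a 1, and a 0 marks its end.
⟨_,_⟩ : List Bool → List Bool → List Bool
⟨ x , y ⟩ = concatMap (λ b → true ∷ b ∷ []) x ++ false ∷ y

InNP : Language → Set₁
InNP L = Σ[ V ∈ Language ] Σ[ p ∈ Polynomial ]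
  InP V ×
  (∀ x → L x ⇔ (∃[ y ] length y ≤ ⟦ p ⟧ (length x) × V ⟨ x , y ⟩))

_≤ₚ_ : Language → Language → Set
L ≤ₚ L′ = Σ[ f ∈ (List Bool → List Bool) ]
  PolyTimeComputable f × (∀ x → L x ⇔ L′ (f x))

NPHard : Language → Set₁
NPHard L = ∀ L′ → InNP L′ → L′ ≤ₚ L

NPComplete : Language → Set₁
NPComplete L = InNP L × NPHard L

------------------------------------------------------------------------
-- Graphs and orientations

record Graph (n : ℕ) : Set where
  field
    adj         : Fin n → Fin n → Bool
    symmetric   : ∀ u v → adj u v ≡ adj v u
    irreflexive : ∀ v → adj v v ≡ false

  degree : Fin n → ℕ
  degree v = ∣ Vec.tabulate (adj v) ∣

Regular : ℕ → ∀ {n} → Graph n → Set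
Regular d G = ∀ v → Graph.degree G v ≡ d

-- arc u v ≡ true means that there is an arc with tail u and head v.
record Orientation {n : ℕ} (G : Graph n) : Set where
  open Graph G
  field
    arc        : Fin n → Fin n → Bool
    arc⇒edge   : ∀ u v → arc u v ≡ true → adj u v ≡ true
    exactlyOne : ∀ u v → adj u v ≡ true → arc u v xor arc v u ≡ true

  inDegree outDegree : Fin n → ℕ
  inDegree  v = ∣ Vec.tabulate (λ u → arc u v) ∣
  outDegree v = ∣ Vec.tabulate (λ u → arc v u) ∣

  inOutDegree : Fin n → ℤ
  inOutDegree v = inDegree v ⊖ outDegree v

  InOutProper : Set
  InOutProper = ∀ u v → adj u v ≡ true → inOutDegree u ≢ inOutDegree v

  -- Equal to 0 for the graph without vertices.
  maxAbsInOutDegree : ℕ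
  maxAbsInOutDegree = max 0 (map (λ v → abs (inOutDegree v)) (allFin n))

-- k is the minimum of maxAbsInOutDegree over the in-out-proper
-- orientations of G.
IsInOutProperOrientationNumber : ∀ {n} → Graph n → ℕ → Set
IsInOutProperOrientationNumber G k =
  (Σ[ D ∈ Orientation G ] InOutProper D × maxAbsInOutDegree D ≡ k) ×
  (∀ (D : Orientation G) → InOutProper D → k ≤ maxAbsInOutDegree D)
  where open Orientation

InOutProperOrientationNumber≤ : ∀ {n} → Graph n → ℕ → Set
InOutProperOrientationNumber≤ G m =
  ∃[ k ] IsInOutProperOrientationNumber G k × k ≤ m

------------------------------------------------------------------------
-- The decision problem

-- The number of vertices in unary, ended by a 0, followed by the
-- adjacency matrix row by row.
encode : ∀ {n} → Graph n → List Bool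
encode {n} G =
  replicate n true ++ false ∷
  concatMap (λ u → map (λ v → Graph.adj G u v) (allFin n)) (allFin n)

-- The encodings of the d-regular graphs whose in-out-proper orientation
-- number is at most m.
RegularInOutProperOrientation : ℕ → ℕ → Language
RegularInOutProperOrientation d m w =
  ∃[ n ] Σ[ G ∈ Graph n ]
    Regular d G × InOutProperOrientationNumber≤ G m × w ≡ encode G

{-# OPTIONS --safe #-}

-- Membership: in a 4-regular graph an orientation is in-out-proper with all
-- |in-out-degrees| ≤ 2 iff all in-degrees are in {1, 2, 3} and the in-degrees
-- of adjacent vertices differ; in particular they form a proper 3-colouring.
-- The arc matrix is the certificate, and "the certificate is right" is a
-- bounded arithmetic formula, which pointer programs, and so Turing machines,
-- decide in polynomial time.
--
-- Hardness: a run of the verifier within T steps is written as a table whose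
-- columns are tape positions relative to the heads, so that all tapes of the
-- machine shift past a fixed column.  The table is a tiling with local
-- constraints.  A tiling is a 3-colouring: each cell has an odd cycle of nodes,
-- each next to the node of one tile, so one tile has to get the colour "true",
-- and conflicting tiles are joined by edges.  Finally each ordered pair u, v of
-- vertices of the 3-colouring instance becomes a cell of 21 nodes; the cells of
-- u form a cyclic chain of diamonds, which carries the colour of u, and cell
-- u, v meets cell v, u if u and v are adjacent.  Every cell is balanced, so a
-- 3-colouring lifts to an orientation whose in-degrees are the colours.
module Submission where

open import Defs
open import Data.Bool.Base using (Bool; true; false; not; if_then_else_; _xor_)
open import Data.Bool.Properties using (not-involutive) renaming (_≟_ to _≟ᵇ_)
open import Data.Empty using (⊥; ⊥-elim)
open import Data.Fin using (#_)
open import Data.Fin.Base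
  using (Fin; zero; suc; toℕ; fromℕ; fromℕ<; inject₁; inject≤; cast; combine; remQuot; splitAt; _↑ˡ_; _↑ʳ_)
open import Data.Fin.Induction using (<-weakInduction)
open import Data.Fin.Properties
  using (all?; any?; toℕ<n; toℕ-injective; toℕ-fromℕ; toℕ-fromℕ<; fromℕ<-toℕ; fromℕ<-cong; toℕ-inject₁; toℕ-inject≤;
         toℕ-cast; toℕ-combine; remQuot-combine; combine-remQuot; splitAt-↑ˡ; splitAt-↑ʳ)
  renaming (_≟_ to _≟ᶠ_; <-cmp to <-cmpᶠ; _<?_ to _<ᶠ?_; suc-injective to sucᶠ-injective)
open import Data.Fin.Relation.Unary.Top using (view; ‵fromℕ; ‵inject₁; view-fromℕ; view-inject₁)
open import Data.Fin.Subset using (∣_∣)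
open import Data.List.Base as List using (List; []; _∷_; _++_; length; _ʳ++_)
open import Data.List.Properties
  using (++-assoc; ++-identityʳ; length-++; length-replicate; length-map; length-ʳ++; ʳ++-ʳ++)
open import Data.Maybe.Base as Maybe using (Maybe; just; nothing; maybe′)
open import Data.Nat.Base hiding (pred)
open import Data.Nat.Properties
open import Data.Product.Base using (Σ-syntax; ∃-syntax; _×_; _,_; proj₁; proj₂; map₁)
open import Data.Product.Properties using (,-injectiveˡ; ,-injectiveʳ)
open import Data.Sum.Base as Sum using (_⊎_; inj₁; inj₂)
open import Data.Unit.Base using (⊤; tt)
open import Data.Vec.Base as Vec using (Vec; []; _∷_; lookup; zipWith; tabulate)
open import Data.Vec.Properties
  using (lookup-zipWith; lookup∘tabulate; lookup-map; lookup-replicate; map-replicate; tabulate∘lookup; tabulate-cong)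
open import Function.Base using (_∘_; id)
open import Function.Bundles using (_⇔_; mk⇔; Equivalence)
open import Function.Properties.Equivalence using () renaming (sym to ⇔-sym; trans to ⇔-trans)
open import Relation.Binary.Definitions using (DecidableEquality; tri<; tri≈; tri>)
open import Relation.Binary.PropositionalEquality hiding (J)
open import Relation.Nullary using (¬_; Dec; yes; no; does; contradiction)
open import Relation.Nullary.Decidable
  using (toWitness; dec-true; dec-false; does-⇔; map′; ¬?; _→-dec_; _×-dec_; _⊎-dec_)

-- In an orientation of a 4-regular graph the in-degrees average 2, so a 3-colouring can be realised
-- by in-degrees 1, 2, 3 only if the colours of in-degree 1 and 3 are equally frequent. This is the
-- obstacle to hardness, as colourings of an arbitrary instance are not balanced. Hence a cell has
-- seven nodes of each colour, whatever the colour of `u`: four `z`, `r₀`, `r₁` and `x`; four `p`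
-- and three `a`; four `q` and three `b`. Cyclic chains have no ends of smaller degree. The four
-- edges between two adjacent cells form a 4-cycle, and its cyclic orientation gives each `r` one
-- arc in and one arc out independently of both colours. So cells of different rows do not interact,
-- one table per colour orients a cell, and correctness of the tables is a finite check. On the side
-- of machines, one language of bounded arithmetic serves both halves: it expresses the verifier,
-- and also adjacency in the constructed graph, which the reduction prints bit by bit. Iterations
-- have counts computed beforehand, so time bounds are read off the syntax.

-- Turing machines with structured states, and pointer programs compiled to them.

module Machines where

  open import Data.Integer.Base using (ℤ; +_; -[1+_])

  nth : ∀ {s} → List (Symbol s) → ℕ → Symbol s
  nth []       _       = blank
  nth (a ∷ as) zero    = a
  nth (a ∷ as) (suc n) = nth as n

  -- A tape as a function on the integers, relative to the head. Tapes that differ only in recorded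
  -- blanks become indistinguishable, and a move becomes a shift of the argument.
  at : ∀ {s} → Tape s → ℤ → Symbol s
  at (tape ls h rs) (+ zero)  = h
  at (tape ls h rs) (+ suc n) = nth rs n
  at (tape ls h rs) -[1+ n ]  = nth ls n

  shift : Move → ℤ → ℤ
  shift left  (+ zero)     = -[1+ 0 ]
  shift left  (+ suc n)    = + n
  shift left  -[1+ n ]     = -[1+ suc n ]
  shift stay  z            = z
  shift right (+ n)        = + suc n
  shift right -[1+ zero ]  = + 0
  shift right -[1+ suc n ] = -[1+ n ]

  at-move : ∀ {s} m (t : Tape s) z → at (move m t) z ≡ at t (shift m z)
  at-move left  (tape []       h rs) (+ zero)  = refl
  at-move left  (tape (l ∷ ls) h rs) (+ zero)  = refl
  at-move left  (tape []       h rs) (+ suc zero)    = refl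
  at-move left  (tape []       h rs) (+ suc (suc n)) = refl
  at-move left  (tape (l ∷ ls) h rs) (+ suc zero)    = refl
  at-move left  (tape (l ∷ ls) h rs) (+ suc (suc n)) = refl
  at-move left  (tape []       h rs) -[1+ n ] = refl
  at-move left  (tape (l ∷ ls) h rs) -[1+ n ] = refl
  at-move stay  t z = refl
  at-move right (tape ls h [])       (+ zero)  = refl
  at-move right (tape ls h [])       (+ suc n) = refl
  at-move right (tape ls h (r ∷ rs)) (+ zero)  = refl
  at-move right (tape ls h (r ∷ rs)) (+ suc n) = refl
  at-move right (tape ls h [])       -[1+ zero ]  = refl
  at-move right (tape ls h [])       -[1+ suc n ] = refl
  at-move right (tape ls h (r ∷ rs)) -[1+ zero ]  = refl
  at-move right (tape ls h (r ∷ rs)) -[1+ suc n ] = refl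

  infix 6 _⊝_
  -- Cell `m` as seen from a head at cell `n`. Recursion on both arguments lets the laws for `shift`
  -- follow by plain induction.
  _⊝_ : ℕ → ℕ → ℤ
  m     ⊝ zero  = + m
  zero  ⊝ suc n = -[1+ n ]
  suc m ⊝ suc n = m ⊝ n

  shift-right : ∀ m n → shift right (m ⊝ n) ≡ suc m ⊝ n
  shift-right m       zero          = refl
  shift-right zero    (suc zero)    = refl
  shift-right zero    (suc (suc n)) = refl
  shift-right (suc m) (suc n)       = shift-right m n

  shift-left : ∀ m n → shift left (m ⊝ n) ≡ m ⊝ suc n
  shift-left zero    zero    = refl
  shift-left (suc m) zero    = refl
  shift-left zero    (suc n) = refl
  shift-left (suc m) (suc n) = shift-left m n

  ⊝-diag : ∀ n → n ⊝ n ≡ + 0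
  ⊝-diag zero    = refl
  ⊝-diag (suc n) = ⊝-diag n

  -- The head of the tape is at cell p of a tape with contents f.
  Points : ∀ {s} → (ℕ → Symbol s) → ℕ → Tape s → Set
  Points f p t = ∀ n → at t (n ⊝ p) ≡ f n

  at-head : ∀ {s} (t : Tape s) → at t (+ 0) ≡ Tape.scanned t
  at-head (tape ls h rs) = refl

  points-scanned : ∀ {s f p} (t : Tape s) → Points f p t → Tape.scanned t ≡ f p
  points-scanned {p = p} t P =
    trans (sym (trans (cong (at t) (⊝-diag p)) (at-head t))) (P p)

  points-right : ∀ {s f p} (t : Tape s) → Points f p t → Points f (suc p) (move right t)
  points-right {p = p} t P n =
    trans (at-move right t (n ⊝ suc p))
          (trans (cong (at t) (shift-right n (suc p))) (P n))

  points-left : ∀ {s f p} (t : Tape s) → Points f (suc p) t → Points f p (move left t)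
  points-left {p = p} t P n =
    trans (at-move left t (n ⊝ p)) (trans (cong (at t) (shift-left n p)) (P n))

  points-zipper : ∀ {s} (ls : List (Symbol s)) h rs →
    Points (nth (ls ʳ++ (h ∷ rs))) (length ls) (tape ls h rs)
  points-zipper []       h rs zero    = refl
  points-zipper []       h rs (suc n) = refl
  points-zipper (l ∷ ls) h rs n =
    trans (cong (at (tape (l ∷ ls) h rs)) (sym (shift-left n (length ls))))
    (trans (sym (at-move left (tape (l ∷ ls) h rs) (n ⊝ length ls)))
           (points-zipper ls l (h ∷ rs) n))

  -- Only a retraction is asked for: numbers that code nothing may decode to anything, which keeps
  -- sums, products and padding simple.
  record Coding (A : Set) : Set where
    field
      size        : ℕ
      code        : A → Fin size
      decode      : Fin size → A
      decode-code : ∀ a → decode (code a) ≡ a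

  ⊤-coding : Coding ⊤
  ⊤-coding = record { size = 1 ; code = λ _ → zero ; decode = λ _ → tt ; decode-code = λ _ → refl }

  ⊎-coding : ∀ {A B} → Coding A → Coding B → Coding (A ⊎ B)
  ⊎-coding {A} {B} c d = record
    { size        = C.size + D.size
    ; code        = Sum.[ (λ a → C.code a ↑ˡ D.size) , (λ b → C.size ↑ʳ D.code b) ]
    ; decode      = λ i → Sum.map C.decode D.decode (splitAt C.size i)
    ; decode-code = λ { (inj₁ a) → trans (cong (Sum.map C.decode D.decode) (splitAt-↑ˡ C.size (C.code a) D.size))
                                         (cong inj₁ (C.decode-code a))
                      ; (inj₂ b) → trans (cong (Sum.map C.decode D.decode) (splitAt-↑ʳ C.size D.size (D.code b)))
                                         (cong inj₂ (D.decode-code b)) }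
    }
    where
    module C = Coding c
    module D = Coding d

  module Machine
    {X : Set} (coding : Coding X) (extras works : ℕ) (begin : X) (acc : X → Bool)
    (δX : X → Vec (Symbol extras) (suc works) → Maybe (X × Vec (Symbol extras × Move) (suc works)))
    where

    open Coding coding

    machine : TM
    machine = record
      { states       = size
      ; extraSymbols = extras
      ; workTapes    = works
      ; start        = code begin
      ; accepting    = acc ∘ decode
      ; δ            = λ q v → Maybe.map (map₁ code) (δX (decode q) v)
      }

    open Run machine public

    Tapes : Set
    Tapes = Vec (Tape extras) (suc works)

    scan : Tapes → Vec (Symbol extras) (suc works)
    scan = Vec.map Tape.scanned

    next-just : ∀ x {y a} ts → δX x (scan ts) ≡ just (y , a) →
      next (config (code x) ts) ≡ just (config (code y) (zipWith writeMove a ts))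
    next-just x ts eq rewrite decode-code x | eq = refl

    next-nothing : ∀ {x} ts → δX x (scan ts) ≡ nothing → next (config (code x) ts) ≡ nothing
    next-nothing {x} ts eq rewrite decode-code x | eq = refl

    infix 4 _⟶[_]_
    -- In contrast to `_⇓[_]_`, the last configuration may be any, so that runs compose.
    data _⟶[_]_ : Config → ℕ → Config → Set where
      here : ∀ {c} → c ⟶[ 0 ] c
      step : ∀ {c c′ d t} → next c ≡ just c′ → c′ ⟶[ t ] d → c ⟶[ suc t ] d

    _▷_ : ∀ {c d e s t} → c ⟶[ s ] d → d ⟶[ t ] e → c ⟶[ s + t ] e
    here      ▷ q = q
    step eq p ▷ q = step eq (p ▷ q)

    _▷halt_ : ∀ {c d t} → c ⟶[ t ] d → next d ≡ nothing → c ⇓[ t ] d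
    here      ▷halt eq = halt eq
    step e p  ▷halt eq = step e (p ▷halt eq)

  Sym₁ : Set
  Sym₁ = Symbol 1

  pattern mark = extra zero

  data Test : Set where
    nonzero isTrue : Test

  test : Test → Sym₁ → Bool
  test nonzero mark       = false
  test nonzero _          = true
  test isTrue  (bit true) = true
  test isTrue  _          = false

  data Program : Set where
    skip    : Program
    inc dec : ℕ → Program
    emit    : Bool → Program
    _⨾_     : Program → Program → Program
    branch  : ℕ → Test → Program → Program → Program
    while   : ℕ → Program → Program

  infixr 5 _⨾_

  -- Register 0 points into the input, preceded by a mark.  The other
  -- registers point into tapes that contain just a mark, and so count.
  contents : List Bool → ℕ → ℕ → Sym₁
  contents w zero    = nth (mark ∷ List.map bit w)
  contents w (suc i) = nth (mark ∷ [])

  contents-suc : ∀ w i n → test nonzero (contents w i (suc n)) ≡ true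
  contents-suc []      zero    n       = refl
  contents-suc (b ∷ w) zero    zero    = refl
  contents-suc (b ∷ w) zero    (suc n) = contents-suc w zero n
  contents-suc w       (suc i) n       = refl

  Registers : Set
  Registers = ℕ → ℕ

  -- Registers are functions, so their change is stated pointwise. Output grows at the front because
  -- the output head moves left. Machine steps are counted exactly: one per instruction or test.
  data Runs (w : List Bool) : Program → Registers → List Bool → ℕ → Registers → List Bool → Set where
    skip  : ∀ {σ o} → Runs w skip σ o 1 σ o
    inc   : ∀ {i σ τ o} → τ i ≡ suc (σ i) → (∀ j → j ≢ i → τ j ≡ σ j) → Runs w (inc i) σ o 1 τ o
    dec   : ∀ {i σ τ o} → σ i ≡ suc (τ i) → (∀ j → j ≢ i → τ j ≡ σ j) → Runs w (dec i) σ o 1 τ o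
    emit  : ∀ {b σ o} → Runs w (emit b) σ o 1 σ (b ∷ o)
    _⨾_   : ∀ {p q σ τ υ o o′ o″ s t} → Runs w p σ o s τ o′ → Runs w q τ o′ t υ o″ →
            Runs w (p ⨾ q) σ o (s + t) υ o″
    true  : ∀ {i c p q σ τ o o′ t} → test c (contents w i (σ i)) ≡ true →
            Runs w p σ o t τ o′ → Runs w (branch i c p q) σ o (suc t) τ o′
    false : ∀ {i c p q σ τ o o′ t} → test c (contents w i (σ i)) ≡ false →
            Runs w q σ o t τ o′ → Runs w (branch i c p q) σ o (suc t) τ o′
    stop  : ∀ {i p σ o} → σ i ≡ 0 → Runs w (while i p) σ o 1 σ o
    loop  : ∀ {i p σ τ υ o o′ o″ s t} → test nonzero (contents w i (σ i)) ≡ true → Runs w p σ o s τ o′ →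
            Runs w (while i p) τ o′ t υ o″ → Runs w (while i p) σ o (suc (s + t)) υ o″

  maxRegister : Program → ℕ
  maxRegister skip             = 0
  maxRegister (inc i)          = i
  maxRegister (dec i)          = i
  maxRegister (emit b)         = 0
  maxRegister (p ⨾ q)          = maxRegister p ⊔ maxRegister q
  maxRegister (branch i c p q) = i ⊔ (maxRegister p ⊔ maxRegister q)
  maxRegister (while i p)      = i ⊔ maxRegister p

  -- Turns a register number into a tape index by truncation, which makes transitions total;
  -- registers up to `R` are kept apart.
  clamp : ∀ R → ℕ → Fin (suc R)
  clamp zero    i       = zero
  clamp (suc R) zero    = zero
  clamp (suc R) (suc i) = suc (clamp R i)

  clamp-injective : ∀ {R i j} → i ≤ R → j ≤ R → clamp R i ≡ clamp R j → i ≡ j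
  clamp-injective {zero}  z≤n     z≤n     eq = refl
  clamp-injective {suc R} z≤n     z≤n     eq = refl
  clamp-injective {suc R} (s≤s a) (s≤s b) eq = cong suc (clamp-injective a b (sucᶠ-injective eq))

  State : Program → Set
  State skip             = ⊤
  State (inc i)          = ⊤
  State (dec i)          = ⊤
  State (emit b)         = ⊤
  State (p ⨾ q)          = State p ⊎ State q
  State (branch i c p q) = ⊤ ⊎ (State p ⊎ State q)
  State (while i p)      = ⊤ ⊎ State p

  state-coding : ∀ p → Coding (State p)
  state-coding skip             = ⊤-coding
  state-coding (inc i)          = ⊤-coding
  state-coding (dec i)          = ⊤-coding
  state-coding (emit b)         = ⊤-coding
  state-coding (p ⨾ q)          = ⊎-coding (state-coding p) (state-coding q)
  state-coding (branch i c p q) = ⊎-coding ⊤-coding (⊎-coding (state-coding p) (state-coding q))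
  state-coding (while i p)      = ⊎-coding ⊤-coding (state-coding p)

  entry : ∀ p → State p
  entry skip             = tt
  entry (inc i)          = tt
  entry (dec i)          = tt
  entry (emit b)         = tt
  entry (p ⨾ q)          = inj₁ (entry p)
  entry (branch i c p q) = inj₁ tt
  entry (while i p)      = inj₁ tt

  acts : ∀ {k} → (Fin k → Sym₁ → Sym₁ × Move) → Vec Sym₁ k → Vec (Sym₁ × Move) k
  acts f v = tabulate λ j → f j (lookup v j)

  lookup-acts : ∀ {k} (f : Fin k → Sym₁ → Sym₁ × Move) (ts : Vec (Tape 1) k) j →
    lookup (zipWith writeMove (acts f (Vec.map Tape.scanned ts)) ts) j ≡
    writeMove (f j (Tape.scanned (lookup ts j))) (lookup ts j)
  lookup-acts f ts j =
    trans (lookup-zipWith writeMove j (acts f (Vec.map Tape.scanned ts)) ts)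
    (cong (λ a → writeMove a (lookup ts j))
      (trans (lookup∘tabulate (λ j → f j (lookup (Vec.map Tape.scanned ts) j)) j) (cong (f j) (lookup-map j Tape.scanned ts))))

  writeMove-idle : ∀ {s k} (ts : Vec (Tape s) k) →
    zipWith writeMove (Vec.map (_, stay) (Vec.map Tape.scanned ts)) ts ≡ ts
  writeMove-idle []       = refl
  writeMove-idle (t ∷ ts) = cong (t ∷_) (writeMove-idle ts)

  idle : Sym₁ → Sym₁ × Move
  idle s = s , stay

  module Compiler (R : ℕ) where

    Action : Set
    Action = Fin (2 + R) → Sym₁ → Sym₁ × Move

    moving : ℕ → Move → Action
    moving i m zero    s = s , stay
    moving i m (suc j) s = s , (if does (j ≟ᶠ clamp R i) then m else stay)

    writing : Bool → Action
    writing b zero    s = bit b , left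
    writing b (suc j) s = idle s

    -- Control in continuation style: `e` embeds the states of the subprogram into those of the
    -- whole, and `x` is the state to enter when it is done.
    transition : ∀ {X : Set} (p : Program) → (State p → X) → X →
                 State p → Vec Sym₁ (2 + R) → X × Action
    transition skip     e x s v = x , λ _ → idle
    transition (inc i)  e x s v = x , moving i right
    transition (dec i)  e x s v = x , moving i left
    transition (emit b) e x s v = x , writing b
    transition (p ⨾ q)  e x (inj₁ s) v = transition p (e ∘ inj₁) (e (inj₂ (entry q))) s v
    transition (p ⨾ q)  e x (inj₂ s) v = transition q (e ∘ inj₂) x s v
    transition (branch i c p q) e x (inj₁ tt) v =
      (if test c (lookup v (suc (clamp R i))) then e (inj₂ (inj₁ (entry p))) else e (inj₂ (inj₂ (entry q)))) , λ _ → idle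
    transition (branch i c p q) e x (inj₂ (inj₁ s)) v = transition p (e ∘ inj₂ ∘ inj₁) x s v
    transition (branch i c p q) e x (inj₂ (inj₂ s)) v = transition q (e ∘ inj₂ ∘ inj₂) x s v
    transition (while i p) e x (inj₁ tt) v =
      (if test nonzero (lookup v (suc (clamp R i))) then e (inj₂ (entry p)) else x) , λ _ → idle
    transition (while i p) e x (inj₂ s) v = transition p (e ∘ inj₂) (e (inj₁ tt)) s v

    -- Tape 0 carries the output and tape `i + 1` the register `i`. The mark behind the output keeps
    -- `leadingBits` from running on into the input, which is still on that tape as part of `rest`.
    record Represents (w : List Bool) (σ : Registers) (o : List Bool) (ts : Vec (Tape 1) (2 + R)) : Set where
      constructor represents
      field
        pointers : ∀ {i} → i ≤ R → Points (contents w i) (σ i) (lookup ts (suc (clamp R i)))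
        {rest}   : List Sym₁
        outTape  : lookup ts zero ≡ tape [] blank (List.map bit o ++ mark ∷ rest)

    module _ {w : List Bool} {σ : Registers} {o : List Bool} {ts : Vec (Tape 1) (2 + R)} where

      after : Action → Vec (Tape 1) (2 + R)
      after f = zipWith writeMove (acts f (Vec.map Tape.scanned ts)) ts

      represents-idle : Represents w σ o ts → Represents w σ o (after λ _ → idle)
      represents-idle (represents P O) = represents
        (λ {i} i≤R → subst (Points (contents w i) (σ i)) (sym (lookup-acts (λ _ → idle) ts (suc (clamp R i)))) (P i≤R))
        (trans (lookup-acts (λ _ → idle) ts zero) O)

      represents-moving : ∀ {τ i} m → i ≤ R →
        (∀ t → Points (contents w i) (σ i) t → Points (contents w i) (τ i) (move m t)) →
        (∀ j → j ≢ i → τ j ≡ σ j) → Represents w σ o ts → Represents w τ o (after (moving i m))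
      represents-moving {τ} {i} m i≤R P→Q same (represents P O) = represents Q
        (trans (lookup-acts (moving i m) ts zero) O)
        where
        Q : ∀ {j} → j ≤ R → Points (contents w j) (τ j) (lookup (after (moving i m)) (suc (clamp R j)))
        Q {j} j≤R rewrite lookup-acts (moving i m) ts (suc (clamp R j)) with clamp R j ≟ᶠ clamp R i
        ... | no  ne = subst (λ p → Points (contents w j) p (lookup ts (suc (clamp R j))))
                             (sym (same j (λ eq → ne (cong (clamp R) eq)))) (P j≤R)
        ... | yes eq with refl ← clamp-injective j≤R i≤R eq = P→Q _ (P i≤R)

      represents-writing : ∀ b → Represents w σ o ts → Represents w σ (b ∷ o) (after (writing b))
      represents-writing b (represents P O) = represents
        (λ {i} i≤R → subst (Points (contents w i) (σ i)) (sym (lookup-acts (writing b) ts (suc (clamp R i)))) (P i≤R))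
        (trans (lookup-acts (writing b) ts zero) (cong (writeMove (bit b , left)) O))

      represents-scanned : ∀ {i} → i ≤ R → Represents w σ o ts →
        lookup (Vec.map Tape.scanned ts) (suc (clamp R i)) ≡ contents w i (σ i)
      represents-scanned {i} i≤R (represents P O) =
        trans (lookup-map (suc (clamp R i)) Tape.scanned ts) (points-scanned _ (P i≤R))

    contents-zero : ∀ w i → contents w i 0 ≡ mark
    contents-zero w zero    = refl
    contents-zero w (suc i) = refl

    module Correct
      {X : Set} (coding : Coding X) (begin : X) (acc : X → Bool)
      (δX : X → Vec Sym₁ (2 + R) → Maybe (X × Vec (Sym₁ × Move) (2 + R)))
      where

      open Coding coding
      open Machine coding 1 (suc R) begin acc δX

      Embeds : (p : Program) → (State p → X) → X → Set
      Embeds p e x = ∀ s v → δX (e s) v ≡ just (let y , f = transition p e x s v in y , acts f v)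

      one : ∀ {x y} f ts → δX x (scan ts) ≡ just (y , acts f (scan ts)) →
            config (code x) ts ⟶[ 1 ] config (code y) (zipWith writeMove (acts f (scan ts)) ts)
      one f ts eq = step (next-just _ ts eq) here

      -- Step for step simulation, by induction on the run, so program time is machine time.
      -- `Embeds` passes to subprograms because `transition` calls itself with the composed
      -- embedding.
      correct : ∀ {w p σ o t τ o′} → Runs w p σ o t τ o′ → maxRegister p ≤ R →
        ∀ e x → Embeds p e x → ∀ {ts} → Represents w σ o ts →
        ∃[ ts′ ] Represents w τ o′ ts′ × config (code (e (entry p))) ts ⟶[ t ] config (code x) ts′
      correct skip m e x E {ts} ρ = _ , represents-idle ρ , one (λ _ → idle) ts (E tt _)
      correct {w} (inc {i} {σ} eq same) m e x E {ts} ρ = _ ,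
        represents-moving right m (λ t P → subst (λ p → Points (contents w i) p (move right t)) (sym eq) (points-right t P)) same ρ ,
        one (moving i right) ts (E tt _)
      correct {w} (dec {i} {σ} eq same) m e x E {ts} ρ = _ ,
        represents-moving left m (λ t P → points-left t (subst (λ p → Points (contents w i) p t) eq P)) same ρ ,
        one (moving i left) ts (E tt _)
      correct (emit {b}) m e x E {ts} ρ = _ , represents-writing b ρ , one (writing b) ts (E tt _)
      correct (_⨾_ {p} {q} r s) m e x E ρ
        with ts₁ , ρ₁ , r₁ ← correct r (m⊔n≤o⇒m≤o (maxRegister p) _ m) (e ∘ inj₁) _ (λ s → E (inj₁ s)) ρ
        with ts₂ , ρ₂ , r₂ ← correct s (m⊔n≤o⇒n≤o (maxRegister p) _ m) (e ∘ inj₂) x (λ s → E (inj₂ s)) ρ₁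
        = ts₂ , ρ₂ , r₁ ▷ r₂
      correct {w} (true {i} {c} {p} {q} {σ} eq r) m e x E {ts} ρ
        with ts₁ , ρ₁ , r₁ ← correct r (m⊔n≤o⇒m≤o (maxRegister p) _ (m⊔n≤o⇒n≤o i _ m)) (e ∘ inj₂ ∘ inj₁) x (λ s → E (inj₂ (inj₁ s))) (represents-idle ρ)
        = ts₁ , ρ₁ , one (λ _ → idle) ts eq′ ▷ r₁
        where
        eq′ : δX (e (inj₁ tt)) (scan ts) ≡ just (e (inj₂ (inj₁ (entry p))) , acts (λ _ → idle) (scan ts))
        eq′ rewrite E (inj₁ tt) (scan ts) | represents-scanned (m⊔n≤o⇒m≤o i _ m) ρ | eq = refl
      correct {w} (false {i} {c} {p} {q} {σ} eq r) m e x E {ts} ρ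
        with ts₁ , ρ₁ , r₁ ← correct r (m⊔n≤o⇒n≤o (maxRegister p) _ (m⊔n≤o⇒n≤o i _ m)) (e ∘ inj₂ ∘ inj₂) x (λ s → E (inj₂ (inj₂ s))) (represents-idle ρ)
        = ts₁ , ρ₁ , one (λ _ → idle) ts eq′ ▷ r₁
        where
        eq′ : δX (e (inj₁ tt)) (scan ts) ≡ just (e (inj₂ (inj₂ (entry q))) , acts (λ _ → idle) (scan ts))
        eq′ rewrite E (inj₁ tt) (scan ts) | represents-scanned (m⊔n≤o⇒m≤o i _ m) ρ | eq = refl
      correct {w} (stop {i} {p} {σ} eq) m e x E {ts} ρ = _ , represents-idle ρ , one (λ _ → idle) ts eq′
        where
        eq′ : δX (e (inj₁ tt)) (scan ts) ≡ just (x , acts (λ _ → idle) (scan ts))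
        eq′ rewrite E (inj₁ tt) (scan ts) | represents-scanned (m⊔n≤o⇒m≤o i _ m) ρ | eq | contents-zero w i = refl
      correct {w} (loop {i} {p} {σ} {s = s} eq r r′) m e x E {ts} ρ
        with ts₁ , ρ₁ , r₁ ← correct r (m⊔n≤o⇒n≤o i _ m) (e ∘ inj₂) _ (λ s → E (inj₂ s)) (represents-idle ρ)
        with ts₂ , ρ₂ , r₂ ← correct r′ m e x E ρ₁
        = ts₂ , ρ₂ , one (λ _ → idle) ts eq′ ▷ (r₁ ▷ r₂)
        where
        eq′ : δX (e (inj₁ tt)) (scan ts) ≡ just (e (inj₂ (entry p)) , acts (λ _ → idle) (scan ts))
        eq′ rewrite E (inj₁ tt) (scan ts) | represents-scanned (m⊔n≤o⇒m≤o i _ m) ρ | eq = refl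

-- The complete machine of a program: setting up the tapes, running, halting.

module Interpreter where

  open Machines
  open import Data.Vec.Base using (replicate)

  -- `marking` marks cell 0 of all register tapes; `copying` copies the input behind the mark of
  -- register 0 while register 1 counts its length; `rewinding` returns to that mark; after the
  -- program, `finishing` moves the output head onto the output.
  data Phase : Set where
    marking copying rewinding finishing : Phase
    halted : Bool → Phase

  phase-coding : Coding Phase
  phase-coding = record { size = 6 ; code = code ; decode = decode ; decode-code = decode-code }
    where
    code : Phase → Fin 6
    code marking        = zero
    code copying        = suc zero
    code rewinding      = suc (suc zero)
    code finishing      = suc (suc (suc zero))
    code (halted false) = suc (suc (suc (suc zero)))
    code (halted true)  = suc (suc (suc (suc (suc zero))))

    decode : Fin 6 → Phase
    decode zero                                = marking
    decode (suc zero)                          = copying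
    decode (suc (suc zero))                    = rewinding
    decode (suc (suc (suc zero)))              = finishing
    decode (suc (suc (suc (suc zero))))        = halted false
    decode (suc (suc (suc (suc (suc zero)))))  = halted true

    decode-code : ∀ a → decode (code a) ≡ a
    decode-code marking        = refl
    decode-code copying        = refl
    decode-code rewinding      = refl
    decode-code finishing      = refl
    decode-code (halted false) = refl
    decode-code (halted true)  = refl

  fresh : Tape 1
  fresh = tape [] mark []

  zipWith-mark : ∀ k →
    zipWith writeMove (Vec.map (λ _ → mark , stay) (Vec.map Tape.scanned (replicate k (emptyTape {1})))) (replicate k emptyTape)
    ≡ replicate k fresh
  zipWith-mark zero    = refl
  zipWith-mark (suc k) = cong (fresh ∷_) (zipWith-mark k)

  inputFrom : List Sym₁ → List Bool → Tape 1
  inputFrom ls []       = tape ls blank []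
  inputFrom ls (b ∷ bs) = tape ls (bit b) (List.map bit bs)

  inputFrom-right : ∀ ls b bs → move right (inputFrom ls (b ∷ bs)) ≡ inputFrom (bit b ∷ ls) bs
  inputFrom-right ls b []       = refl
  inputFrom-right ls b (c ∷ bs) = refl

  inputTape-from : ∀ w → writeMove (idle (Tape.scanned (inputTape w))) (inputTape w) ≡ inputFrom [] w
  inputTape-from []      = refl
  inputTape-from (b ∷ w) = refl

  nth-++-blank : ∀ (as : List Sym₁) n → nth (as ++ blank ∷ []) n ≡ nth as n
  nth-++-blank []       zero    = refl
  nth-++-blank []       (suc n) = refl
  nth-++-blank (a ∷ as) zero    = refl
  nth-++-blank (a ∷ as) (suc n) = nth-++-blank as n

  leadingBits-mark : ∀ o rest → leadingBits {1} (List.map bit o ++ mark ∷ rest) ≡ o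
  leadingBits-mark []      rest = refl
  leadingBits-mark (b ∷ o) rest = cong (b ∷_) (leadingBits-mark o rest)

  initialRegisters : List Bool → Registers
  initialRegisters w zero          = 0
  initialRegisters w (suc zero)    = length w
  initialRegisters w (suc (suc i)) = 0

  module Execution (p : Program) where

    r R : ℕ
    r = maxRegister p
    R = 3 + r

    open Compiler R

    advancing : Action
    advancing zero    s = s , right
    advancing (suc j) s = idle s

    Q : Set
    Q = Phase ⊎ State p

    accept : Q → Bool
    accept (inj₁ (halted b)) = b
    accept _                 = false

    copyStep : Vec Sym₁ (2 + R) → Q × Vec (Sym₁ × Move) (2 + R)
    copyStep (bit b ∷ s₁ ∷ s₂ ∷ v) =
      inj₁ copying , (bit b , right) ∷ (bit b , right) ∷ (s₂ , right) ∷ Vec.map idle v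
    copyStep v = inj₁ rewinding , Vec.map idle v

    rewindStep : Bool → Vec Sym₁ (2 + R) → Q × Vec (Sym₁ × Move) (2 + R)
    rewindStep true  (s₀ ∷ s₁ ∷ v) = inj₁ rewinding , (s₀ , left) ∷ (s₁ , left) ∷ Vec.map idle v
    rewindStep false (s₀ ∷ v)      = inj₂ (entry p) , (mark , left) ∷ Vec.map idle v

    δX : Q → Vec Sym₁ (2 + R) → Maybe (Q × Vec (Sym₁ × Move) (2 + R))
    δX (inj₁ marking) (s₀ ∷ s₁ ∷ v) =
      just (inj₁ copying , (s₀ , stay) ∷ (mark , right) ∷ Vec.map (λ _ → mark , stay) v)
    δX (inj₁ copying)   v = just (copyStep v)
    δX (inj₁ rewinding) v = just (rewindStep (test nonzero (lookup v (suc zero))) v)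
    δX (inj₁ finishing) v =
      just (inj₁ (halted (test nonzero (lookup v (suc (suc (suc zero)))))) , acts advancing v)
    δX (inj₁ (halted b)) v = nothing
    δX (inj₂ s) v = just (let y , f = transition p inj₂ (inj₁ finishing) s v in y , acts f v)

    coding : Coding Q
    coding = ⊎-coding phase-coding (state-coding p)

    open Coding coding
    open Machine coding 1 (suc R) (inj₁ marking) accept δX public
    open Correct coding (inj₁ marking) accept δX

    rest : Vec (Tape 1) (2 + r)
    rest = replicate (2 + r) fresh

    config-cong : ∀ {q t₀ t₀′ t₁ t₂} {ts ts′ : Vec (Tape 1) (2 + r)} → t₀ ≡ t₀′ → ts ≡ ts′ →
      just (config q (t₀ ∷ t₁ ∷ t₂ ∷ ts)) ≡ just (config q (t₀′ ∷ t₁ ∷ t₂ ∷ ts′))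
    config-cong refl refl = refl

    copy : ∀ b ls₀ ls₁ {n} t₂ → Points (nth (mark ∷ [])) n t₂ →
      ∃[ t₂′ ] Points (nth (mark ∷ [])) (length b + n) t₂′ ×
      config (code (inj₁ copying)) (inputFrom ls₀ b ∷ tape ls₁ blank [] ∷ t₂ ∷ rest)
        ⟶[ suc (length b) ]
      config (code (inj₁ rewinding))
        (tape (List.map bit b ʳ++ ls₀) blank [] ∷ tape (List.map bit b ʳ++ ls₁) blank [] ∷ t₂′ ∷ rest)
    copy [] ls₀ ls₁ t₂ P = t₂ , P ,
      step (trans (next-just (inj₁ copying) (tape ls₀ blank [] ∷ tape ls₁ blank [] ∷ t₂ ∷ rest) refl)
                  (config-cong refl (writeMove-idle rest))) here
    copy (b ∷ bs) ls₀ ls₁ {n} t₂ P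
      with t₂′ , P′ , q ← copy bs (bit b ∷ ls₀) (bit b ∷ ls₁) (move right t₂) (points-right t₂ P)
      = t₂′ , subst (λ n → Points (nth (mark ∷ [])) n t₂′) (+-suc (length bs) n) P′ ,
        step (trans (next-just (inj₁ copying) (inputFrom ls₀ (b ∷ bs) ∷ tape ls₁ blank [] ∷ t₂ ∷ rest) refl)
                    (config-cong (inputFrom-right ls₀ b bs) (writeMove-idle rest)))
             q

    -- The tape of register 0 is one cell longer than the input because of its mark, hence `n ∸ 1`.
    -- So the head of tape 0 arrives at the blank before the input and writes there the mark that
    -- separates output from input.
    rewind : ∀ w n ls h rs t₁ t₂ → length ls ≡ n ∸ 1 → Points (contents w 0) n t₁ →
      test nonzero (contents w 0 0) ≡ false →
      (∀ m → test nonzero (contents w 0 (suc m)) ≡ true) →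
      ∃[ t₁′ ] ∃[ rs′ ] Points (contents w 0) 0 t₁′ ×
      config (code (inj₁ rewinding)) (tape ls h rs ∷ t₁ ∷ t₂ ∷ rest)
        ⟶[ suc n ]
      config (code (inj₂ (entry p))) (tape [] blank (mark ∷ rs′) ∷ t₁′ ∷ t₂ ∷ rest)
    rewind w zero [] h rs t₁ t₂ eq P z nz = t₁ , rs , P ,
      step (trans (next-just (inj₁ rewinding) (tape [] h rs ∷ t₁ ∷ t₂ ∷ rest)
                    (cong (λ b → just (rewindStep b (h ∷ Vec.map Tape.scanned (t₁ ∷ t₂ ∷ rest))))
                      (trans (cong (test nonzero) (points-scanned {p = 0} t₁ P)) z)))
                  (config-cong refl (writeMove-idle rest))) here
    rewind w (suc n) ls h rs t₁ t₂ eq P z nz = extend ls eq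
      where
      first : ∀ {ls} → next (config (code (inj₁ rewinding)) (tape ls h rs ∷ t₁ ∷ t₂ ∷ rest)) ≡
        just (config (code (inj₁ rewinding)) (move left (tape ls h rs) ∷ move left t₁ ∷ t₂ ∷ rest))
      first {ls} = trans (next-just (inj₁ rewinding) (tape ls h rs ∷ t₁ ∷ t₂ ∷ rest)
                    (cong (λ b → just (rewindStep b (h ∷ Vec.map Tape.scanned (t₁ ∷ t₂ ∷ rest))))
                      (trans (cong (test nonzero) (points-scanned {p = suc n} t₁ P)) (nz n))))
                  (config-cong refl (writeMove-idle rest))

      extend : ∀ ls → length ls ≡ n → ∃[ t₁′ ] ∃[ rs′ ] Points (contents w 0) 0 t₁′ ×
        config (code (inj₁ rewinding)) (tape ls h rs ∷ t₁ ∷ t₂ ∷ rest)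
          ⟶[ suc (suc n) ]
        config (code (inj₂ (entry p))) (tape [] blank (mark ∷ rs′) ∷ t₁′ ∷ t₂ ∷ rest)
      extend [] refl
        with t₁′ , rs′ , P′ , q ← rewind w n [] blank (h ∷ rs) (move left t₁) t₂ refl (points-left t₁ P) z nz
        = t₁′ , rs′ , P′ , step first q
      extend (l ∷ ls) refl
        with t₁′ , rs′ , P′ , q ← rewind w n ls l (h ∷ rs) (move left t₁) t₂ refl (points-left t₁ P) z nz
        = t₁′ , rs′ , P′ , step first q

    prepare : ∀ w → ∃[ ts ] Represents w (initialRegisters w) [] ts ×
      initial w ⟶[ 1 + (suc (length w) + suc (suc (length w))) ] config (code (inj₂ (entry p))) ts
    prepare w
      with t₂ , P₂ , q ← copy w [] (mark ∷ []) fresh (points-zipper [] mark [])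
      with t₁ , rs , P₁ , q′ ← rewind w (suc (length w)) (List.map bit w ʳ++ []) blank []
             (tape (List.map bit w ʳ++ (mark ∷ [])) blank []) t₂
             (trans (length-ʳ++ (List.map bit w)) (trans (+-identityʳ _) (length-map bit w)))
             (subst (λ n → Points (contents w 0) n (tape (List.map bit w ʳ++ (mark ∷ [])) blank []))
               (trans (length-ʳ++ (List.map bit w)) (trans (+-comm _ 1) (cong suc (length-map bit w))))
               (λ n → trans (points-zipper (List.map bit w ʳ++ (mark ∷ [])) blank [] n)
                      (trans (cong (λ as → nth as n) (ʳ++-ʳ++ (List.map bit w)))
                             (nth-++-blank (mark ∷ List.map bit w) n))))
             refl (contents-suc w 0)
      = _ , ρ , step first (q ▷ q′)
      where
      first : next (initial w) ≡
        just (config (code (inj₁ copying)) (inputFrom [] w ∷ tape (mark ∷ []) blank [] ∷ fresh ∷ rest))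
      first = trans (next-just (inj₁ marking) (inputTape w ∷ replicate (suc R) emptyTape) refl)
                (config-cong (inputTape-from w) (zipWith-mark (2 + r)))

      ρ : Represents w (initialRegisters w) [] _
      ρ = represents pointers refl
        where
        pointers : ∀ {i} → i ≤ R → Points (contents w i) (initialRegisters w i)
          (lookup (tape [] blank (mark ∷ rs) ∷ t₁ ∷ t₂ ∷ rest) (suc (clamp R i)))
        pointers {zero}        i≤R = P₁
        pointers {suc zero}    i≤R = subst (λ n → Points _ n t₂) (+-identityʳ (length w)) P₂
        pointers {suc (suc i)} i≤R n =
          trans (cong (λ t → at t (n ⊝ 0)) (lookup-replicate (clamp (suc r) i) fresh)) (points-zipper [] mark [] n)

    -- Acceptance is read off register 2, on tape 3, where the value of a computed expression is
    -- left.
    finish : ∀ w σ o ts → Represents w σ o ts → ∃[ c ]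
      config (code (inj₁ finishing)) ts ⟶[ 1 ] c × next c ≡ nothing × output c ≡ o ×
      TM.accepting machine (Config.state c) ≡ test nonzero (contents w 2 (σ 2))
    finish w σ o ts ρ =
      config (code (inj₁ (halted (test nonzero (lookup (scan ts) (suc (suc (suc zero))))))))
             (zipWith writeMove (acts advancing (scan ts)) ts) ,
      step (next-just (inj₁ finishing) ts refl) here ,
      next-nothing {inj₁ (halted (test nonzero (lookup (scan ts) (suc (suc (suc zero))))))} (zipWith writeMove (acts advancing (scan ts)) ts) refl ,
      trans (cong outputOf (trans (lookup-acts advancing ts zero)
                                  (cong (writeMove′ right) (Represents.outTape ρ))))
            (outputOf-right o) ,
      trans (cong accept (decode-code (inj₁ (halted (test nonzero (lookup (scan ts) (suc (suc (suc zero)))))))))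
            (cong (test nonzero) (represents-scanned {i = 2} (s≤s (s≤s z≤n)) ρ))
      where
      writeMove′ : Move → Tape 1 → Tape 1
      writeMove′ m t = writeMove (Tape.scanned t , m) t

      outputOf-right : ∀ o {rest} → outputOf (move right (tape [] blank (List.map bit o ++ mark ∷ rest))) ≡ o
      outputOf-right []      = refl
      outputOf-right (b ∷ o) = cong (b ∷_) (leadingBits-mark o _)

    execute : ∀ w {t τ o} → Runs w p (initialRegisters w) [] t τ o →
      ∃[ c ] initial w ⇓[ 1 + (suc (length w) + suc (suc (length w))) + (t + 1) ] c × output c ≡ o ×
      TM.accepting machine (Config.state c) ≡ test nonzero (contents w 2 (τ 2))
    execute w run
      with ts , ρ , q ← prepare w
      with ts′ , ρ′ , q′ ← correct run (m≤n+m r 3) inj₂ (inj₁ finishing) (λ s v → refl) ρ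
      with c , q″ , stopped , out , acc ← finish w _ _ ts′ ρ′
      = c , ((q ▷ (q′ ▷ q″)) ▷halt stopped) , out , acc

-- Bounded arithmetic on the input bits, compiled with polynomial time bounds.

module Expressions where

  open Machines

  sum : ℕ → (ℕ → ℕ) → ℕ
  sum zero    f = 0
  sum (suc n) f = f n + sum n f

  sum-const : ∀ n k → sum n (λ _ → k) ≡ n * k
  sum-const zero    k = refl
  sum-const (suc n) k = cong (k +_) (sum-const n k)

  sum-ones : ∀ n → sum n (λ _ → 1) ≡ n
  sum-ones n = trans (sum-const n 1) (*-identityʳ n)

  bitAt : List Bool → ℕ → ℕ
  bitAt []          n       = 0
  bitAt (true  ∷ w) zero    = 1
  bitAt (false ∷ w) zero    = 0
  bitAt (b     ∷ w) (suc n) = bitAt w n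

  -- Iteration occurs only with a count that is computed beforehand, so values and running times are
  -- bounded by recursion on the syntax. The input is accessed through `inp` alone.
  data Expr (n : ℕ) : Set where
    var         : Fin n → Expr n
    con         : ℕ → Expr n
    _⊕_ _⊗_ _⊖_ : Expr n → Expr n → Expr n
    ∑           : Expr n → Expr (suc n) → Expr n
    inp         : Expr n → Expr n

  infixl 6 _⊕_ _⊖_
  infixl 7 _⊗_

  eval : ∀ {n} → List Bool → Expr n → Vec ℕ n → ℕ
  eval w (var i) ρ = lookup ρ i
  eval w (con k) ρ = k
  eval w (e ⊕ f) ρ = eval w e ρ + eval w f ρ
  eval w (e ⊗ f) ρ = eval w e ρ * eval w f ρ
  eval w (e ⊖ f) ρ = eval w e ρ ∸ eval w f ρ
  eval w (∑ e f) ρ = sum (eval w e ρ) λ i → eval w f (i ∷ ρ)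
  eval w (inp e) ρ = bitAt w (eval w e ρ)

  infixl 8 _[_≔_]
  _[_≔_] : Registers → ℕ → ℕ → Registers
  (σ [ i ≔ v ]) j = if does (j ≟ i) then v else σ j

  update-same : ∀ σ i {v} → (σ [ i ≔ v ]) i ≡ v
  update-same σ i rewrite dec-true (i ≟ i) refl = refl

  update-other : ∀ σ i {v} j → j ≢ i → (σ [ i ≔ v ]) j ≡ σ j
  update-other σ i j ne rewrite dec-false (j ≟ i) ne = refl

  test-suc : ∀ w i {m n} → m ≡ suc n → test nonzero (contents w i m) ≡ true
  test-suc w i {n = n} refl = contents-suc w i n

  module _ {w : List Bool} where

    run-inc : ∀ i σ {o} → Runs w (inc i) σ o 1 (σ [ i ≔ suc (σ i) ]) o
    run-inc i σ = inc (update-same σ i) (update-other σ i)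

    run-dec : ∀ i σ {n o} → σ i ≡ suc n → Runs w (dec i) σ o 1 (σ [ i ≔ n ]) o
    run-dec i σ eq = dec (trans eq (cong suc (sym (update-same σ i)))) (update-other σ i)

    -- Loop rule for a counter in register `i`, where `I n` is the invariant with `n` rounds to go.
    -- A round costs `2 + B`: the test, the decrement and the body.
    countdown : ∀ i body B (I : ℕ → Registers → List Bool → Set) →
      (∀ {n σ o} → I n σ o → σ i ≡ n) →
      (∀ n {σ o} → I (suc n) σ o →
        ∃[ t ] ∃[ τ ] ∃[ o′ ] Runs w body (σ [ i ≔ n ]) o t τ o′ × t ≤ B × I n τ o′) →
      ∀ n {σ o} → I n σ o →
      ∃[ t ] ∃[ τ ] ∃[ o′ ] Runs w (while i (dec i ⨾ body)) σ o t τ o′ × t ≤ 1 + n * (2 + B) × I 0 τ o′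
    countdown i body B I value iterate zero    Iσ = 1 , _ , _ , stop (value Iσ) , ≤-refl , Iσ
    countdown i body B I value iterate (suc n) {σ} Iσ
      with s , τ , o₁ , r , s≤B , Iτ ← iterate n Iσ
      with t , υ , o₂ , q , t≤ , Iυ ← countdown i body B I value iterate n Iτ
      = _ , υ , o₂ , loop (test-suc w i (value Iσ)) (run-dec i σ (value Iσ) ⨾ r) q ,
        s≤s (≤-trans (s≤s (+-mono-≤ s≤B t≤))
          (≤-reflexive (cong suc (+-suc B (n * (2 + B)))))) , Iυ

    -- The loop variable i takes the values N - 1, …, 0.
    accumulate : ∀ i d body B N (g : ℕ → ℕ) σ {o} → i ≢ d → σ i ≡ N →
      (∀ n → n < N → ∀ τ → τ i ≡ n → (∀ j → j ≢ i → j ≢ d → τ j ≡ σ j) →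
        ∃[ t ] ∃[ υ ] Runs w body τ o t υ o × t ≤ B × υ d ≡ τ d + g n × (∀ j → j ≢ d → υ j ≡ τ j)) →
      ∃[ t ] ∃[ τ ] Runs w (while i (dec i ⨾ body)) σ o t τ o × t ≤ 1 + N * (2 + B) ×
        τ i ≡ 0 × τ d ≡ σ d + sum N g × (∀ j → j ≢ i → j ≢ d → τ j ≡ σ j)
    accumulate i d body B N g σ {o} i≢d σi iterate =
      finish (countdown i body B I proj₁ next N (σi , refl , (λ _ _ _ → refl) , ≤-refl , refl))
      where
      Loop = while i (dec i ⨾ body)

      I : ℕ → Registers → List Bool → Set
      I n τ o′ = τ i ≡ n × τ d + sum n g ≡ σ d + sum N g ×
                 (∀ j → j ≢ i → j ≢ d → τ j ≡ σ j) × n ≤ N × o′ ≡ o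

      next : ∀ n {τ o′} → I (suc n) τ o′ →
        ∃[ t ] ∃[ υ ] ∃[ o″ ] Runs w body (τ [ i ≔ n ]) o′ t υ o″ × t ≤ B × I n υ o″
      next n {τ} (a , b , c , n<N , refl)
        with t , υ , r , t≤B , x , y ← iterate n n<N (τ [ i ≔ n ]) (update-same τ i)
               (λ j j≢i j≢d → trans (update-other τ i j j≢i) (c j j≢i j≢d))
        = t , υ , o , r , t≤B ,
          ( trans (y i i≢d) (update-same τ i)
          , trans (cong (_+ sum n g) (trans x (cong (_+ g n) (update-other τ i d (i≢d ∘ sym)))))
                  (trans (+-assoc (τ d) (g n) (sum n g)) b)
          , (λ j j≢i j≢d → trans (y j j≢d) (trans (update-other τ i j j≢i) (c j j≢i j≢d)))
          , ≤-trans (n≤1+n n) n<N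
          , refl )

      finish : ∃[ t ] ∃[ τ ] ∃[ o′ ] Runs w Loop σ o t τ o′ × t ≤ 1 + N * (2 + B) × I 0 τ o′ →
        ∃[ t ] ∃[ τ ] Runs w Loop σ o t τ o × t ≤ 1 + N * (2 + B) ×
          τ i ≡ 0 × τ d ≡ σ d + sum N g × (∀ j → j ≢ i → j ≢ d → τ j ≡ σ j)
      finish (t , τ , _ , r , t≤ , (a , b , c , _ , refl)) =
        t , τ , r , t≤ , a , trans (sym (+-identityʳ _)) b , c

  incs : ℕ → ℕ → Program
  incs zero    d = skip
  incs (suc k) d = inc d ⨾ incs k d

  -- Adds the value of the expression to register d.  The registers from f
  -- on are 0 before and after.
  compute : ∀ {n} → Expr n → Vec ℕ n → (d f : ℕ) → Program
  compute (var i) vs d f =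
    -- Reading a counter destroys it; the second copy, in `f`, restores `v`.
    while v (dec v ⨾ inc d ⨾ inc f) ⨾ while f (dec f ⨾ inc v)
    where
    v = lookup vs i
  compute (con k) vs d f = incs k d
  compute (e ⊕ g) vs d f = compute e vs d f ⨾ compute g vs d f
  compute (e ⊗ g) vs d f =
    compute e vs f (suc f) ⨾ while f (dec f ⨾ compute g vs d (suc f))
  compute (e ⊖ g) vs d f =
    -- The second value, in `suc f`, is counted down against the first; the branch stops `f` at 0,
    -- which makes the subtraction truncated.
    compute e vs f (suc f) ⨾ compute g vs (suc f) (2 + f) ⨾
    while (suc f) (dec (suc f) ⨾ branch f nonzero (dec f) skip) ⨾
    while f (dec f ⨾ inc d)
  compute (∑ e g) vs d f =
    compute e vs f (suc f) ⨾ while f (dec f ⨾ compute g (f ∷ vs) d (suc f))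
  compute (inp e) vs d f =
    -- The additional `inc 0` steps over the mark in cell 0; the final loop takes the pointer back
    -- to it.
    compute e vs f (suc f) ⨾ while f (dec f ⨾ inc 0) ⨾ inc 0 ⨾
    branch 0 isTrue (inc d) skip ⨾ while 0 (dec 0 ⨾ skip)

  -- Bounds in terms of the input length. They are monotone, having coefficients in `ℕ`, so a
  -- difference is bounded by its minuend.
  size : ∀ {n} → Expr n → Vec Polynomial n → Polynomial
  size (var i) bs = lookup bs i
  size (con k) bs = con k
  size (e ⊕ g) bs = size e bs :+ size g bs
  size (e ⊗ g) bs = size e bs :* size g bs
  size (e ⊖ g) bs = size e bs
  size (∑ e g) bs = size e bs :* size g (size e bs ∷ bs)
  size (inp e) bs = con 1

  -- Mirrors `compute`: a loop over a value of at most `s` contributes `1 + s * (2 + body)`.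
  time : ∀ {n} → Expr n → Vec Polynomial n → Polynomial
  time (var i) bs = (con 1 :+ (lookup bs i :* con 4)) :+ (con 1 :+ (lookup bs i :* con 3))
  time (con k) bs = con (suc k)
  time (e ⊕ g) bs = time e bs :+ time g bs
  time (e ⊗ g) bs = time e bs :+ (con 1 :+ (size e bs :* (con 2 :+ time g bs)))
  time (e ⊖ g) bs = time e bs :+ (time g bs :+ ((con 1 :+ (size g bs :* con 4)) :+ (con 1 :+ (size e bs :* con 3))))
  time (∑ e g) bs = time e bs :+ (con 1 :+ (size e bs :* (con 2 :+ time g (size e bs ∷ bs))))
  time (inp e) bs = time e bs :+ ((con 1 :+ (size e bs :* con 3)) :+ (con 1 :+ (con 2 :+ (con 1 :+ ((con 1 :+ size e bs) :* con 3)))))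

  sum-mono : ∀ n {f : ℕ → ℕ} {B} → (∀ i → i < n → f i ≤ B) → sum n f ≤ n * B
  sum-mono zero    h = z≤n
  sum-mono (suc n) h = +-mono-≤ (h n ≤-refl) (sum-mono n (λ i i<n → h i (m≤n⇒m≤1+n i<n)))

  bitAt≤1 : ∀ w n → bitAt w n ≤ 1
  bitAt≤1 []          n       = z≤n
  bitAt≤1 (true  ∷ w) zero    = ≤-refl
  bitAt≤1 (false ∷ w) zero    = z≤n
  bitAt≤1 (true  ∷ w) (suc n) = bitAt≤1 w n
  bitAt≤1 (false ∷ w) (suc n) = bitAt≤1 w n

  Bounded : ∀ {n} → ℕ → Vec Polynomial n → Vec ℕ n → Set
  Bounded N bs ρ = ∀ i → lookup ρ i ≤ ⟦ lookup bs i ⟧ N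

  bounded-∷ : ∀ {n N b v} {bs : Vec Polynomial n} {ρ} → v ≤ ⟦ b ⟧ N → Bounded N bs ρ → Bounded N (b ∷ bs) (v ∷ ρ)
  bounded-∷ h H zero    = h
  bounded-∷ h H (suc i) = H i

  eval≤size : ∀ {n} w (e : Expr n) {bs ρ N} → Bounded N bs ρ → eval w e ρ ≤ ⟦ size e bs ⟧ N
  eval≤size w (var i) H = H i
  eval≤size w (con k) H = ≤-refl
  eval≤size w (e ⊕ g) H = +-mono-≤ (eval≤size w e H) (eval≤size w g H)
  eval≤size w (e ⊗ g) H = *-mono-≤ (eval≤size w e H) (eval≤size w g H)
  eval≤size w (e ⊖ g) {ρ = ρ} H = ≤-trans (m∸n≤m _ (eval w g ρ)) (eval≤size w e H)
  eval≤size w (∑ e g) {ρ = ρ} H =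
    ≤-trans (sum-mono (eval w e ρ) (λ i i<n →
              eval≤size w g (bounded-∷ (≤-trans (<⇒≤ i<n) (eval≤size w e H)) H)))
            (*-monoˡ-≤ _ (eval≤size w e H))
  eval≤size w (inp e) {ρ = ρ} H = bitAt≤1 w (eval w e ρ)

  -- The register discipline: the input pointer rests on the mark, variables and destination lie
  -- below `f`, and from `f` on there is scratch space, all 0. `vs≢d` protects the variables from
  -- accumulation in `d`.
  record Ready {n} (vs : Vec ℕ n) (d f : ℕ) (σ : Registers) (ρ : Vec ℕ n) : Set where
    field
      0<d   : 0 < d
      d<f   : d < f
      0<vs  : ∀ i → 0 < lookup vs i
      vs<f  : ∀ i → lookup vs i < f
      vs≢d  : ∀ i → lookup vs i ≢ d
      input : σ 0 ≡ 0
      free  : ∀ j → f ≤ j → σ j ≡ 0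
      value : ∀ i → σ (lookup vs i) ≡ lookup ρ i

    d≢f : d ≢ f
    d≢f = <⇒≢ d<f

    f≢0 : f ≢ 0
    f≢0 eq = n≮0 (subst (d <_) eq d<f)

  module _ {n} {vs : Vec ℕ n} {d f : ℕ} {σ : Registers} {ρ : Vec ℕ n} (R : Ready vs d f σ ρ) where

    open Ready R

    0<f : 0 < f
    0<f = <-trans 0<d d<f

    ready-temp : Ready vs f (suc f) σ ρ
    ready-temp = record
      { 0<d = 0<f ; d<f = ≤-refl ; 0<vs = 0<vs ; vs<f = λ i → m≤n⇒m≤1+n (vs<f i)
      ; vs≢d = λ i → <⇒≢ (vs<f i) ; input = input
      ; free = λ j le → free j (<⇒≤ le) ; value = value }

    ready-later : ∀ {τ} → (∀ j → j ≢ f → j ≢ d → τ j ≡ σ j) → Ready vs d (suc f) τ ρ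
    ready-later same = record
      { 0<d = 0<d ; d<f = m≤n⇒m≤1+n d<f ; 0<vs = 0<vs ; vs<f = λ i → m≤n⇒m≤1+n (vs<f i)
      ; vs≢d = vs≢d
      ; input = trans (same 0 (f≢0 ∘ sym) (<⇒≢ 0<d)) input
      ; free = λ j le → trans (same j (<⇒≢ le ∘ sym) (<⇒≢ (<-trans d<f le) ∘ sym)) (free j (<⇒≤ le))
      ; value = λ i → trans (same _ (<⇒≢ (vs<f i)) (vs≢d i)) (value i) }

    ready-bind : ∀ {τ v} → τ f ≡ v → (∀ j → j ≢ f → j ≢ d → τ j ≡ σ j) → Ready (f ∷ vs) d (suc f) τ (v ∷ ρ)
    ready-bind {τ} {v} eq same = record
      { 0<d = 0<d ; d<f = m≤n⇒m≤1+n d<f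
      ; 0<vs = λ { zero → 0<f ; (suc i) → 0<vs i }
      ; vs<f = λ { zero → ≤-refl ; (suc i) → m≤n⇒m≤1+n (vs<f i) }
      ; vs≢d = λ { zero → d≢f ∘ sym ; (suc i) → vs≢d i }
      ; input = Ready.input L ; free = Ready.free L
      ; value = λ { zero → eq ; (suc i) → Ready.value L i } }
      where L = ready-later {τ} same

    ready-same : ∀ {τ} → (∀ j → j ≢ d → τ j ≡ σ j) → Ready vs d f τ ρ
    ready-same same = record
      { 0<d = 0<d ; d<f = d<f ; 0<vs = 0<vs ; vs<f = vs<f ; vs≢d = vs≢d
      ; input = trans (same 0 (<⇒≢ 0<d)) input
      ; free = λ j le → trans (same j (<⇒≢ (<-≤-trans d<f le) ∘ sym)) (free j le)
      ; value = λ i → trans (same _ (vs≢d i)) (value i) }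

  module _ (w : List Bool) where

    private N = length w

    Computes : Program → ℕ → ℕ → Registers → Polynomial → Set
    Computes p d v σ b = ∀ {o} → ∃[ t ] ∃[ τ ] Runs w p σ o t τ o × t ≤ ⟦ b ⟧ N ×
      τ d ≡ σ d + v × (∀ j → j ≢ d → τ j ≡ σ j)

    incs-correct : ∀ k d σ → Computes (incs k d) d k σ (con (suc k))
    incs-correct zero    d σ = 1 , σ , skip , ≤-refl , sym (+-identityʳ _) , λ _ _ → refl
    incs-correct (suc k) d σ
      with t , τ , r , t≤ , a , b ← incs-correct k d (σ [ d ≔ suc (σ d) ])
      = suc t , τ , run-inc d σ ⨾ r , s≤s t≤ ,
        trans a (trans (cong (_+ k) (update-same σ d)) (sym (+-suc (σ d) k))) ,
        λ j j≢d → trans (b j j≢d) (update-other σ d j j≢d)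

    var-correct : ∀ v d f σ {n} → v ≢ d → v ≢ f → d ≢ f → σ v ≡ n → σ f ≡ 0 → ∀ {o} →
      ∃[ t ] ∃[ τ ] Runs w (while v (dec v ⨾ inc d ⨾ inc f) ⨾ while f (dec f ⨾ inc v)) σ o t τ o ×
      t ≤ (1 + n * 4) + (1 + n * 3) × τ d ≡ σ d + n × (∀ j → j ≢ d → τ j ≡ σ j)
    var-correct v d f σ {n} v≢d v≢f d≢f σv σf {o} =
      finish (countdown v (inc d ⨾ inc f) 2 I proj₁ next n
        (σv , refl , cong (_+ n) σf , (λ _ _ _ _ → refl) , refl))
      where
      I : ℕ → Registers → List Bool → Set
      I m τ o′ = τ v ≡ m × τ d + m ≡ σ d + n × τ f + m ≡ n ×
                 (∀ j → j ≢ v → j ≢ d → j ≢ f → τ j ≡ σ j) × o′ ≡ o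

      next : ∀ m {τ o′} → I (suc m) τ o′ →
        ∃[ t ] ∃[ υ ] ∃[ o″ ] Runs w (inc d ⨾ inc f) (τ [ v ≔ m ]) o′ t υ o″ × t ≤ 2 × I m υ o″
      next m {τ} (a , b , e , c , refl) = 2 , υ , o , run-inc d τ₁ ⨾ run-inc f τ₂ , ≤-refl ,
        ( trans (update-other τ₂ f v v≢f) (trans (update-other τ₁ d v v≢d) (update-same τ v))
        , trans (cong (_+ m) (trans (update-other τ₂ f d d≢f) (trans (update-same τ₁ d) (cong suc (update-other τ v d (v≢d ∘ sym))))))
                (trans (sym (+-suc (τ d) m)) b)
        , trans (cong (_+ m) (trans (update-same τ₂ f) (cong suc (trans (update-other τ₁ d f (d≢f ∘ sym)) (update-other τ v f (v≢f ∘ sym))))))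
                (trans (sym (+-suc (τ f) m)) e)
        , (λ j j≢v j≢d j≢f → trans (update-other τ₂ f j j≢f) (trans (update-other τ₁ d j j≢d) (trans (update-other τ v j j≢v) (c j j≢v j≢d j≢f))))
        , refl )
        where
        τ₁ = τ [ v ≔ m ]
        τ₂ = τ₁ [ d ≔ suc (τ₁ d) ]
        υ  = τ₂ [ f ≔ suc (τ₂ f) ]

      others : ∀ {τ υ : Registers} → τ v ≡ 0 → (∀ j → j ≢ v → j ≢ d → j ≢ f → τ j ≡ σ j) →
        υ f ≡ 0 → υ v ≡ τ v + sum n (λ _ → 1) → (∀ j → j ≢ f → j ≢ v → υ j ≡ τ j) →
        ∀ j → j ≢ d → υ j ≡ σ j
      others {τ} {υ} a c x y z j j≢d with j ≟ v | j ≟ f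
      ... | yes refl | _        = trans y (trans (cong (_+ sum n (λ _ → 1)) a) (trans (sum-ones n) (sym σv)))
      ... | no _     | yes refl = trans x (sym σf)
      ... | no j≢v   | no j≢f   = trans (z j j≢f j≢v) (c j j≢v j≢d j≢f)

      finish : ∃[ t ] ∃[ τ ] ∃[ o′ ] Runs w (while v (dec v ⨾ inc d ⨾ inc f)) σ o t τ o′ × t ≤ 1 + n * 4 × I 0 τ o′ →
        ∃[ t ] ∃[ τ ] Runs w (while v (dec v ⨾ inc d ⨾ inc f) ⨾ while f (dec f ⨾ inc v)) σ o t τ o ×
        t ≤ (1 + n * 4) + (1 + n * 3) × τ d ≡ σ d + n × (∀ j → j ≢ d → τ j ≡ σ j)
      finish (t , τ , _ , r , t≤ , (a , b , e , c , refl))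
        with t′ , υ , r′ , t′≤ , x , y , z ← accumulate {w} f v (inc v) 1 n (λ _ → 1) τ {o} (v≢f ∘ sym) (trans (sym (+-identityʳ _)) e)
          (λ m m<n ζ _ _ → 1 , _ , run-inc v ζ , ≤-refl , trans (update-same ζ v) (+-comm 1 (ζ v)) , update-other ζ v)
        = t + t′ , υ , r ⨾ r′ , +-mono-≤ t≤ t′≤ ,
          trans (z d d≢f (v≢d ∘ sym)) (trans (sym (+-identityʳ _)) b) , others {τ} {υ} a c x y z

    -- The pattern common to products and sums, a product being a sum of equal terms: compute the
    -- count into `f`, then run `body` that often. For a sum, `f` doubles as the bound variable.
    through : ∀ {n} {e : Expr n} {vs d f σ ρ} {E be b bE body} (g : ℕ → ℕ) → Ready vs d f σ ρ →
      Computes (compute e vs f (suc f)) f E σ be → E ≤ ⟦ bE ⟧ N →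
      (∀ n → n < E → ∀ τ → τ f ≡ n → (∀ j → j ≢ f → j ≢ d → τ j ≡ σ j) → Computes body d (g n) τ b) →
      Computes (compute e vs f (suc f) ⨾ while f (dec f ⨾ body)) d (sum E g) σ
               (be :+ (con 1 :+ (bE :* (con 2 :+ b))))
    through {d = d} {f} {σ} {E = E} {b = b} {body = body} g R C E≤ iterate
      with s , τ , r , s≤ , a , c ← C
      with t , υ , q , t≤ , x , y , z ← accumulate {w} f d body (⟦ b ⟧ N) E g τ (Ready.d≢f R ∘ sym)
             (trans a (cong (_+ E) (Ready.free R f ≤-refl)))
             (λ n n<E ζ ζf same → iterate n n<E ζ ζf (λ j j≢f j≢d → trans (same j j≢f j≢d) (c j j≢f)))
      = s + t , υ , r ⨾ q ,
        +-mono-≤ s≤ (≤-trans t≤ (s≤s (*-monoˡ-≤ _ E≤))) ,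
        trans y (cong (_+ sum E g) (c d (Ready.d≢f R))) , others
      where
      others : ∀ j → j ≢ d → υ j ≡ σ j
      others j j≢d with j ≟ f
      ... | yes refl = trans x (sym (Ready.free R f ≤-refl))
      ... | no  j≢f  = trans (z j j≢f j≢d) (c j j≢f)

    isTrue-bitAt : ∀ n v → (test isTrue (nth (List.map bit v) n) ≡ true × bitAt v n ≡ 1) ⊎
                           (test isTrue (nth (List.map bit v) n) ≡ false × bitAt v n ≡ 0)
    isTrue-bitAt n       []          = inj₂ (refl , refl)
    isTrue-bitAt zero    (true  ∷ v) = inj₁ (refl , refl)
    isTrue-bitAt zero    (false ∷ v) = inj₂ (refl , refl)
    isTrue-bitAt (suc n) (true  ∷ v) = isTrue-bitAt n v
    isTrue-bitAt (suc n) (false ∷ v) = isTrue-bitAt n v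

    lookup-input : ∀ {E} d σ → d ≢ 0 → σ 0 ≡ E → ∀ {o} →
      ∃[ t ] ∃[ τ ] Runs w (inc 0 ⨾ branch 0 isTrue (inc d) skip ⨾ while 0 (dec 0 ⨾ skip)) σ o t τ o ×
      t ≤ 1 + (2 + (1 + suc E * 3)) × τ 0 ≡ 0 × τ d ≡ σ d + bitAt w E × (∀ j → j ≢ 0 → j ≢ d → τ j ≡ σ j)
    lookup-input {E} d σ d≢0 σ0 {o} = go (isTrue-bitAt E w)
      where
      σ₁ = σ [ 0 ≔ suc (σ 0) ]
      σ₂ = σ₁ [ d ≔ suc (σ₁ d) ]

      at₁ : σ₁ 0 ≡ suc E
      at₁ = trans (update-same σ 0) (cong suc σ0)

      contents₁ : ∀ {b} → test isTrue (nth (List.map bit w) E) ≡ b → test isTrue (contents w 0 (σ₁ 0)) ≡ b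
      contents₁ = trans (cong (λ n → test isTrue (contents w 0 n)) at₁)

      zeros : sum (suc E) (λ _ → 0) ≡ 0
      zeros = trans (sum-const E 0) (*-zeroʳ E)

      reset : ∀ τ → τ 0 ≡ suc E → ∃[ t ] ∃[ υ ] Runs w (while 0 (dec 0 ⨾ skip)) τ o t υ o ×
        t ≤ 1 + suc E * 3 × υ 0 ≡ 0 × υ d ≡ τ d + sum (suc E) (λ _ → 0) × (∀ j → j ≢ 0 → j ≢ d → υ j ≡ τ j)
      reset τ eq = accumulate 0 d skip 1 (suc E) (λ _ → 0) τ (d≢0 ∘ sym) eq
        (λ _ _ ζ _ _ → 1 , ζ , skip , ≤-refl , sym (+-identityʳ _) , λ _ _ → refl)

      go : _ → _
      go (inj₁ (eq , bitE))
        with t , τ , r , t≤ , a , b , c ← reset σ₂ (trans (update-other σ₁ d 0 (d≢0 ∘ sym)) at₁)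
        = _ , τ , run-inc 0 σ ⨾ true (contents₁ eq) (run-inc d σ₁) ⨾ r , s≤s (s≤s (s≤s t≤)) , a ,
          trans b (trans (cong₂ _+_ (trans (update-same σ₁ d) (cong suc (update-other σ 0 d d≢0))) zeros)
                         (trans (+-identityʳ _) (trans (+-comm 1 (σ d)) (cong (σ d +_) (sym bitE))))) ,
          λ j j≢0 j≢d → trans (c j j≢0 j≢d) (trans (update-other σ₁ d j j≢d) (update-other σ 0 j j≢0))
      go (inj₂ (eq , bitE))
        with t , τ , r , t≤ , a , b , c ← reset σ₁ at₁
        = _ , τ , run-inc 0 σ ⨾ false (contents₁ eq) skip ⨾ r , s≤s (s≤s (s≤s t≤)) , a ,
          trans b (cong₂ _+_ (update-other σ 0 d d≢0) (trans zeros (sym bitE))) ,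
          λ j j≢0 j≢d → trans (c j j≢0 j≢d) (update-other σ 0 j j≢0)

    decrease : ∀ f σ {E G} → f ≢ 0 → σ f ≡ E → σ (suc f) ≡ G → ∀ {o} →
      ∃[ t ] ∃[ τ ] Runs w (while (suc f) (dec (suc f) ⨾ branch f nonzero (dec f) skip)) σ o t τ o ×
      t ≤ 1 + G * 4 × τ (suc f) ≡ 0 × τ f ≡ E ∸ G × (∀ j → j ≢ f → j ≢ suc f → τ j ≡ σ j)
    decrease f σ {E} {G} f≢0 σf σsf {o} =
      finish (countdown {w} (suc f) body 2 I proj₁ next G (σsf , cong (_∸ G) σf , (λ _ _ _ → refl) , refl))
      where
      body = branch f nonzero (dec f) skip

      I : ℕ → Registers → List Bool → Set
      -- The truncated difference of the two counters is invariant, also once `f` has reached 0.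
      I m τ o′ = τ (suc f) ≡ m × τ f ∸ m ≡ E ∸ G × (∀ j → j ≢ f → j ≢ suc f → τ j ≡ σ j) × o′ ≡ o

      f≢sf : f ≢ suc f
      f≢sf = <⇒≢ ≤-refl

      next : ∀ m {τ o′} → I (suc m) τ o′ →
        ∃[ t ] ∃[ υ ] ∃[ o″ ] Runs w body (τ [ suc f ≔ m ]) o′ t υ o″ × t ≤ 2 × I m υ o″
      next m {τ} (a , b , c , refl) = go (τ f) refl
        where
        τ₁ = τ [ suc f ≔ m ]
        same : ∀ j → j ≢ f → j ≢ suc f → τ₁ j ≡ σ j
        same j j≢f j≢sf = trans (update-other τ (suc f) j j≢sf) (c j j≢f j≢sf)
        go : ∀ x → τ f ≡ x → ∃[ t ] ∃[ υ ] ∃[ o″ ] Runs w body τ₁ o t υ o″ × t ≤ 2 × I m υ o″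
        go zero eq = 2 , τ₁ , o ,
          false (trans (cong (λ n → test nonzero (contents w f n)) (trans (update-other τ (suc f) f f≢sf) eq)) (test-zero f)) skip ,
          ≤-refl , update-same τ (suc f) ,
          trans (cong (_∸ m) (trans (update-other τ (suc f) f f≢sf) eq))
                (trans (0∸n≡0 m) (trans (cong (_∸ suc m) (sym eq)) b)) , same , refl
          where
          test-zero : ∀ i → test nonzero (contents w i 0) ≡ false
          test-zero zero    = refl
          test-zero (suc i) = refl
        go (suc x) eq = 2 , τ₁ [ f ≔ x ] , o ,
          true (test-suc w f (trans (update-other τ (suc f) f f≢sf) eq))
               (run-dec f τ₁ (trans (update-other τ (suc f) f f≢sf) eq)) ,
          ≤-refl , trans (update-other τ₁ f (suc f) (f≢sf ∘ sym)) (update-same τ (suc f)) ,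
          trans (cong (_∸ m) (update-same τ₁ f)) (trans (cong (_∸ suc m) (sym eq)) b) ,
          (λ j j≢f j≢sf → trans (update-other τ₁ f j j≢f) (same j j≢f j≢sf)) , refl

      finish : ∃[ t ] ∃[ τ ] ∃[ o′ ] Runs w (while (suc f) (dec (suc f) ⨾ body)) σ o t τ o′ × t ≤ 1 + G * 4 × I 0 τ o′ →
        ∃[ t ] ∃[ τ ] Runs w (while (suc f) (dec (suc f) ⨾ body)) σ o t τ o ×
        t ≤ 1 + G * 4 × τ (suc f) ≡ 0 × τ f ≡ E ∸ G × (∀ j → j ≢ f → j ≢ suc f → τ j ≡ σ j)
      finish (t , τ , _ , r , t≤ , a , b , c , refl) = t , τ , r , t≤ , a , b , c

    compute-correct : ∀ {n} (e : Expr n) vs d f {σ ρ} bs → Ready vs d f σ ρ → Bounded N bs ρ →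
      Computes (compute e vs d f) d (eval w e ρ) σ (time e bs)
    compute-correct (var i) vs d f {σ} {ρ} bs R H {o}
      with t , τ , r , t≤ , p ← var-correct (lookup vs i) d f σ {lookup ρ i}
             (Ready.vs≢d R i) (<⇒≢ (Ready.vs<f R i)) (Ready.d≢f R) (Ready.value R i) (Ready.free R f ≤-refl) {o}
      = t , τ , r , ≤-trans t≤ (+-mono-≤ (s≤s (*-monoˡ-≤ 4 (H i))) (s≤s (*-monoˡ-≤ 3 (H i)))) , p
    compute-correct (con k) vs d f {σ} bs R H = incs-correct k d σ
    compute-correct (e ⊕ g) vs d f {σ} {ρ} bs R H
      with s , τ , r , s≤ , a , b ← compute-correct e vs d f bs R H
      with t , υ , q , t≤ , x , y ← compute-correct g vs d f bs (ready-same R b) H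
      = s + t , υ , r ⨾ q , +-mono-≤ s≤ t≤ ,
        trans x (trans (cong (_+ eval w g ρ) a) (+-assoc (σ d) _ _)) ,
        λ j j≢d → trans (y j j≢d) (b j j≢d)
    compute-correct (e ⊗ g) vs d f {σ} {ρ} bs R H {o}
      with t , τ , r , t≤ , a , b ← through {e = e} {be = time e bs} {time g bs} {size e bs} (λ _ → eval w g ρ) R
             (compute-correct e vs f (suc f) bs (ready-temp R) H) (eval≤size w e H)
             (λ n _ τ _ same → compute-correct g vs d (suc f) bs (ready-later R same) H) {o}
      = t , τ , r , t≤ , trans a (cong (σ d +_) (sum-const (eval w e ρ) (eval w g ρ))) , b
    compute-correct (e ⊖ g) vs d f {σ} {ρ} bs R H
      with s , τ , r , s≤ , a , b ← compute-correct e vs f (suc f) bs (ready-temp R) H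
      with s′ , τ′ , r′ , s′≤ , a′ , b′ ← compute-correct g vs (suc f) (2 + f) bs (ready-temp (ready-later R (λ j j≢f _ → b j j≢f))) H
      with s″ , τ″ , r″ , s″≤ , a″ , c″ , b″ ← decrease f τ′ {eval w e ρ} {eval w g ρ} (Ready.f≢0 R)
             (trans (b′ f (<⇒≢ ≤-refl)) (trans a (cong (_+ eval w e ρ) (Ready.free R f ≤-refl))))
             (trans a′ (cong (_+ eval w g ρ) (trans (b (suc f) (<⇒≢ ≤-refl ∘ sym)) (Ready.free R (suc f) (n≤1+n f)))))
      with t , υ , q , t≤ , x , y , z ← accumulate {w} f d (inc d) 1 (eval w e ρ ∸ eval w g ρ) (λ _ → 1) τ″ (Ready.d≢f R ∘ sym)
             c″ (λ n _ ζ _ _ → 1 , _ , run-inc d ζ , ≤-refl , trans (update-same ζ d) (+-comm 1 (ζ d)) , update-other ζ d)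
      = s + (s′ + (s″ + t)) , υ , r ⨾ r′ ⨾ r″ ⨾ q ,
        +-mono-≤ s≤ (+-mono-≤ s′≤ (+-mono-≤ (≤-trans s″≤ (s≤s (*-monoˡ-≤ 4 (eval≤size w g H))))
                                             (≤-trans t≤ (s≤s (*-monoˡ-≤ 3 (eval≤size w (e ⊖ g) H)))))) ,
        trans y (cong₂ _+_ (trans (b″ d (Ready.d≢f R) d≢sf) (trans (b′ d d≢sf) (b d (Ready.d≢f R))))
                           (sum-ones (eval w e ρ ∸ eval w g ρ))) ,
        others
      where
      d≢sf : d ≢ suc f
      d≢sf = <⇒≢ (m≤n⇒m≤1+n (Ready.d<f R))
      others : ∀ j → j ≢ d → υ j ≡ σ j
      others j j≢d with j ≟ f | j ≟ suc f
      ... | yes refl | _        = trans x (sym (Ready.free R f ≤-refl))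
      ... | no j≢f   | yes refl = trans (z j j≢f j≢d) (trans a″ (sym (Ready.free R (suc f) (n≤1+n f))))
      ... | no j≢f   | no j≢sf  = trans (z j j≢f j≢d) (trans (b″ j j≢f j≢sf) (trans (b′ j j≢sf) (b j j≢f)))
    compute-correct (∑ e g) vs d f {σ} {ρ} bs R H {o} =
      through {e = e} {be = time e bs} {time g (size e bs ∷ bs)} {size e bs} (λ i → eval w g (i ∷ ρ)) R
        (compute-correct e vs f (suc f) bs (ready-temp R) H) (eval≤size w e H)
        (λ n n<E τ τf same → compute-correct g (f ∷ vs) d (suc f) (size e bs ∷ bs) (ready-bind R τf same)
          (bounded-∷ (≤-trans (<⇒≤ n<E) (eval≤size w e H)) H)) {o}
    compute-correct (inp e) vs d f {σ} {ρ} bs R H {o}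
      with s , τ , r , s≤ , a , b ← compute-correct e vs f (suc f) bs (ready-temp R) H
      with s′ , τ′ , r′ , s′≤ , x , y , z ← accumulate {w} f 0 (inc 0) 1 (eval w e ρ) (λ _ → 1) τ (Ready.f≢0 R)
             (trans a (cong (_+ eval w e ρ) (Ready.free R f ≤-refl)))
             (λ n _ ζ _ _ → 1 , _ , run-inc 0 ζ , ≤-refl , trans (update-same ζ 0) (+-comm 1 (ζ 0)) , update-other ζ 0)
      with s″ , τ″ , r″ , s″≤ , a″ , c″ , b″ ← lookup-input {eval w e ρ} d τ′ (<⇒≢ (Ready.0<d R) ∘ sym)
             (trans y (cong₂ _+_ (trans (b 0 (Ready.f≢0 R ∘ sym)) (Ready.input R)) (sum-ones (eval w e ρ))))
      = s + (s′ + s″) , τ″ , r ⨾ r′ ⨾ r″ ,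
        +-mono-≤ s≤ (+-mono-≤ (≤-trans s′≤ (s≤s (*-monoˡ-≤ 3 E≤)))
                               (≤-trans s″≤ (s≤s (s≤s (s≤s (s≤s (*-monoˡ-≤ 3 (s≤s E≤)))))))) ,
        trans c″ (cong (_+ bitAt w (eval w e ρ)) (trans (z d (Ready.d≢f R) d≢0) (b d (Ready.d≢f R)))) ,
        others
      where
      E≤ = eval≤size w e H
      d≢0 : d ≢ 0
      d≢0 = <⇒≢ (Ready.0<d R) ∘ sym
      others : ∀ j → j ≢ d → τ″ j ≡ σ j
      others j j≢d with j ≟ 0 | j ≟ f
      ... | yes refl | _        = trans a″ (sym (Ready.input R))
      ... | no j≢0   | yes refl = trans (b″ j j≢0 j≢d) (trans x (sym (Ready.free R f ≤-refl)))
      ... | no j≢0   | no j≢f   = trans (b″ j j≢0 j≢d) (trans (z j j≢f j≢0) (b j j≢f))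

-- Printing commands; polynomial time decision and computation.

module Commands where

  open Machines
  open Interpreter
  open Expressions

  positive : ℕ → Bool
  positive zero    = false
  positive (suc n) = true

  repeat : ∀ {A : Set} → ℕ → (ℕ → List A) → List A
  repeat zero    f = []
  repeat (suc n) f = repeat n f ++ f n

  data Command (n : ℕ) : Set where
    print : Expr n → Command n
    _⨟_   : Command n → Command n → Command n
    for   : Expr n → Command (suc n) → Command n
    bind  : Expr n → Command (suc n) → Command n

  infixr 5 _⨟_

  printed : ∀ {n} → List Bool → Command n → Vec ℕ n → List Bool
  printed w (print e) ρ = positive (eval w e ρ) ∷ []
  printed w (c ⨟ d)   ρ = printed w c ρ ++ printed w d ρ
  printed w (for e c) ρ = repeat (eval w e ρ) λ i → printed w c (i ∷ ρ)
  printed w (bind e c) ρ = printed w c (eval w e ρ ∷ ρ)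

  -- The output grows at the front, so everything runs backwards.
  compile : ∀ {n} → Command n → Vec ℕ n → ℕ → Program
  compile (print e) vs f =
    compute e vs f (suc f) ⨾ branch f nonzero (emit true) (emit false) ⨾ while f (dec f ⨾ skip)
  compile (c ⨟ d)   vs f = compile d vs f ⨾ compile c vs f
  compile (for e c) vs f = compute e vs f (suc f) ⨾ while f (dec f ⨾ compile c (f ∷ vs) (suc f))
  compile (bind e c) vs f = compute e vs f (suc f) ⨾ compile c (f ∷ vs) (suc f) ⨾ while f (dec f ⨾ skip)

  duration : ∀ {n} → Command n → Vec Polynomial n → Polynomial
  duration (print e) bs = time e bs :+ (con 2 :+ (con 1 :+ (size e bs :* con 3)))
  duration (c ⨟ d)   bs = duration d bs :+ duration c bs
  duration (for e c) bs = time e bs :+ (con 1 :+ (size e bs :* (con 2 :+ duration c (size e bs ∷ bs))))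
  duration (bind e c) bs = time e bs :+ (duration c (size e bs ∷ bs) :+ (con 1 :+ (size e bs :* con 3)))

  module _ (w : List Bool) where

    private N = length w

    Outputs : Program → Registers → List Bool → Polynomial → Set
    Outputs p σ out b = ∀ o → ∃[ t ] ∃[ τ ] Runs w p σ o t τ (out ++ o) × t ≤ ⟦ b ⟧ N × (∀ j → τ j ≡ σ j)

    print-bit : ∀ f σ n o → σ (suc f) ≡ n →
      Runs w (branch (suc f) nonzero (emit true) (emit false)) σ o 2 σ (positive n ∷ o)
    print-bit f σ zero    o eq = false (cong (λ n → test nonzero (contents w (suc f) n)) eq) emit
    print-bit f σ (suc n) o eq = true (test-suc w (suc f) eq) emit

    compile-correct : ∀ {n} (c : Command n) vs d f {σ ρ} bs → Ready vs d (suc f) σ ρ → Bounded N bs ρ →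
      Outputs (compile c vs (suc f)) σ (printed w c ρ) (duration c bs)
    compile-correct (print e) vs d f {σ} {ρ} bs R H o
      with s , τ , r , s≤ , a , b ← compute-correct w e vs (suc f) (2 + f) bs (ready-temp R) H
      with t , υ , q , t≤ , x , y , z ← accumulate {w} (suc f) d skip 1 (eval w e ρ) (λ _ → 0) τ (Ready.d≢f R ∘ sym)
             (trans a (cong (_+ eval w e ρ) (Ready.free R (suc f) ≤-refl)))
             (λ _ _ ζ _ _ → 1 , ζ , skip , ≤-refl , sym (+-identityʳ _) , λ _ _ → refl)
      = s + (2 + t) , υ ,
        r ⨾ print-bit f τ (eval w e ρ) o (trans a (cong (_+ eval w e ρ) (Ready.free R (suc f) ≤-refl))) ⨾ q ,
        +-mono-≤ s≤ (s≤s (s≤s (≤-trans t≤ (s≤s (*-monoˡ-≤ 3 (eval≤size w e H)))))) ,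
        same
      where
      same : ∀ j → υ j ≡ σ j
      same j with j ≟ suc f | j ≟ d
      ... | yes refl | _        = trans x (sym (Ready.free R (suc f) ≤-refl))
      ... | no j≢f   | yes refl = trans y (trans (cong₂ _+_ (b d j≢f) (trans (sum-const (eval w e ρ) 0) (*-zeroʳ (eval w e ρ)))) (+-identityʳ _))
      ... | no j≢f   | no j≢d   = trans (z j j≢f j≢d) (b j j≢f)
    compile-correct (c₁ ⨟ c₂) vs d f {ρ = ρ} bs R H o
      with s , τ , r , s≤ , a ← compile-correct c₂ vs d f bs R H o
      with t , υ , q , t≤ , b ← compile-correct c₁ vs d f bs (ready-same R (λ j _ → a j)) H (printed w c₂ ρ ++ o)
      = s + t , υ , r ⨾ subst (Runs w (compile c₁ vs (suc f)) τ _ t υ) (sym (++-assoc (printed w c₁ ρ) _ o)) q ,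
        +-mono-≤ s≤ t≤ , λ j → trans (b j) (a j)
    compile-correct (for e c) vs d f {σ} {ρ} bs R H o
      with s , τ , r , s≤ , a , b ← compute-correct w e vs (suc f) (2 + f) bs (ready-temp R) H {o}
      = finish (countdown (suc f) body (⟦ duration c (size e bs ∷ bs) ⟧ N) I proj₁ next E
          (trans a (cong (_+ E) (Ready.free R (suc f) ≤-refl)) , b , ≤-refl , refl))
      where
      E    = eval w e ρ
      out  = λ i → printed w c (i ∷ ρ)
      body = compile c (suc f ∷ vs) (2 + f)
      Loop = while (suc f) (dec (suc f) ⨾ body)

      I : ℕ → Registers → List Bool → Set
      -- The loop runs from the last round to the first, so what is still to be printed stands in
      -- front of what has been printed.
      I n υ o′ = υ (suc f) ≡ n × (∀ j → j ≢ suc f → υ j ≡ σ j) × n ≤ E × repeat n out ++ o′ ≡ repeat E out ++ o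

      next : ∀ n {υ o′} → I (suc n) υ o′ →
        ∃[ t ] ∃[ ζ ] ∃[ o″ ] Runs w body (υ [ suc f ≔ n ]) o′ t ζ o″ × t ≤ ⟦ duration c (size e bs ∷ bs) ⟧ N × I n ζ o″
      next n {υ} {o′} (x , y , n<E , eq)
        with t , ζ , q , t≤ , z ← compile-correct c (suc f ∷ vs) d (suc f) (size e bs ∷ bs)
               (ready-bind R (update-same υ (suc f)) (λ j j≢f _ → trans (update-other υ (suc f) j j≢f) (y j j≢f)))
               (bounded-∷ (≤-trans (<⇒≤ n<E) (eval≤size w e H)) H) o′
        = t , ζ , out n ++ o′ , q , t≤ ,
          ( trans (z (suc f)) (update-same υ (suc f))
          , (λ j j≢f → trans (z j) (trans (update-other υ (suc f) j j≢f) (y j j≢f)))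
          , <⇒≤ n<E
          , trans (sym (++-assoc (repeat n out) (out n) o′)) eq )

      finish : ∃[ t ] ∃[ υ ] ∃[ o′ ] Runs w Loop τ o t υ o′ × t ≤ 1 + E * (2 + ⟦ duration c (size e bs ∷ bs) ⟧ N) × I 0 υ o′ →
        ∃[ t ] ∃[ υ ] Runs w (compile (for e c) vs (suc f)) σ o t υ (repeat E out ++ o) ×
          t ≤ ⟦ duration (for e c) bs ⟧ N × (∀ j → υ j ≡ σ j)
      finish (t , υ , _ , q , t≤ , x , y , _ , refl) = s + t , υ , r ⨾ q ,
        +-mono-≤ s≤ (≤-trans t≤ (s≤s (*-monoˡ-≤ _ (eval≤size w e H)))) , same
        where
        same : ∀ j → υ j ≡ σ j
        same j with j ≟ suc f
        ... | yes refl = trans x (sym (Ready.free R (suc f) ≤-refl))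
        ... | no j≢f   = y j j≢f

    compile-correct (bind e c) vs d f {σ} {ρ} bs R H o
      with s , τ , r , s≤ , a , b ← compute-correct w e vs (suc f) (2 + f) bs (ready-temp R) H
      with s′ , τ′ , r′ , s′≤ , b′ ← compile-correct c (suc f ∷ vs) d (suc f) (size e bs ∷ bs)
             (ready-bind R (trans a (cong (_+ eval w e ρ) (Ready.free R (suc f) ≤-refl))) (λ j j≢f _ → b j j≢f))
             (bounded-∷ (eval≤size w e H) H) o
      with t , υ , q , t≤ , x , y , z ← accumulate {w} (suc f) d skip 1 (eval w e ρ) (λ _ → 0) τ′ (Ready.d≢f R ∘ sym)
             (trans (b′ (suc f)) (trans a (cong (_+ eval w e ρ) (Ready.free R (suc f) ≤-refl))))
             (λ _ _ ζ _ _ → 1 , ζ , skip , ≤-refl , sym (+-identityʳ _) , λ _ _ → refl)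
      = s + (s′ + t) , υ , r ⨾ r′ ⨾ q ,
        +-mono-≤ s≤ (+-mono-≤ s′≤ (≤-trans t≤ (s≤s (*-monoˡ-≤ 3 (eval≤size w e H))))) ,
        same
      where
      same : ∀ j → υ j ≡ σ j
      same j with j ≟ suc f | j ≟ d
      ... | yes refl | _        = trans x (sym (Ready.free R (suc f) ≤-refl))
      ... | no j≢f   | yes refl = trans y (trans (cong₂ _+_ (trans (b′ d) (b d j≢f)) (trans (sum-const (eval w e ρ) 0) (*-zeroʳ (eval w e ρ)))) (+-identityʳ _))
      ... | no j≢f   | no j≢d   = trans (z j j≢f j≢d) (trans (b′ j) (b j j≢f))

    -- The only variable is the input length in register 1; the destination is register 2, and
    -- scratch space begins at 3.
    initial-ready : Ready (1 ∷ []) 2 3 (initialRegisters w) (N ∷ [])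
    initial-ready = record
      { 0<d = s≤s z≤n ; d<f = ≤-refl
      ; 0<vs = λ { zero → s≤s z≤n } ; vs<f = λ { zero → s≤s (s≤s z≤n) } ; vs≢d = λ { zero () }
      ; input = refl ; free = free ; value = λ { zero → refl } }
      where
      free : ∀ j → 3 ≤ j → initialRegisters w j ≡ 0
      free (suc (suc j)) _        = refl
      free (suc zero)    (s≤s ())

    initial-bounded : Bounded N (X ∷ []) (N ∷ [])
    initial-bounded zero = ≤-refl

  -- Marking, copying and rewinding take `1`, `1 + n` and `2 + n` steps, and finishing takes one.
  overhead : Polynomial → Polynomial
  overhead b = (con 1 :+ ((con 1 :+ X) :+ (con 2 :+ X))) :+ (b :+ con 1)

  expression-InP : (φ : Expr 1) → InP (λ w → eval w φ (length w ∷ []) ≢ 0)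
  expression-InP φ = machine , overhead (time φ (X ∷ [])) , halts
    where
    open Execution (compute φ (1 ∷ []) 2 3)

    decide : ∀ w n → test nonzero (contents w 2 n) ≡ true ⇔ n ≢ 0
    decide w zero    = mk⇔ (λ ()) (λ ne → contradiction refl ne)
    decide w (suc n) = mk⇔ (λ _ ()) (λ _ → refl)

    halts : HaltsInTime machine (overhead (time φ (X ∷ []))) _
    halts w =
      let t , τ , r , t≤ , a , b = compute-correct w φ (1 ∷ []) 2 3 (X ∷ []) (initial-ready w) (initial-bounded w)
          c , h , _ , acc = execute w r
      in _ , c , h , +-monoʳ-≤ (⟦ con 1 :+ ((con 1 :+ X) :+ (con 2 :+ X)) ⟧ (length w)) (+-monoˡ-≤ 1 t≤) ,
        subst (λ b → b ≡ true ⇔ eval w φ (length w ∷ []) ≢ 0)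
          (sym (trans acc (cong (λ n → test nonzero (contents w 2 n)) a)))
          (decide w (eval w φ (length w ∷ [])))

  command-PolyTime : (c : Command 1) → PolyTimeComputable (λ w → printed w c (length w ∷ []))
  command-PolyTime c = machine , overhead (duration c (X ∷ [])) , halts
    where
    open Execution (compile c (1 ∷ []) 3)

    halts : HaltsInTime machine (overhead (duration c (X ∷ []))) _
    halts w =
      let t , τ , r , t≤ , _ = compile-correct w c (1 ∷ []) 2 2 (X ∷ []) (initial-ready w) (initial-bounded w) []
          d , h , out , _ = execute w r
      in _ , d , h , +-monoʳ-≤ (⟦ con 1 :+ ((con 1 :+ X) :+ (con 2 :+ X)) ⟧ (length w)) (+-monoˡ-≤ 1 t≤) , trans out (++-identityʳ _)

-- Bounded formulas and their truth values as expressions.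

module Formulas where

  open Expressions
  open Commands

  infix  4 _≐_ _≺_
  infixr 3 _∧_
  infixr 2 _∨_
  infixr 1 _⇒_

  -- `⋁` is written out over a fixed finite index set. It ranges over nodes, tiles and rules, whose
  -- number is independent of the input, while `∃<` and `∀<` have computed bounds.
  data Formula (n : ℕ) : Set where
    _≐_ _≺_     : Expr n → Expr n → Formula n
    _∧_ _∨_ _⇒_ : Formula n → Formula n → Formula n
    ∃< ∀<       : Expr n → Formula (suc n) → Formula n
    ⋁           : (k : ℕ) → (Fin k → Formula n) → Formula n

  module _ (w : List Bool) where

    True : ∀ {n} → Formula n → Vec ℕ n → Set
    True (a ≐ b)  ρ = eval w a ρ ≡ eval w b ρ
    True (a ≺ b)  ρ = eval w a ρ < eval w b ρ
    True (φ ∧ ψ)  ρ = True φ ρ × True ψ ρ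
    True (φ ∨ ψ)  ρ = True φ ρ ⊎ True ψ ρ
    True (φ ⇒ ψ)  ρ = True φ ρ → True ψ ρ
    True (∃< e φ) ρ = ∃[ i ] i < eval w e ρ × True φ (i ∷ ρ)
    True (∀< e φ) ρ = ∀ i → i < eval w e ρ → True φ (i ∷ ρ)
    True (⋁ k φ)  ρ = ∃[ i ] True (φ i) ρ

  total : ∀ {n} k → (Fin k → Expr n) → Expr n
  total zero    e = con 0
  total (suc k) e = e zero ⊕ total k (e ∘ suc)

  -- True means positive: disjunction and existence become sums, conjunction a product, `a ≺ b` a
  -- truncated difference, and `1 ∸ a` negates.
  truth : ∀ {n} → Formula n → Expr n
  truth (a ≐ b)  = con 1 ⊖ ((a ⊖ b) ⊕ (b ⊖ a))
  truth (a ≺ b)  = b ⊖ a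
  truth (φ ∧ ψ)  = truth φ ⊗ truth ψ
  truth (φ ∨ ψ)  = truth φ ⊕ truth ψ
  truth (φ ⇒ ψ)  = (con 1 ⊖ truth φ) ⊕ truth ψ
  truth (∃< e φ) = ∑ e (truth φ)
  truth (∀< e φ) = con 1 ⊖ ∑ e (con 1 ⊖ truth φ)
  truth (⋁ k φ)  = total k (truth ∘ φ)

  sum-positive : ∀ n f → 0 < sum n f ⇔ (∃[ i ] i < n × 0 < f i)
  sum-positive n f = mk⇔ (to n) (λ (i , i<n , p) → from n i<n p)
    where
    to : ∀ n → 0 < sum n f → ∃[ i ] i < n × 0 < f i
    to (suc n) p with f n in eq
    ... | suc k = n , ≤-refl , subst (0 <_) (sym eq) (s≤s z≤n)
    ... | zero  = let i , i<n , q = to n p in i , m≤n⇒m≤1+n i<n , q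

    from : ∀ n {i} → i < n → 0 < f i → 0 < sum n f
    from (suc n) {i} i<n p with i ≟ n
    ... | yes refl = ≤-trans p (m≤m+n (f i) _)
    ... | no  i≢n  = ≤-trans (from n (≤∧≢⇒< (s≤s⁻¹ i<n) i≢n) p) (m≤n+m _ (f n))

  zero-or-positive : ∀ n → n ≡ 0 ⊎ 0 < n
  zero-or-positive zero    = inj₁ refl
  zero-or-positive (suc n) = inj₂ (s≤s z≤n)

  not-positive : ∀ n → 0 < 1 ∸ n ⇔ (¬ 0 < n)
  not-positive zero    = mk⇔ (λ _ ()) (λ _ → s≤s z≤n)
  not-positive (suc n) = mk⇔ (λ p → contradiction (subst (0 <_) (0∸n≡0 n) p) (λ ())) (λ ¬p → contradiction (s≤s z≤n) ¬p)

  module _ (w : List Bool) where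

    open Equivalence

    truth-correct : ∀ {n} (φ : Formula n) ρ → 0 < eval w (truth φ) ρ ⇔ True w φ ρ
    truth-correct (a ≐ b) ρ = mk⇔ t f
      where
      x = eval w a ρ
      y = eval w b ρ
      t : 0 < 1 ∸ ((x ∸ y) + (y ∸ x)) → x ≡ y
      t p = ≤-antisym
        (m∸n≡0⇒m≤n (m+n≡0⇒m≡0 (x ∸ y) s))
        (m∸n≡0⇒m≤n (m+n≡0⇒n≡0 (x ∸ y) s))
        where
        s : (x ∸ y) + (y ∸ x) ≡ 0
        s with zero-or-positive ((x ∸ y) + (y ∸ x))
        ... | inj₁ eq = eq
        ... | inj₂ q  = contradiction q (to (not-positive _) p)
      f : x ≡ y → 0 < 1 ∸ ((x ∸ y) + (y ∸ x))
      f eq = subst (λ z → 0 < 1 ∸ z) (sym (cong₂ _+_ (m≤n⇒m∸n≡0 (≤-reflexive eq)) (m≤n⇒m∸n≡0 (≤-reflexive (sym eq))))) (s≤s z≤n)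
    truth-correct (a ≺ b) ρ = mk⇔ t m<n⇒0<n∸m
      where
      x = eval w a ρ
      y = eval w b ρ
      t : 0 < y ∸ x → x < y
      t p = ≰⇒> (λ y≤x → contradiction (subst (0 <_) (m≤n⇒m∸n≡0 y≤x) p) (λ ()))
    truth-correct (φ ∧ ψ) ρ = mk⇔
      (λ p → to (truth-correct φ ρ) (factorˡ (eval w (truth φ) ρ) p) , to (truth-correct ψ ρ) (factorʳ (eval w (truth φ) ρ) p))
      (λ (p , q) → *-mono-< (from (truth-correct φ ρ) p) (from (truth-correct ψ ρ) q))
      where
      factorˡ : ∀ a {b} → 0 < a * b → 0 < a
      factorˡ (suc a) p = s≤s z≤n
      factorʳ : ∀ a {b} → 0 < a * b → 0 < b
      factorʳ a {zero}  p = subst (0 <_) (*-zeroʳ a) p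
      factorʳ a {suc b} p = s≤s z≤n
    truth-correct (φ ∨ ψ) ρ = mk⇔ t
      Sum.[ (λ p → ≤-trans (from (truth-correct φ ρ) p) (m≤m+n _ _))
          , (λ p → ≤-trans (from (truth-correct ψ ρ) p) (m≤n+m _ _)) ]
      where
      t : 0 < eval w (truth φ) ρ + eval w (truth ψ) ρ → True w φ ρ ⊎ True w ψ ρ
      t p with zero-or-positive (eval w (truth φ) ρ)
      ... | inj₂ q  = inj₁ (to (truth-correct φ ρ) q)
      ... | inj₁ eq = inj₂ (to (truth-correct ψ ρ) (subst (λ x → 0 < x + _) eq p))
    truth-correct (φ ⇒ ψ) ρ = mk⇔ t f
      where
      t : 0 < 1 ∸ eval w (truth φ) ρ + eval w (truth ψ) ρ → True w φ ρ → True w ψ ρ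
      t p q = to (truth-correct ψ ρ)
        (subst (λ x → 0 < x + eval w (truth ψ) ρ) (m≤n⇒m∸n≡0 (from (truth-correct φ ρ) q)) p)
      f : (True w φ ρ → True w ψ ρ) → 0 < 1 ∸ eval w (truth φ) ρ + eval w (truth ψ) ρ
      f g with zero-or-positive (eval w (truth φ) ρ)
      ... | inj₁ eq = subst (λ x → 0 < 1 ∸ x + _) (sym eq) (s≤s z≤n)
      ... | inj₂ q  = ≤-trans (from (truth-correct ψ ρ) (g (to (truth-correct φ ρ) q))) (m≤n+m _ _)
    truth-correct (∃< e φ) ρ = mk⇔
      (λ p → let i , i<n , q = to (sum-positive _ _) p in i , i<n , to (truth-correct φ (i ∷ ρ)) q)
      (λ (i , i<n , q) → from (sum-positive _ _) (i , i<n , from (truth-correct φ (i ∷ ρ)) q))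
    truth-correct (∀< e φ) ρ = mk⇔ t f
      where
      g : ℕ → ℕ
      g i = 1 ∸ eval w (truth φ) (i ∷ ρ)
      t : 0 < 1 ∸ sum (eval w e ρ) g → ∀ i → i < eval w e ρ → True w φ (i ∷ ρ)
      t p i i<n with zero-or-positive (eval w (truth φ) (i ∷ ρ))
      ... | inj₂ q  = to (truth-correct φ (i ∷ ρ)) q
      ... | inj₁ eq = contradiction
        (from (sum-positive (eval w e ρ) g) (i , i<n , subst (λ x → 0 < 1 ∸ x) (sym eq) (s≤s z≤n)))
        (to (not-positive _) p)
      f : (∀ i → i < eval w e ρ → True w φ (i ∷ ρ)) → 0 < 1 ∸ sum (eval w e ρ) g
      f h = from (not-positive _) λ p → let i , i<n , q = to (sum-positive (eval w e ρ) g) p in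
        to (not-positive _) q (from (truth-correct φ (i ∷ ρ)) (h i i<n))
    truth-correct (⋁ k φ) ρ = mk⇔ (t k φ (λ i → to (truth-correct (φ i) ρ))) (λ (i , p) → f k φ i (from (truth-correct (φ i) ρ) p))
      where
      t : ∀ k (φ : Fin k → Formula _) → (∀ i → 0 < eval w (truth (φ i)) ρ → True w (φ i) ρ) →
          0 < eval w (total k (truth ∘ φ)) ρ → ∃[ i ] True w (φ i) ρ
      t (suc k) φ h p with zero-or-positive (eval w (truth (φ zero)) ρ)
      ... | inj₂ q  = zero , h zero q
      ... | inj₁ eq = let i , q = t k (φ ∘ suc) (h ∘ suc) (subst (λ x → 0 < x + eval w (total k (truth ∘ φ ∘ suc)) ρ) eq p) in suc i , q
      f : ∀ k (φ : Fin k → Formula _) i → 0 < eval w (truth (φ i)) ρ → 0 < eval w (total k (truth ∘ φ)) ρ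
      f (suc k) φ zero    p = ≤-trans p (m≤m+n _ _)
      f (suc k) φ (suc i) p = ≤-trans (f k (φ ∘ suc) i p) (m≤n+m _ _)

  formula-InP : (φ : Formula 1) → InP (λ w → True w φ (length w ∷ []))
  formula-InP φ = let M , p , h = expression-InP (truth φ) in M , p , λ w →
    let t , c , run , t≤ , Q = h w in t , c , run , t≤ , mk⇔
      (λ a → Equivalence.to (truth-correct w φ _) (n≢0⇒n>0 (Equivalence.to Q a)))
      (λ a → Equivalence.from Q (>⇒≢ (Equivalence.from (truth-correct w φ _) a)))

-- Bit positions in encoded graphs and in pairs.

module Encodings where

  open Expressions
  open Commands
  open import Data.List.Base using (replicate; concatMap; map; allFin)

  toNat : Bool → ℕ
  toNat false = 0
  toNat true  = 1

  does-true : ∀ {A : Set} (a? : Dec A) → does a? ≡ true → A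
  does-true (yes a) eq = a

  toNat-injective : ∀ {a b} → toNat a ≡ toNat b → a ≡ b
  toNat-injective {false} {false} _ = refl
  toNat-injective {true}  {true}  _ = refl

  bitAt-∷ : ∀ b xs i → bitAt (b ∷ xs) (suc i) ≡ bitAt xs i
  bitAt-∷ false xs i = refl
  bitAt-∷ true  xs i = refl

  bitAt-singleton : ∀ b → bitAt (b ∷ []) 0 ≡ toNat b
  bitAt-singleton false = refl
  bitAt-singleton true  = refl

  bitAt-++ʳ : ∀ xs ys i → bitAt (xs ++ ys) (length xs + i) ≡ bitAt ys i
  bitAt-++ʳ []       ys i = refl
  bitAt-++ʳ (x ∷ xs) ys i = trans (bitAt-∷ x (xs ++ ys) _) (bitAt-++ʳ xs ys i)

  bitAt-++ˡ : ∀ xs ys {i} → i < length xs → bitAt (xs ++ ys) i ≡ bitAt xs i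
  bitAt-++ˡ (false ∷ xs) ys {zero}  _       = refl
  bitAt-++ˡ (true  ∷ xs) ys {zero}  _       = refl
  bitAt-++ˡ (x ∷ xs)     ys {suc i} (s≤s p) =
    trans (bitAt-∷ x (xs ++ ys) i) (trans (bitAt-++ˡ xs ys p) (sym (bitAt-∷ x xs i)))

  bitAt-replicate : ∀ n {i} → i < n → bitAt (replicate n true) i ≡ 1
  bitAt-replicate (suc n) {zero}  _       = refl
  bitAt-replicate (suc n) {suc i} (s≤s p) = bitAt-replicate n p

  bits-ext : ∀ {xs ys} → length xs ≡ length ys → (∀ i → i < length xs → bitAt xs i ≡ bitAt ys i) → xs ≡ ys
  bits-ext {[]}     {[]}     eq h = refl
  bits-ext {x ∷ xs} {y ∷ ys} eq h = cong₂ _∷_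
    (toNat-injective (trans (sym (head-bit x xs)) (trans (h 0 (s≤s z≤n)) (head-bit y ys))))
    (bits-ext (suc-injective eq) λ i i< → trans (sym (bitAt-∷ x xs i)) (trans (h (suc i) (s≤s i<)) (bitAt-∷ y ys i)))
    where
    head-bit : ∀ b zs → bitAt (b ∷ zs) 0 ≡ toNat b
    head-bit false zs = refl
    head-bit true  zs = refl

  repeat-cong : ∀ {A : Set} n {f g : ℕ → List A} → (∀ i → i < n → f i ≡ g i) → repeat n f ≡ repeat n g
  repeat-cong zero    h = refl
  repeat-cong (suc n) h = cong₂ _++_ (repeat-cong n (λ i p → h i (m≤n⇒m≤1+n p))) (h n ≤-refl)

  repeat-suc : ∀ {A : Set} n (f : ℕ → List A) → repeat (suc n) f ≡ f 0 ++ repeat n (f ∘ suc)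
  repeat-suc zero    f = sym (++-identityʳ (f 0))
  repeat-suc (suc n) f =
    trans (cong (_++ f (suc n)) (repeat-suc n f)) (++-assoc (f 0) (repeat n (f ∘ suc)) (f (suc n)))

  repeat-+ : ∀ {A : Set} m n (f : ℕ → List A) → repeat (m + n) f ≡ repeat m f ++ repeat n (f ∘ (m +_))
  repeat-+ m zero    f = trans (cong (λ k → repeat k f) (+-identityʳ m)) (sym (++-identityʳ _))
  repeat-+ m (suc n) f =
    trans (cong (λ k → repeat k f) (+-suc m n))
    (trans (cong (_++ f (m + n)) (repeat-+ m n f)) (++-assoc (repeat m f) _ _))

  -- Splits an index into quotient and remainder, which turns a loop over vertices into nested loops
  -- over their coordinates.
  repeat-* : ∀ {A : Set} k n (f : ℕ → List A) → repeat (k * n) f ≡ repeat n λ i → repeat k λ j → f (k * i + j)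
  repeat-* k zero    f = cong (λ m → repeat m f) (*-zeroʳ k)
  repeat-* k (suc n) f =
    trans (cong (λ m → repeat m f) (trans (*-suc k n) (+-comm k (k * n))))
    (trans (repeat-+ (k * n) k f) (cong (_++ repeat k (λ j → f (k * n + j))) (repeat-* k n f)))

  repeat-true : ∀ n → repeat n (λ _ → true ∷ []) ≡ replicate n true
  repeat-true zero    = refl
  repeat-true (suc n) = trans (repeat-suc n (λ _ → true ∷ [])) (cong (true ∷_) (repeat-true n))

  concatMap-tabulate : ∀ {A B : Set} n (k : Fin n → A) (g : A → List B) (h : ℕ → List B) →
    (∀ i → g (k i) ≡ h (toℕ i)) → concatMap g (List.tabulate k) ≡ repeat n h
  concatMap-tabulate zero    k g h eq = refl
  concatMap-tabulate (suc n) k g h eq =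
    trans (cong₂ _++_ (eq zero) (concatMap-tabulate n (k ∘ suc) g (h ∘ suc) (eq ∘ suc))) (sym (repeat-suc n h))

  map-tabulate′ : ∀ {A B : Set} n (k : Fin n → A) (g : A → B) (h : ℕ → B) →
    (∀ i → g (k i) ≡ h (toℕ i)) → map g (List.tabulate k) ≡ repeat n (λ i → h i ∷ [])
  map-tabulate′ zero    k g h eq = refl
  map-tabulate′ (suc n) k g h eq =
    trans (cong₂ _∷_ (eq zero) (map-tabulate′ n (k ∘ suc) g (h ∘ suc) (eq ∘ suc))) (sym (repeat-suc n (λ i → h i ∷ [])))

  length-repeat : ∀ {A : Set} {k} n {f : ℕ → List A} → (∀ i → length (f i) ≡ k) → length (repeat n f) ≡ k * n
  length-repeat {k = k} zero    h = sym (*-zeroʳ k)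
  length-repeat {k = k} (suc n) {f} h =
    trans (length-++ (repeat n f)) (trans (cong₂ _+_ (length-repeat n h) (h n)) (trans (+-comm (k * n) k) (sym (*-suc k n))))

  position< : ∀ {k n i j} → i < n → j < k → k * i + j < k * n
  position< {k} {n} {i} {j} i<n j<k =
    <-≤-trans (+-monoʳ-< (k * i) j<k)
    (≤-trans (≤-reflexive (trans (+-comm (k * i) k) (sym (*-suc k i)))) (*-monoʳ-≤ k i<n))

  bitAt-repeat : ∀ {k} n {f : ℕ → List Bool} → (∀ i → length (f i) ≡ k) → ∀ {i j} → i < n → j < k →
    bitAt (repeat n f) (k * i + j) ≡ bitAt (f i) j
  bitAt-repeat {k} (suc n) {f} h {i} {j} i<n j<k with i ≟ n
  ... | yes refl = trans (cong (λ l → bitAt (repeat n f ++ f n) (l + j)) (sym (length-repeat n h))) (bitAt-++ʳ (repeat n f) (f n) j)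
  ... | no i≢n   = trans
    (bitAt-++ˡ (repeat n f) (f n) (subst (k * i + j <_) (sym (length-repeat n h)) (position< i<n′ j<k)))
    (bitAt-repeat n h i<n′ j<k)
    where i<n′ = ≤∧≢⇒< (s≤s⁻¹ i<n) i≢n

  rows : ℕ → (ℕ → ℕ → Bool) → List Bool
  rows n f = repeat n λ u → repeat n λ v → f u v ∷ []

  encoding : ℕ → (ℕ → ℕ → Bool) → List Bool
  encoding n f = replicate n true ++ false ∷ rows n f

  encode-encoding : ∀ {n} (G : Graph n) f → (∀ u v → Graph.adj G u v ≡ f (toℕ u) (toℕ v)) → encode G ≡ encoding n f
  encode-encoding {n} G f eq = cong (λ r → replicate n true ++ false ∷ r)
    (concatMap-tabulate n id _ _ λ u → map-tabulate′ n id _ (f (toℕ u)) (eq u))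

  length-row : ∀ n (f : ℕ → Bool) → length (repeat n λ v → f v ∷ []) ≡ n
  length-row n f = trans (length-repeat n (λ _ → refl)) (*-identityˡ n)

  length-encoding : ∀ n f → length (encoding n f) ≡ n + suc (n * n)
  length-encoding n f = trans (length-++ (replicate n true))
    (cong₂ (λ a b → a + suc b) (length-replicate n) (length-repeat n (λ u → length-row n (f u))))

  bitAt-rows : ∀ {n} f {u v} → u < n → v < n → bitAt (rows n f) (n * u + v) ≡ toNat (f u v)
  bitAt-rows {n} f {u} {v} u<n v<n =
    trans (bitAt-repeat n (λ u → length-row n (f u)) u<n v<n)
    (trans (cong (bitAt (repeat n λ v → f u v ∷ [])) (sym (trans (+-identityʳ (1 * v)) (*-identityˡ v))))
    (trans (bitAt-repeat {1} n {λ v → f u v ∷ []} (λ _ → refl) v<n (s≤s z≤n)) (bitAt-singleton (f u v))))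

  module _ (n : ℕ) (f : ℕ → ℕ → Bool) where

    private
      after-ones : ∀ i → bitAt (encoding n f) (n + i) ≡ bitAt (false ∷ rows n f) i
      after-ones i = trans (cong (λ l → bitAt (encoding n f) (l + i)) (sym (length-replicate n)))
                           (bitAt-++ʳ (replicate n true) (false ∷ rows n f) i)

    encoding-one : ∀ {i} → i < n → bitAt (encoding n f) i ≡ 1
    encoding-one i<n = trans
      (bitAt-++ˡ (replicate n true) _ (subst (_ <_) (sym (length-replicate n)) i<n)) (bitAt-replicate n i<n)

    encoding-zero : bitAt (encoding n f) n ≡ 0
    encoding-zero = trans (cong (bitAt (encoding n f)) (sym (+-identityʳ n))) (after-ones 0)

    encoding-entry : ∀ {u v} → u < n → v < n → bitAt (encoding n f) (n + suc (n * u + v)) ≡ toNat (f u v)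
    encoding-entry u<n v<n = trans (after-ones _) (bitAt-rows f u<n v<n)

  position-split : ∀ {n m i} → i < n * m → ∃[ u ] ∃[ v ] u < m × v < n × i ≡ n * u + v
  position-split {n} {zero}  {i} i< = contradiction (subst (i <_) (*-zeroʳ n) i<) λ ()
  position-split {n} {suc m} {i} i< with i <? n * m
  ... | yes p = let u , v , u< , v< , eq = position-split {n} {m} p in u , v , m≤n⇒m≤1+n u< , v< , eq
  ... | no ¬p = m , i ∸ n * m , ≤-refl ,
    +-cancelˡ-< (n * m) _ n (subst₂ _<_ (sym (m+[n∸m]≡n (≮⇒≥ ¬p))) (trans (*-suc n m) (+-comm n (n * m))) i<) ,
    sym (m+[n∸m]≡n (≮⇒≥ ¬p))

  -- A position is in the block of ones, at its end, or of the form `n + suc (n * u + v)` by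
  -- `position-split`; so the listed bits and the length determine the word.
  encoding-unique : ∀ {x n} f → length x ≡ n + suc (n * n) → (∀ i → i < n → bitAt x i ≡ 1) → bitAt x n ≡ 0 →
    (∀ u v → u < n → v < n → bitAt x (n + suc (n * u + v)) ≡ toNat (f u v)) → x ≡ encoding n f
  encoding-unique {x} {n} f len ones zer entries = bits-ext (trans len (sym (length-encoding n f))) agree
    where
    agree : ∀ i → i < length x → bitAt x i ≡ bitAt (encoding n f) i
    agree i i< with <-cmp i n
    ... | tri< i<n _ _ = trans (ones i i<n) (sym (encoding-one n f i<n))
    ... | tri≈ _ refl _ = trans zer (sym (encoding-zero n f))
    ... | tri> _ _ n<i with k , refl ← m≤n⇒∃[o]m+o≡n n<i
          with u , v , u< , v< , refl ← position-split {n} {n} (+-cancelˡ-< (suc n) k (n * n) (subst (suc n + k <_) (trans len (+-suc n (n * n))) i<))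
          = trans (cong (bitAt x) (sym (+-suc n _))) (trans (entries u v u< v<)
              (trans (sym (encoding-entry n f u< v<)) (cong (bitAt (encoding n f)) (+-suc n _))))

  -- Layout of a pair, here and in the next lemmas: bit `p` of `x` stands at `2p + 1` behind its
  -- flag at `2p`, the delimiter at twice the length of `x`, and `y` right after it.
  bitAt-flag : ∀ x y {p} → p < length x → bitAt ⟨ x , y ⟩ (p * 2) ≡ 1
  bitAt-flag (b ∷ x) y {zero}  _       = refl
  bitAt-flag (b ∷ x) y {suc p} (s≤s h) = trans (bitAt-∷ b _ _) (bitAt-flag x y h)

  bitAt-delimiter : ∀ x y → bitAt ⟨ x , y ⟩ (length x * 2) ≡ 0
  bitAt-delimiter []      y = refl
  bitAt-delimiter (b ∷ x) y = trans (bitAt-∷ b _ _) (bitAt-delimiter x y)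

  bitAt-first : ∀ x y {p} → p < length x → bitAt ⟨ x , y ⟩ (suc (p * 2)) ≡ bitAt x p
  bitAt-first (false ∷ x) y {zero}  _       = refl
  bitAt-first (true  ∷ x) y {zero}  _       = refl
  bitAt-first (b ∷ x)     y {suc p} (s≤s h) =
    trans (bitAt-∷ b _ _) (trans (bitAt-first x y h) (sym (bitAt-∷ b x p)))

  bitAt-second : ∀ x y q → bitAt ⟨ x , y ⟩ (length x * 2 + suc q) ≡ bitAt y q
  bitAt-second []      y q = refl
  bitAt-second (b ∷ x) y q = trans (bitAt-∷ b _ _) (bitAt-second x y q)

  length-pair : ∀ x y → length ⟨ x , y ⟩ ≡ length x * 2 + suc (length y)
  length-pair []      y = refl
  length-pair (b ∷ x) y = cong (2 +_) (length-pair x y)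

-- In-out-degrees and in-degrees in 4-regular graphs.

module Orientations where

  open Expressions using (sum)
  open Encodings
  open import Data.Integer.Base using (_⊖_) renaming (∣_∣ to abs)
  open import Data.List.Base using (map; allFin)
  open import Data.List.Extrema.Nat using (max; xs≤max; max≤v⁺)
  open import Data.List.Membership.Propositional.Properties using (∈-allFin; ∈-map⁺)
  open import Data.List.Relation.Unary.All as All using (All)
  import Data.List.Relation.Unary.All.Properties as All

  count-∷ : ∀ {n} b (p : Vec Bool n) → ∣ b ∷ p ∣ ≡ toNat b + ∣ p ∣
  count-∷ false p = refl
  count-∷ true  p = refl

  sum-suc : ∀ n f → sum (suc n) f ≡ f 0 + sum n (f ∘ suc)
  sum-suc zero    f = refl
  sum-suc (suc n) f = begin
    f (suc n) + sum (suc n) f             ≡⟨ cong (f (suc n) +_) (sum-suc n f) ⟩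
    f (suc n) + (f 0 + sum n (f ∘ suc))   ≡⟨ sym (+-assoc (f (suc n)) (f 0) _) ⟩
    f (suc n) + f 0 + sum n (f ∘ suc)     ≡⟨ cong (_+ sum n (f ∘ suc)) (+-comm (f (suc n)) (f 0)) ⟩
    f 0 + f (suc n) + sum n (f ∘ suc)     ≡⟨ +-assoc (f 0) (f (suc n)) _ ⟩
    f 0 + sum (suc n) (f ∘ suc)           ∎
    where open ≡-Reasoning

  count-sum : ∀ {n} (f : Fin n → Bool) (g : ℕ → ℕ) → (∀ i → toNat (f i) ≡ g (toℕ i)) → ∣ tabulate f ∣ ≡ sum n g
  count-sum {zero}  f g h = refl
  count-sum {suc n} f g h =
    trans (count-∷ (f zero) (tabulate (f ∘ suc)))
    (trans (cong₂ _+_ (h zero) (count-sum (f ∘ suc) (g ∘ suc) (h ∘ suc))) (sym (sum-suc n g)))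

  count-+ : ∀ {n} (f g h : Fin n → Bool) → (∀ i → toNat (f i) + toNat (g i) ≡ toNat (h i)) →
    ∣ tabulate f ∣ + ∣ tabulate g ∣ ≡ ∣ tabulate h ∣
  count-+ {zero}  f g h eq = refl
  count-+ {suc n} f g h eq
    rewrite count-∷ (f zero) (tabulate (f ∘ suc)) | count-∷ (g zero) (tabulate (g ∘ suc)) | count-∷ (h zero) (tabulate (h ∘ suc))
    = trans (+-interchange (toNat (f zero)) _ (toNat (g zero)) _)
            (cong₂ _+_ (eq zero) (count-+ (f ∘ suc) (g ∘ suc) (h ∘ suc) (eq ∘ suc)))
    where
    +-interchange : ∀ a b c d → (a + b) + (c + d) ≡ (a + c) + (b + d)
    +-interchange a b c d = begin
      (a + b) + (c + d) ≡⟨ +-assoc a b _ ⟩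
      a + (b + (c + d)) ≡⟨ cong (a +_) (trans (sym (+-assoc b c d)) (trans (cong (_+ d) (+-comm b c)) (+-assoc c b d))) ⟩
      a + (c + (b + d)) ≡⟨ sym (+-assoc a c _) ⟩
      (a + c) + (b + d) ∎
      where open ≡-Reasoning

  count-witness : ∀ {n} (f : Fin n → Bool) → 0 < ∣ tabulate f ∣ → ∃[ i ] f i ≡ true
  count-witness {suc n} f p with f zero in eq
  ... | true  = zero , eq
  ... | false = let i , q = count-witness (f ∘ suc) p in suc i , q

  module _ {n} {G : Graph n} (D : Orientation G) where

    open Graph G
    open Orientation D

    in+out≡degree : ∀ v → inDegree v + outDegree v ≡ degree v
    in+out≡degree v = count-+ (λ u → arc u v) (arc v) (adj v) pointwise
      where
      pointwise : ∀ u → toNat (arc u v) + toNat (arc v u) ≡ toNat (adj v u)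
      pointwise u with adj v u in e | arc v u in a | arc u v in b
      ... | true  | true  | false = refl
      ... | true  | false | true  = refl
      ... | false | false | false = refl
      ... | true  | true  | true  with () ← trans (sym (exactlyOne v u e)) (cong₂ _xor_ a b)
      ... | true  | false | false with () ← trans (sym (exactlyOne v u e)) (cong₂ _xor_ a b)
      ... | false | true  | _     with () ← trans (sym e) (arc⇒edge v u a)
      ... | false | false | true  with () ← trans (sym e) (trans (symmetric v u) (arc⇒edge u v b))

  -- In a 4-regular graph, an in-out-degree of absolute value at most 2 is
  -- an in-degree from 1 to 3, and the in-degree determines it.
  Balanced : ∀ {n} {G : Graph n} → Orientation G → Set
  Balanced {G = G} D =
    (∀ v → 0 < inDegree v × inDegree v < 4) ×
    (∀ u v → Graph.adj G u v ≡ true → inDegree u ≢ inDegree v)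
    where open Orientation D

  abs≤2⇒ : ∀ i o → i + o ≡ 4 → abs (i ⊖ o) ≤ 2 → 0 < i × i < 4
  abs≤2⇒ 0 4 refl (s≤s (s≤s ()))
  abs≤2⇒ 1 3 refl h = s≤s z≤n , s≤s (s≤s z≤n)
  abs≤2⇒ 2 2 refl h = s≤s z≤n , s≤s (s≤s (s≤s z≤n))
  abs≤2⇒ 3 1 refl h = s≤s z≤n , ≤-refl
  abs≤2⇒ 4 0 refl (s≤s (s≤s ()))
  abs≤2⇒ (suc (suc (suc (suc (suc i))))) o ()

  ⇒abs≤2 : ∀ i o → i + o ≡ 4 → 0 < i × i < 4 → abs (i ⊖ o) ≤ 2
  ⇒abs≤2 1 3 refl h = ≤-refl
  ⇒abs≤2 2 2 refl h = z≤n
  ⇒abs≤2 3 1 refl h = ≤-refl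
  ⇒abs≤2 0 o eq (() , _)
  ⇒abs≤2 (suc (suc (suc (suc i)))) o eq (_ , s≤s (s≤s (s≤s (s≤s ()))))

  -- The difference is even because the sum is 4, so it vanishes or has absolute value at least 2.
  ⇒2≤abs : ∀ i o → i + o ≡ 4 → i ≢ 2 → 2 ≤ abs (i ⊖ o)
  ⇒2≤abs 0 4 refl h = s≤s (s≤s z≤n)
  ⇒2≤abs 1 3 refl h = ≤-refl
  ⇒2≤abs 2 o eq   h = contradiction refl h
  ⇒2≤abs 3 1 refl h = ≤-refl
  ⇒2≤abs 4 0 refl h = s≤s (s≤s z≤n)
  ⇒2≤abs (suc (suc (suc (suc (suc i))))) o ()

  ⊖-injective : ∀ i o j p → i + o ≡ 4 → j + p ≡ 4 → i ⊖ o ≡ j ⊖ p → i ≡ j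
  ⊖-injective 0 4 0 4 refl refl eq = refl
  ⊖-injective 1 3 1 3 refl refl eq = refl
  ⊖-injective 2 2 2 2 refl refl eq = refl
  ⊖-injective 3 1 3 1 refl refl eq = refl
  ⊖-injective 4 0 4 0 refl refl eq = refl
  ⊖-injective 0 4 1 3 refl refl ()
  ⊖-injective 0 4 2 2 refl refl ()
  ⊖-injective 0 4 3 1 refl refl ()
  ⊖-injective 0 4 4 0 refl refl ()
  ⊖-injective 1 3 0 4 refl refl ()
  ⊖-injective 1 3 2 2 refl refl ()
  ⊖-injective 1 3 3 1 refl refl ()
  ⊖-injective 1 3 4 0 refl refl ()
  ⊖-injective 2 2 0 4 refl refl ()
  ⊖-injective 2 2 1 3 refl refl ()
  ⊖-injective 2 2 3 1 refl refl ()
  ⊖-injective 2 2 4 0 refl refl ()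
  ⊖-injective 3 1 0 4 refl refl ()
  ⊖-injective 3 1 1 3 refl refl ()
  ⊖-injective 3 1 2 2 refl refl ()
  ⊖-injective 3 1 4 0 refl refl ()
  ⊖-injective 4 0 0 4 refl refl ()
  ⊖-injective 4 0 1 3 refl refl ()
  ⊖-injective 4 0 2 2 refl refl ()
  ⊖-injective 4 0 3 1 refl refl ()
  ⊖-injective (suc (suc (suc (suc (suc i))))) o j p ()
  ⊖-injective i o (suc (suc (suc (suc (suc j))))) p eq ()

  module _ {n} {G : Graph n} (regular : Regular 4 G) where

    open Graph G

    in+out≡4 : ∀ (D : Orientation G) v → Orientation.inDegree D v + Orientation.outDegree D v ≡ 4
    in+out≡4 D v = trans (in+out≡degree D v) (regular v)

    abs≤max : ∀ (D : Orientation G) v → abs (Orientation.inOutDegree D v) ≤ Orientation.maxAbsInOutDegree D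
    abs≤max D v = All.lookup (xs≤max 0 (map (λ v → abs (Orientation.inOutDegree D v)) (allFin n)))
                             (∈-map⁺ (λ v → abs (Orientation.inOutDegree D v)) (∈-allFin v))

    max≤2 : ∀ (D : Orientation G) → Balanced D → Orientation.maxAbsInOutDegree D ≤ 2
    max≤2 D (range , _) = max≤v⁺ z≤n (All.map⁺ (All.tabulate {xs = allFin n} λ {v} _ →
      ⇒abs≤2 _ (Orientation.outDegree D v) (in+out≡4 D v) (range v)))

    proper⇒ : ∀ (D : Orientation G) → Orientation.InOutProper D →
      ∀ u v → adj u v ≡ true → Orientation.inDegree D u ≢ Orientation.inDegree D v
    proper⇒ D P u v e eq = P u v e (cong₂ _⊖_ eq
      (+-cancelˡ-≡ (inDegree u) _ _ (trans (in+out≡4 D u) (sym (trans (cong (_+ outDegree v) eq) (in+out≡4 D v))))))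
      where open Orientation D

    -- Of two adjacent vertices at most one has in-degree 2, and every other in-degree gives an
    -- absolute value of at least 2. So a balanced orientation attains the minimum, and the
    -- orientation number exists without a search through all orientations.
    2≤max : Fin n → ∀ (D : Orientation G) → Orientation.InOutProper D → 2 ≤ Orientation.maxAbsInOutDegree D
    2≤max v D P with u , e ← count-witness (adj v) (subst (0 <_) (sym (regular v)) (s≤s z≤n))
      with Orientation.inDegree D v ≟ 2
    ... | no  v≢2 = ≤-trans (⇒2≤abs _ (Orientation.outDegree D v) (in+out≡4 D v) v≢2) (abs≤max D v)
    ... | yes v≡2 = ≤-trans (⇒2≤abs _ (Orientation.outDegree D u) (in+out≡4 D u)
                      (λ u≡2 → proper⇒ D P v u e (trans v≡2 (sym u≡2)))) (abs≤max D u)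

    balanced⇔ : (InOutProperOrientationNumber≤ G 2 → Σ[ D ∈ Orientation G ] Balanced D) ×
                ((Σ[ D ∈ Orientation G ] Balanced D) → InOutProperOrientationNumber≤ G 2)
    balanced⇔ = to , from
      where
      to : InOutProperOrientationNumber≤ G 2 → Σ[ D ∈ Orientation G ] Balanced D
      to (k , ((D , P , eq) , _) , k≤2) = D ,
        (λ v → abs≤2⇒ _ (Orientation.outDegree D v) (in+out≡4 D v)
                 (≤-trans (abs≤max D v) (≤-trans (≤-reflexive eq) k≤2))) ,
        proper⇒ D P

      from : (Σ[ D ∈ Orientation G ] Balanced D) → InOutProperOrientationNumber≤ G 2
      from (D , B@(range , distinct)) = maxAbsInOutDegree D , ((D , P , refl) , least) , max≤2 D B
        where
        open Orientation
        P : InOutProper D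
        P u v e eq = distinct u v e
          (⊖-injective _ (outDegree D u) _ (outDegree D v) (in+out≡4 D u) (in+out≡4 D v) eq)
        -- Argued vertex by vertex, which covers the graph without vertices, where both maxima are
        -- 0.
        least : ∀ D′ → InOutProper D′ → maxAbsInOutDegree D ≤ maxAbsInOutDegree D′
        least D′ P′ = max≤v⁺ z≤n (All.map⁺ (All.tabulate {xs = allFin n} λ {v} _ →
          ≤-trans (⇒abs≤2 _ (outDegree D v) (in+out≡4 D v) (range v)) (2≤max v D′ P′)))

-- The problem is in NP.

module Membership where

  open Expressions
  open Commands using (positive)
  open Formulas
  open Encodings
  open Orientations

  extend : ∀ {n} → (Fin n → Fin n → Bool) → ℕ → ℕ → Bool
  extend {n} f u v with u <? n | v <? n
  ... | yes p | yes q = f (fromℕ< p) (fromℕ< q)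
  ... | _     | _     = false

  extend-toℕ : ∀ {n} (f : Fin n → Fin n → Bool) u v → extend f (toℕ u) (toℕ v) ≡ f u v
  extend-toℕ {n} f u v with toℕ u <? n | toℕ v <? n
  ... | yes p | yes q = cong₂ f (fromℕ<-toℕ u p) (fromℕ<-toℕ v q)
  ... | yes p | no ¬q = contradiction (toℕ<n v) ¬q
  ... | no ¬p | _     = contradiction (toℕ<n u) ¬p

  toNat-positive : ∀ {n} → n ≤ 1 → toNat (positive n) ≡ n
  toNat-positive z≤n       = refl
  toNat-positive (s≤s z≤n) = refl

  positive-true : ∀ {n} → n ≤ 1 → positive n ≡ true → n ≡ 1
  positive-true (s≤s z≤n) eq = refl

  toNat-true : ∀ {b} → toNat b ≡ 1 → b ≡ true
  toNat-true {true} eq = refl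

  module _ (n : ℕ) (a d : ℕ → ℕ → ℕ) where

    inCount : ℕ → ℕ
    inCount u = sum n λ v → d v u

    -- Arithmetic conditions on an adjacency matrix `a` and an arc matrix `d`. That in-degrees
    -- differ is put as a disjunction of strict inequalities, the form available to formulas.
    ArcOK : ℕ → ℕ → Set
    ArcOK u v = a u v ≡ a v u × (d u v ≡ 1 → a u v ≡ 1) × (a u v ≡ 1 → d u v + d v u ≡ 1) ×
                (a u v ≡ 1 → inCount u < inCount v ⊎ inCount v < inCount u)

    VertexOK : ℕ → Set
    VertexOK u = a u u ≡ 0 × sum n (λ v → a u v) ≡ 4 × 0 < inCount u × inCount u < 4 × (∀ v → v < n → ArcOK u v)

    module _ (a≤1 : ∀ u v → a u v ≤ 1) (d≤1 : ∀ u v → d u v ≤ 1) (ok : ∀ u → u < n → VertexOK u) where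

      private
        vertex : (u : Fin n) → VertexOK (toℕ u)
        vertex u = ok (toℕ u) (toℕ<n u)

        arcs : (u v : Fin n) → ArcOK (toℕ u) (toℕ v)
        arcs u v = proj₂ (proj₂ (proj₂ (proj₂ (vertex u)))) (toℕ v) (toℕ<n v)

      numericGraph : Graph n
      numericGraph = record
        { adj         = λ u v → positive (a (toℕ u) (toℕ v))
        ; symmetric   = λ u v → cong positive (proj₁ (arcs u v))
        ; irreflexive = λ v → cong positive (proj₁ (vertex v)) }

      numericRegular : Regular 4 numericGraph
      numericRegular v = trans (count-sum {n} _ (a (toℕ v)) (λ i → toNat-positive (a≤1 _ _))) (proj₁ (proj₂ (vertex v)))

      numericOrientation : Orientation numericGraph
      numericOrientation = record
        { arc        = λ u v → positive (d (toℕ u) (toℕ v))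
        ; arc⇒edge   = λ u v e → cong positive (proj₁ (proj₂ (arcs u v)) (positive-true (d≤1 _ _) e))
        ; exactlyOne = λ u v e → one (d≤1 _ _) (d≤1 _ _) (proj₁ (proj₂ (proj₂ (arcs u v))) (positive-true (a≤1 _ _) e)) }
        where
        one : ∀ {x y} → x ≤ 1 → y ≤ 1 → x + y ≡ 1 → positive x xor positive y ≡ true
        one z≤n       (s≤s z≤n) eq = refl
        one (s≤s z≤n) z≤n       eq = refl

      numericBalanced : Balanced numericOrientation
      numericBalanced =
        (λ v → subst (0 <_) (sym (inDegree≡ v)) (proj₁ (proj₂ (proj₂ (vertex v)))) ,
               subst (_< 4) (sym (inDegree≡ v)) (proj₁ (proj₂ (proj₂ (proj₂ (vertex v)))))) ,
        λ u v e eq → distinct (proj₂ (proj₂ (proj₂ (arcs u v))) (positive-true (a≤1 _ _) e))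
          (trans (sym (inDegree≡ u)) (trans eq (inDegree≡ v)))
        where
        open Orientation numericOrientation
        inDegree≡ : ∀ v → inDegree v ≡ inCount (toℕ v)
        inDegree≡ v = count-sum {n} _ (λ u → d u (toℕ v)) (λ i → toNat-positive (d≤1 _ _))
        distinct : ∀ {x y} → x < y ⊎ y < x → x ≢ y
        distinct (inj₁ lt) = <⇒≢ lt
        distinct (inj₂ lt) = <⇒≢ lt ∘ sym

    module _ {G : Graph n} (regular : Regular 4 G) (D : Orientation G) (balanced : Balanced D) where

      open Graph G
      open Orientation D

      module _ (a≡ : ∀ u v → a (toℕ u) (toℕ v) ≡ toNat (adj u v)) (d≡ : ∀ u v → d (toℕ u) (toℕ v) ≡ toNat (arc u v)) where

        private
          inDegree≡ : ∀ v → inCount (toℕ v) ≡ inDegree v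
          inDegree≡ v = sym (count-sum _ (λ u → d u (toℕ v)) (λ i → sym (d≡ i v)))

          edge : ∀ u v → a (toℕ u) (toℕ v) ≡ 1 → adj u v ≡ true
          edge u v e = toNat-true (trans (sym (a≡ u v)) e)

          arcOK : ∀ u v → ArcOK (toℕ u) (toℕ v)
          arcOK u v =
            trans (a≡ u v) (trans (cong toNat (symmetric u v)) (sym (a≡ v u))) ,
            (λ e → trans (a≡ u v) (cong toNat (arc⇒edge u v (toNat-true (trans (sym (d≡ u v)) e))))) ,
            (λ e → trans (cong₂ _+_ (d≡ u v) (d≡ v u)) (one {arc u v} (exactlyOne u v (edge u v e)))) ,
            λ e → subst₂ (λ x y → x < y ⊎ y < x) (sym (inDegree≡ u)) (sym (inDegree≡ v))
                         (distinct (proj₂ balanced u v (edge u v e)))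
            where
            one : ∀ {b c} → b xor c ≡ true → toNat b + toNat c ≡ 1
            one {true}  {false} eq = refl
            one {false} {true}  eq = refl
            distinct : ∀ {x y} → x ≢ y → x < y ⊎ y < x
            distinct {x} {y} ne with <-cmp x y
            ... | tri< lt _ _ = inj₁ lt
            ... | tri≈ _ eq _ = contradiction eq ne
            ... | tri> _ _ gt = inj₂ gt

        vertexOK : ∀ u → u < n → VertexOK u
        vertexOK u u<n = subst VertexOK (toℕ-fromℕ< u<n) (ok (fromℕ< u<n))
          where
          ok : ∀ u → VertexOK (toℕ u)
          ok u = trans (a≡ u u) (cong toNat (irreflexive u)) ,
            trans (sym (count-sum (adj u) (a (toℕ u)) (λ i → sym (a≡ u i)))) (regular u) ,
            subst (0 <_) (sym (inDegree≡ u)) (proj₁ (proj₁ balanced u)) ,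
            subst (_< 4) (sym (inDegree≡ u)) (proj₂ (proj₁ balanced u)) ,
            λ v v<n → subst (ArcOK (toℕ u)) (toℕ-fromℕ< v<n) (arcOK u (fromℕ< v<n))

  pattern v₀ = var zero
  pattern v₁ = var (suc zero)
  pattern v₂ = var (suc (suc zero))
  pattern v₃ = var (suc (suc (suc zero)))
  pattern v₄ = var (suc (suc (suc (suc zero))))
  pattern v₅ = var (suc (suc (suc (suc (suc zero)))))

  module _ {k : ℕ} where

    -- Bit p of x, in the input ⟨ x , y ⟩.
    firstBit : Expr k → Expr k
    firstBit p = inp (con 1 ⊕ p ⊗ con 2)

    graphLength : Expr k → Expr k
    graphLength n = n ⊕ (con 1 ⊕ n ⊗ n)

    edgeBit arcBit : Expr k → Expr k → Expr k → Expr k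
    edgeBit n u v = firstBit (n ⊕ (con 1 ⊕ (n ⊗ u ⊕ v)))
    arcBit  n u v = inp (graphLength n ⊗ con 2 ⊕ (con 1 ⊕ (n ⊗ u ⊕ v)))

  -- Its truth unfolds to `Verified`. The outer quantifier guesses the number of vertices; flags and
  -- delimiter fix the length of the first component, the next two clauses its header, and the rest
  -- is `VertexOK` for its matrix and the arc matrix, the certificate.
  verifier : Formula 1
  verifier = ∃< v₀ (
    ∀< (graphLength v₀) (inp (v₀ ⊗ con 2) ≐ con 1) ∧
    inp (graphLength v₀ ⊗ con 2) ≐ con 0 ∧
    ∀< v₀ (firstBit v₀ ≐ con 1) ∧
    firstBit v₀ ≐ con 0 ∧
    ∀< v₀ (
      edgeBit v₁ v₀ v₀ ≐ con 0 ∧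
      ∑ v₁ (edgeBit v₂ v₁ v₀) ≐ con 4 ∧
      con 0 ≺ ∑ v₁ (arcBit v₂ v₀ v₁) ∧
      ∑ v₁ (arcBit v₂ v₀ v₁) ≺ con 4 ∧
      ∀< v₁ (
        edgeBit v₂ v₁ v₀ ≐ edgeBit v₂ v₀ v₁ ∧
        (arcBit v₂ v₁ v₀ ≐ con 1 ⇒ edgeBit v₂ v₁ v₀ ≐ con 1) ∧
        (edgeBit v₂ v₁ v₀ ≐ con 1 ⇒ arcBit v₂ v₁ v₀ ⊕ arcBit v₂ v₀ v₁ ≐ con 1) ∧
        (edgeBit v₂ v₁ v₀ ≐ con 1 ⇒
          ∑ v₂ (arcBit v₃ v₀ v₂) ≺ ∑ v₂ (arcBit v₃ v₀ v₁) ∨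
          ∑ v₂ (arcBit v₃ v₀ v₁) ≺ ∑ v₂ (arcBit v₃ v₀ v₂)))))

  Target : Language
  Target = RegularInOutProperOrientation 4 2

  edges arcs : List Bool → ℕ → ℕ → ℕ → ℕ
  edges w n u v = bitAt w (suc ((n + suc (n * u + v)) * 2))
  arcs  w n u v = bitAt w ((n + suc (n * n)) * 2 + suc (n * u + v))

  Verified : List Bool → Set
  Verified w = ∃[ n ] n < length w ×
    (∀ p → p < n + suc (n * n) → bitAt w (p * 2) ≡ 1) ×
    bitAt w ((n + suc (n * n)) * 2) ≡ 0 ×
    (∀ p → p < n → bitAt w (suc (p * 2)) ≡ 1) ×
    bitAt w (suc (n * 2)) ≡ 0 ×
    (∀ u → u < n → VertexOK n (edges w n) (arcs w n) u)

  target⇒ : ∀ {x} → Target x → ∃[ y ] length y ≤ length x × Verified ⟨ x , y ⟩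
  target⇒ {x} (n , G , regular , number , refl)
    with D , balanced ← proj₁ (balanced⇔ regular) number
    = y , length-y , n , n<w , flags , delimiter , ones , zer ,
      vertexOK n (edges w n) (arcs w n) regular D balanced edges≡ arcs≡
    where
    open Graph G
    open Orientation D
    f = extend adj
    g = extend arc
    y = rows n g
    w = ⟨ encode G , y ⟩

    x≡ : encode G ≡ encoding n f
    x≡ = encode-encoding G f (λ u v → sym (extend-toℕ adj u v))

    length-x : length (encode G) ≡ n + suc (n * n)
    length-x = trans (cong length x≡) (length-encoding n f)

    length-y : length y ≤ length (encode G)
    length-y = subst₂ _≤_ (sym (length-repeat n (λ u → length-row n (g u)))) (sym length-x)
      (≤-trans (n≤1+n _) (m≤n+m _ n))

    x< : ∀ {p} → p < n + suc (n * n) → p < length (encode G)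
    x< = subst (_ <_) (sym length-x)

    first : ∀ {p} → p < n + suc (n * n) → bitAt w (suc (p * 2)) ≡ bitAt (encoding n f) p
    first p< = trans (bitAt-first (encode G) y (x< p<)) (cong (λ z → bitAt z _) x≡)

    n<w : n < length w
    n<w = subst (n <_) (sym (length-pair (encode G) y))
      (≤-trans (≤-trans (m<m+n n (s≤s z≤n)) (≤-reflexive (sym length-x)))
               (≤-trans (m≤m*n (length (encode G)) 2) (m≤m+n _ _)))

    flags : ∀ p → p < n + suc (n * n) → bitAt w (p * 2) ≡ 1
    flags p p< = bitAt-flag (encode G) y (x< p<)

    delimiter : bitAt w ((n + suc (n * n)) * 2) ≡ 0
    delimiter = trans (cong (λ l → bitAt w (l * 2)) (sym length-x)) (bitAt-delimiter (encode G) y)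

    ones : ∀ p → p < n → bitAt w (suc (p * 2)) ≡ 1
    ones p p<n = trans (first (<-≤-trans p<n (m≤m+n n _))) (encoding-one n f p<n)

    zer : bitAt w (suc (n * 2)) ≡ 0
    zer = trans (first (m<m+n n (s≤s z≤n))) (encoding-zero n f)

    edges≡ : ∀ u v → edges w n (toℕ u) (toℕ v) ≡ toNat (adj u v)
    edges≡ u v = trans (first (+-monoʳ-< n (s≤s (position< (toℕ<n u) (toℕ<n v)))))
      (trans (encoding-entry n f (toℕ<n u) (toℕ<n v)) (cong toNat (extend-toℕ adj u v)))

    arcs≡ : ∀ u v → arcs w n (toℕ u) (toℕ v) ≡ toNat (arc u v)
    arcs≡ u v = trans (cong (λ l → bitAt w (l * 2 + suc (n * toℕ u + toℕ v))) (sym length-x))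
      (trans (bitAt-second (encode G) y _)
      (trans (bitAt-rows g (toℕ<n u) (toℕ<n v)) (cong toNat (extend-toℕ arc u v))))

  target⇐ : ∀ {x y} → Verified ⟨ x , y ⟩ → Target x
  target⇐ {x} {y} (n , _ , flags , delimiter , ones , zer , ok) =
    n , G , numericRegular n a d a≤1 d≤1 ok , proj₂ (balanced⇔ (numericRegular n a d a≤1 d≤1 ok))
      (numericOrientation n a d a≤1 d≤1 ok , numericBalanced n a d a≤1 d≤1 ok) ,
    trans (encoding-unique f length-x (λ i i<n → trans (sym (first (<-≤-trans i<n (m≤m+n n _)))) (ones i i<n))
            (trans (sym (first (m<m+n n (s≤s z≤n)))) zer)
            (λ u v u<n v<n → trans (sym (first (+-monoʳ-< n (s≤s (position< u<n v<n))))) (sym (toNat-positive (a≤1 u v)))))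
          (sym (encode-encoding G f (λ u v → refl)))
    where
    w = ⟨ x , y ⟩
    a = edges w n
    d = arcs w n
    a≤1 : ∀ u v → a u v ≤ 1
    a≤1 u v = bitAt≤1 w _
    d≤1 : ∀ u v → d u v ≤ 1
    d≤1 u v = bitAt≤1 w _
    G = numericGraph n a d a≤1 d≤1 ok
    f : ℕ → ℕ → Bool
    f u v = positive (a u v)

    -- Were `x` shorter, its delimiter 0 would stand where a flag 1 is demanded; were it longer, a
    -- flag would stand where the delimiter is demanded.
    length-x : length x ≡ n + suc (n * n)
    length-x with <-cmp (length x) (n + suc (n * n))
    ... | tri≈ _ eq _ = eq
    ... | tri< lt _ _ with () ← trans (sym (flags (length x) lt)) (bitAt-delimiter x y)
    ... | tri> _ _ gt with () ← trans (sym (bitAt-flag x y gt)) delimiter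

    first : ∀ {p} → p < n + suc (n * n) → bitAt w (suc (p * 2)) ≡ bitAt x p
    first p< = bitAt-first x y (subst (_ <_) (sym length-x) p<)

  Target-InNP : InNP Target
  -- The bound `X` works because the `n * n` certificate bits are fewer than the bits of the encoded
  -- graph.
  Target-InNP = _ , X , formula-InP verifier , λ x → mk⇔ target⇒ (λ (y , _ , v) → target⇐ {x} {y} v)

-- Four-regular graphs and their orientations from darts.

module DartGraphs where

  open Encodings
  open Orientations
  open import Data.Bool.Base using (_∨_; T)
  open import Data.Bool.Properties using (T?)

  count-false : ∀ {n} (f : Fin n → Bool) → (∀ i → f i ≡ false) → ∣ tabulate f ∣ ≡ 0
  count-false {zero}  f h = refl
  count-false {suc n} f h = trans (count-∷ (f zero) (tabulate (f ∘ suc)))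
    (cong₂ _+_ (cong toNat (h zero)) (count-false (f ∘ suc) (h ∘ suc)))

  count-cong : ∀ {n} {f g : Fin n → Bool} → (∀ i → f i ≡ g i) → ∣ tabulate f ∣ ≡ ∣ tabulate g ∣
  count-cong h = cong ∣_∣ (tabulate-cong h)

  count-single : ∀ {n} (x : Fin n) → ∣ tabulate (λ y → does (x ≟ᶠ y)) ∣ ≡ 1
  count-single {suc n} zero    = cong suc (count-false {n} (λ y → does (zero ≟ᶠ suc y)) (λ _ → refl))
  count-single {suc n} (suc x) = count-single x

  module _ {n : ℕ} where

    Hits : ∀ {k} → (Fin k → Bool) → (Fin k → Fin n) → Fin n → Set
    Hits g t y = ∃[ i ] T (g i) × t i ≡ y

    hits? : ∀ {k} (g : Fin k → Bool) (t : Fin k → Fin n) y → Dec (Hits g t y)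
    hits? g t y = any? λ i → T? (g i) ×-dec (t i ≟ᶠ y)

    -- As `t` is injective, hits correspond to the indices chosen by `g`. Choosing all darts gives
    -- the degree, choosing the inward ones the in-degree.
    count-hits : ∀ {k} (g : Fin k → Bool) (t : Fin k → Fin n) → (∀ {i j} → t i ≡ t j → i ≡ j) →
      ∣ tabulate (λ y → does (hits? g t y)) ∣ ≡ ∣ tabulate g ∣
    count-hits {zero}  g t inj = count-false (λ y → does (hits? g t y)) (λ y → dec-false (hits? g t y) (λ ()))
    count-hits {suc k} g t inj = trans (sym (count-+ first rest both split))
      (trans (cong₂ _+_ (count-first (g zero) refl) (count-hits (g ∘ suc) (t ∘ suc) (sucᶠ-injective ∘ inj)))
             (sym (count-∷ (g zero) (tabulate (g ∘ suc)))))
      where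
      first rest both : Fin n → Bool
      first y = does (T? (g zero) ×-dec (t zero ≟ᶠ y))
      rest  y = does (hits? (g ∘ suc) (t ∘ suc) y)
      both  y = does (hits? g t y)

      split : ∀ y → toNat (first y) + toNat (rest y) ≡ toNat (both y)
      split y = disjoint (first y) (rest y) λ p q →
        let _ , e       = does-true (T? (g zero) ×-dec (t zero ≟ᶠ y)) p
            i , _ , e′  = does-true (hits? (g ∘ suc) (t ∘ suc) y) q
        in contradiction (inj (trans e (sym e′))) λ ()
        where
        disjoint : ∀ a b → (a ≡ true → b ≡ true → ⊥) → toNat a + toNat b ≡ toNat (a ∨ b)
        disjoint false b     h = refl
        disjoint true  false h = refl
        disjoint true  true  h = ⊥-elim (h refl refl)

      count-first : ∀ b → g zero ≡ b → ∣ tabulate first ∣ ≡ toNat b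
      count-first false eq = count-false first λ y → dec-false (T? (g zero) ×-dec (t zero ≟ᶠ y)) λ (p , _) → subst T eq p
      count-first true  eq = trans (count-cong {f = first} {λ y → does (t zero ≟ᶠ y)} λ y →
        does-⇔ (mk⇔ proj₂ (λ e → subst T (sym eq) _ , e)) (T? (g zero) ×-dec (t zero ≟ᶠ y)) (t zero ≟ᶠ y)) (count-single (t zero))

  -- A 4-regular graph given by its darts: dart i of u leads to nb u i, where
  -- it is dart back u i.
  record Darts (V : Set) : Set where
    field
      nb             : V → Fin 4 → V
      back           : V → Fin 4 → Fin 4
      nb-back        : ∀ u i → nb (nb u i) (back u i) ≡ u
      back-back      : ∀ u i → back (nb u i) (back u i) ≡ i
      nb-injective   : ∀ u {i j} → nb u i ≡ nb u j → i ≡ j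
      nb-irreflexive : ∀ u i → nb u i ≢ u

  record Numbering (V : Set) (n : ℕ) : Set where
    field
      enc     : V → Fin n
      dec     : Fin n → V
      dec-enc : ∀ u → dec (enc u) ≡ u
      enc-dec : ∀ x → enc (dec x) ≡ x

    enc-injective : ∀ {u v} → enc u ≡ enc v → u ≡ v
    enc-injective eq = trans (sym (dec-enc _)) (trans (cong dec eq) (dec-enc _))

  module DartGraph {V : Set} {n : ℕ} (numbering : Numbering V n) (darts : Darts V) where

    open Numbering numbering
    open Darts darts

    everywhere : Fin 4 → Bool
    everywhere _ = true

    to : Fin n → Fin 4 → Fin n
    to x i = enc (nb (dec x) i)

    to-injective : ∀ x {i j} → to x i ≡ to x j → i ≡ j
    to-injective x = nb-injective (dec x) ∘ enc-injective

    reverse : ∀ {x y i} → to x i ≡ y → to y (back (dec x) i) ≡ x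
    reverse {x} {i = i} refl = trans (cong (λ u → enc (nb u (back (dec x) i))) (dec-enc _))
                                     (trans (cong enc (nb-back (dec x) i)) (enc-dec x))

    hits-reverse : ∀ {x y} → Hits everywhere (to x) y → Hits everywhere (to y) x
    hits-reverse {x} (i , _ , e) = back (dec x) i , _ , reverse e

    abstract

      graph : Graph n
      graph = record
        { adj         = λ x y → does (hits? everywhere (to x) y)
        ; symmetric   = λ x y → does-⇔ (mk⇔ hits-reverse hits-reverse) (hits? everywhere (to x) y) (hits? everywhere (to y) x)
        ; irreflexive = λ x → dec-false (hits? everywhere (to x) x)
            λ (i , _ , e) → nb-irreflexive (dec x) i (enc-injective (trans e (sym (enc-dec x)))) }

      adj-does : ∀ x y → Graph.adj graph x y ≡ does (hits? everywhere (to x) y)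
      adj-does x y = refl

      regular : Regular 4 graph
      regular x = count-hits everywhere (to x) (to-injective x)

    open Graph graph

    adj-hits : ∀ {x y} → adj x y ≡ true → Hits everywhere (to x) y
    adj-hits {x} {y} e = does-true (hits? everywhere (to x) y) (trans (sym (adj-does x y)) e)

    hits-adj : ∀ {x y} → Hits everywhere (to x) y → adj x y ≡ true
    hits-adj {x} {y} h = trans (adj-does x y) (dec-true (hits? everywhere (to x) y) h)

    adj-nb : ∀ u i → adj (enc u) (enc (nb u i)) ≡ true
    adj-nb u i = hits-adj (i , _ , cong (λ u → enc (nb u i)) (dec-enc u))

    adj⇔ : ∀ u v → adj (enc u) (enc v) ≡ true ⇔ (∃[ i ] nb u i ≡ v)
    adj⇔ u v = mk⇔
      (λ e → let i , _ , q = adj-hits e in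
         i , enc-injective (trans (cong (λ u → enc (nb u i)) (sym (dec-enc u))) q))
      λ { (i , refl) → adj-nb u i }

    record Directed : Set where
      field
        out      : V → Fin 4 → Bool
        out-back : ∀ u i → out (nb u i) (back u i) ≡ not (out u i)

      inward : V → Fin 4 → Bool
      inward u i = not (out u i)

      -- The same arc seen from its head: by `out-back` an outward dart of `x` is an inward dart of
      -- `y`. This lets the in-degree be counted at the head.
      leaves⇔enters : ∀ x y → Hits (out (dec x)) (to x) y ⇔ Hits (inward (dec y)) (to y) x
      leaves⇔enters x y = mk⇔ f g
        where
        f : Hits (out (dec x)) (to x) y → Hits (inward (dec y)) (to y) x
        f (i , p , refl) = back (dec x) i ,
          subst T (sym (trans (cong (λ u → not (out u (back (dec x) i))) (dec-enc _))
                              (trans (cong not (out-back (dec x) i)) (not-involutive _)))) p ,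
          reverse {x} refl
        g : Hits (inward (dec y)) (to y) x → Hits (out (dec x)) (to x) y
        g (i , p , refl) = back (dec y) i ,
          subst T (sym (trans (cong (λ u → out u (back (dec y) i)) (dec-enc _)) (out-back (dec y) i))) p ,
          reverse {y} refl

      orientation : Orientation graph
      orientation = record
        { arc        = λ x y → does (hits? (out (dec x)) (to x) y)
        ; arc⇒edge   = λ x y e → let i , _ , q = does-true (hits? (out (dec x)) (to x) y) e in
                         hits-adj (i , _ , q)
        ; exactlyOne = λ x y e → one x y (adj-hits e) }
        where
        one : ∀ x y → Hits everywhere (to x) y → does (hits? (out (dec x)) (to x) y) xor does (hits? (out (dec y)) (to y) x) ≡ true
        one x y (i , _ , e) with out (dec x) i in eq
        ... | true = cong₂ _xor_ (dec-true (hits? (out (dec x)) (to x) y) (i , subst T (sym eq) _ , e))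
          (dec-false (hits? (out (dec y)) (to y) x) λ h →
            let j , p , e′ = Equivalence.to (leaves⇔enters y x) h in
            subst T (trans (cong (inward (dec x)) (to-injective x (trans e′ (sym e)))) (cong not eq)) p)
        ... | false = cong₂ _xor_
          (dec-false (hits? (out (dec x)) (to x) y) λ (j , p , e′) →
            subst T (trans (cong (out (dec x)) (to-injective x (trans e′ (sym e)))) eq) p)
          (dec-true (hits? (out (dec y)) (to y) x)
            (Equivalence.from (leaves⇔enters y x) (i , subst T (sym (cong not eq)) _ , e)))

      inDegree≡ : ∀ x → Orientation.inDegree orientation x ≡ ∣ tabulate (inward (dec x)) ∣
      inDegree≡ x = trans
        (count-cong λ y → does-⇔ (leaves⇔enters y x) (hits? (out (dec y)) (to y) x) (hits? (inward (dec x)) (to x) y))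
        (count-hits (inward (dec x)) (to x) (to-injective x))

      balanced : (c : V → ℕ) → (∀ u → ∣ tabulate (inward u) ∣ ≡ c u) → (∀ u → 0 < c u × c u < 4) →
        (∀ u i → c u ≢ c (nb u i)) → Balanced orientation
      balanced c count range proper =
        (λ x → subst (λ k → 0 < k × k < 4) (sym (degree≡ x)) (range (dec x))) ,
        λ x y e eq → let i , _ , q = adj-hits e in
          proper (dec x) i (trans (trans (sym (degree≡ x)) (trans eq (degree≡ y)))
            (cong c (trans (cong dec (sym q)) (dec-enc _))))
        where
        degree≡ : ∀ x → Orientation.inDegree orientation x ≡ c (dec x)
        degree≡ x = trans (inDegree≡ x) (count (dec x))

    balanced-proper : (D : Orientation graph) → Balanced D → ∀ u i →
      Orientation.inDegree D (enc u) ≢ Orientation.inDegree D (enc (nb u i))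
    balanced-proper D (_ , distinct) u i = distinct _ _ (adj-nb u i)

-- The cell of 21 nodes and its tables, checked by enumeration.

module Cells where

  open Machines using (clamp)
  open import Data.Product.Properties using (≡-dec)

  data Direction : Set where
    same next prev cross : Direction

  _≟ᵈ_ : DecidableEquality Direction
  same  ≟ᵈ same  = yes refl
  next  ≟ᵈ next  = yes refl
  prev  ≟ᵈ prev  = yes refl
  cross ≟ᵈ cross = yes refl
  same  ≟ᵈ next  = no λ ()
  same  ≟ᵈ prev  = no λ ()
  same  ≟ᵈ cross = no λ ()
  next  ≟ᵈ same  = no λ ()
  next  ≟ᵈ prev  = no λ ()
  next  ≟ᵈ cross = no λ ()
  prev  ≟ᵈ same  = no λ ()
  prev  ≟ᵈ next  = no λ ()
  prev  ≟ᵈ cross = no λ ()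
  cross ≟ᵈ same  = no λ ()
  cross ≟ᵈ next  = no λ ()
  cross ≟ᵈ prev  = no λ ()

  opposite : Direction → Direction
  opposite same  = same
  opposite next  = prev
  opposite prev  = next
  opposite cross = cross

  Node : Set
  Node = Fin 21

  -- The cell of an ordered pair of vertices u, v of the 3-colouring
  -- instance, where h says whether they are adjacent.  The nodes are
  -- z₀ p₀ q₀ … z₃ p₃ q₃ r₀ r₁ x a₁ a₂ a₃ b₁ b₂ b₃: a chain of diamonds
  -- z p q z, so that all z and r have the same colour; r₀ and r₁ are joined
  -- to r₀ and r₁ of the cell of v, u if h, and subdivide the edges a₁b₁
  -- and a₂b₂ otherwise; x, a, b serve to balance the colours.
  -- Entry i of row k is the target of dart i of node k.
  cell : Bool → Vec (Vec (Direction × ℕ × ℕ) 4) 21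
  cell h =
    ((same , 1 , 0) ∷ (same , 2 , 0) ∷ (prev , 10 , 3) ∷ (prev , 11 , 3) ∷ []) ∷
    ((same , 0 , 0) ∷ (same , 2 , 1) ∷ (same , 3 , 0) ∷ (same , 20 , 0) ∷ []) ∷
    ((same , 0 , 1) ∷ (same , 1 , 1) ∷ (same , 3 , 1) ∷ (same , 17 , 0) ∷ []) ∷
    ((same , 1 , 2) ∷ (same , 2 , 2) ∷ (same , 4 , 0) ∷ (same , 5 , 0) ∷ []) ∷
    ((same , 3 , 2) ∷ (same , 5 , 1) ∷ (same , 6 , 0) ∷ (same , 12 , 0) ∷ []) ∷
    ((same , 3 , 3) ∷ (same , 4 , 1) ∷ (same , 6 , 1) ∷ (same , 12 , 1) ∷ []) ∷
    ((same , 4 , 2) ∷ (same , 5 , 2) ∷ (same , 7 , 0) ∷ (same , 8 , 0) ∷ []) ∷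
    ((same , 6 , 2) ∷ (same , 8 , 1) ∷ (same , 9 , 0) ∷ (same , 20 , 1) ∷ []) ∷
    ((same , 6 , 3) ∷ (same , 7 , 1) ∷ (same , 9 , 1) ∷ (same , 17 , 1) ∷ []) ∷
    ((same , 7 , 2) ∷ (same , 8 , 2) ∷ (same , 10 , 0) ∷ (same , 11 , 0) ∷ []) ∷
    ((same , 9 , 2) ∷ (same , 11 , 1) ∷ (same , 13 , 0) ∷ (next , 0 , 2) ∷ []) ∷
    ((same , 9 , 3) ∷ (same , 10 , 1) ∷ (same , 13 , 1) ∷ (next , 0 , 3) ∷ []) ∷
    ((same , 4 , 3) ∷ (same , 5 , 3) ∷ (if h then (cross , 12 , 2) else (same , 15 , 0)) ∷
                                       (if h then (cross , 13 , 2) else (same , 18 , 0)) ∷ []) ∷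
    ((same , 10 , 2) ∷ (same , 11 , 2) ∷ (if h then (cross , 12 , 3) else (same , 16 , 1)) ∷
                                         (if h then (cross , 13 , 3) else (same , 19 , 1)) ∷ []) ∷
    ((same , 15 , 3) ∷ (same , 16 , 3) ∷ (same , 18 , 3) ∷ (same , 19 , 3) ∷ []) ∷
    ((same , (if h then 18 else 12) , (if h then 0 else 2)) ∷ (same , 19 , 0) ∷ (same , 20 , 2) ∷ (same , 14 , 0) ∷ []) ∷
    ((same , 18 , 1) ∷ (same , (if h then 19 else 13) , (if h then 1 else 2)) ∷ (same , 20 , 3) ∷ (same , 14 , 1) ∷ []) ∷
    ((same , 2 , 3) ∷ (same , 8 , 3) ∷ (same , 18 , 2) ∷ (same , 19 , 2) ∷ []) ∷
    ((same , (if h then 15 else 12) , (if h then 0 else 3)) ∷ (same , 16 , 0) ∷ (same , 17 , 2) ∷ (same , 14 , 2) ∷ []) ∷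
    ((same , 15 , 1) ∷ (same , (if h then 16 else 13) , (if h then 1 else 3)) ∷ (same , 17 , 3) ∷ (same , 14 , 3) ∷ []) ∷
    ((same , 1 , 3) ∷ (same , 7 , 3) ∷ (same , 15 , 2) ∷ (same , 16 , 2) ∷ []) ∷ []

  direction : Bool → Node → Fin 4 → Direction
  direction h k i = proj₁ (lookup (lookup (cell h) k) i)

  target : Bool → Node → Fin 4 → Node
  target h k i = clamp 20 (proj₁ (proj₂ (lookup (lookup (cell h) k) i)))

  return : Bool → Node → Fin 4 → Fin 4
  return h k i = clamp 3 (proj₂ (proj₂ (lookup (lookup (cell h) k) i)))

  -- In a row, the colour of each node if z has colour c.
  colours : Fin 3 → Vec ℕ 21
  colours zero             = 0 ∷ 1 ∷ 2 ∷ 0 ∷ 1 ∷ 2 ∷ 0 ∷ 1 ∷ 2 ∷ 0 ∷ 1 ∷ 2 ∷ 0 ∷ 0 ∷ 0 ∷ 1 ∷ 1 ∷ 1 ∷ 2 ∷ 2 ∷ 2 ∷ []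
  colours (suc zero)       = 1 ∷ 0 ∷ 2 ∷ 1 ∷ 0 ∷ 2 ∷ 1 ∷ 0 ∷ 2 ∷ 1 ∷ 0 ∷ 2 ∷ 1 ∷ 1 ∷ 1 ∷ 0 ∷ 0 ∷ 0 ∷ 2 ∷ 2 ∷ 2 ∷ []
  colours (suc (suc zero)) = 2 ∷ 0 ∷ 1 ∷ 2 ∷ 0 ∷ 1 ∷ 2 ∷ 0 ∷ 1 ∷ 2 ∷ 0 ∷ 1 ∷ 2 ∷ 2 ∷ 2 ∷ 0 ∷ 0 ∷ 0 ∷ 1 ∷ 1 ∷ 1 ∷ []

  colour : Fin 3 → Node → Fin 3
  colour c k = clamp 2 (lookup (colours c) k)

  -- The binary digits of an entry tell which darts of the node go out.
  -- Darts 2 and 3 of r₀ and r₁ are treated separately.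
  leaving : Fin 3 → Vec ℕ 21
  leaving zero             = 7 ∷ 10 ∷ 8 ∷ 11 ∷ 3 ∷ 4 ∷ 13 ∷ 10 ∷ 8 ∷ 11 ∷ 3 ∷ 8 ∷ 3 ∷ 3 ∷ 14 ∷ 10 ∷ 5 ∷ 12 ∷ 1 ∷ 2 ∷ 4 ∷ []
  leaving (suc zero)       = 6 ∷ 7 ∷ 4 ∷ 12 ∷ 14 ∷ 4 ∷ 12 ∷ 14 ∷ 8 ∷ 10 ∷ 7 ∷ 8 ∷ 2 ∷ 2 ∷ 12 ∷ 14 ∷ 13 ∷ 13 ∷ 1 ∷ 2 ∷ 1 ∷ []
  leaving (suc (suc zero)) = 4 ∷ 7 ∷ 5 ∷ 8 ∷ 11 ∷ 12 ∷ 1 ∷ 7 ∷ 5 ∷ 8 ∷ 7 ∷ 12 ∷ 0 ∷ 0 ∷ 8 ∷ 14 ∷ 13 ∷ 7 ∷ 9 ∷ 6 ∷ 3 ∷ []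

  digit : ℕ → Fin 4 → Bool
  digit n zero                = does (n % 2 ≟ 1)
  digit n (suc zero)          = does (n / 2 % 2 ≟ 1)
  digit n (suc (suc zero))    = does (n / 4 % 2 ≟ 1)
  digit n (suc (suc (suc _))) = does (n / 8 % 2 ≟ 1)

  -- s breaks the symmetry between two adjacent cells.
  outgoing : Fin 3 → Bool → Bool → Node → Fin 4 → Bool
  outgoing c h s k i with toℕ k | toℕ i
  ... | 12 | 2 = if h then s else true
  ... | 12 | 3 = if h then not s else false
  ... | 13 | 2 = if h then not s else true
  ... | 13 | 3 = if h then s else false
  ... | _  | _ = digit (lookup (leaving c) k) i

  all-Bool? : {P : Bool → Set} → (∀ b → Dec (P b)) → Dec (∀ b → P b)
  all-Bool? {P} P? = map′ (λ { (p , q) false → p ; (p , q) true → q }) (λ h → h false , h true) (P? false ×-dec P? true)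

  -- What holds of the cell at the far end of a dart, from what holds here
  -- and there.
  far : Direction → Bool → Bool → Bool
  far same  b b′ = b
  far next  b b′ = b′
  far prev  b b′ = b′
  far cross b b′ = b

  _≟ᵗ_ : DecidableEquality (Direction × Node × Fin 4)
  _≟ᵗ_ = ≡-dec _≟ᵈ_ (≡-dec _≟ᶠ_ _≟ᶠ_)

  -- The cell at the far end may be of the other kind, so both kinds are tried there; `far`
  -- identifies them inside a cell, and for crossing darts, where adjacency is symmetric.
  return-correct : ∀ h h′ k i → let d = direction h k i ; k′ = target h k i ; i′ = return h k i ; h″ = far d h h′ in
    (direction h″ k′ i′ , target h″ k′ i′ , return h″ k′ i′) ≡ (opposite d , k , i)
  return-correct = toWitness {a? = all-Bool? λ h → all-Bool? λ h′ → all? λ k → all? λ i → _ ≟ᵗ _} tt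

  cross⇒edge : ∀ h k i → direction h k i ≡ cross → h ≡ true
  cross⇒edge = toWitness {a? = all-Bool? λ h → all? λ k → all? λ i → (_ ≟ᵈ _) →-dec (_ ≟ᵇ _)} tt

  target-injective : ∀ h k i j → target h k i ≡ target h k j → i ≡ j
  target-injective = toWitness {a? = all-Bool? λ h → all? λ k → all? λ i → all? λ j → (_ ≟ᶠ _) →-dec (_ ≟ᶠ _)} tt

  target-irreflexive : ∀ h k i → target h k i ≡ k → direction h k i ≡ cross
  target-irreflexive = toWitness {a? = all-Bool? λ h → all? λ k → all? λ i → (_ ≟ᶠ _) →-dec (_ ≟ᵈ _)} tt

  -- Darts that do not cross stay in the row of `u`, whose cells share the colour `c`; so the table
  -- of a colour has to fit only itself.
  outgoing-near : ∀ c h h′ s s′ k i → let d = direction h k i in d ≢ cross →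
    outgoing c (far d h h′) (far d s s′) (target h k i) (return h k i) ≡ not (outgoing c h s k i)
  outgoing-near = toWitness {a? = all? λ c → all-Bool? λ h → all-Bool? λ h′ → all-Bool? λ s → all-Bool? λ s′ → all? λ k → all? λ i →
    ¬? (_ ≟ᵈ _) →-dec (_ ≟ᵇ _)} tt

  -- The edges between `r₀`, `r₁` here and there form a 4-cycle, oriented cyclically in the sense
  -- given by `s`. The colours `c` and `c′` do not affect its orientation.
  outgoing-cross : ∀ c c′ s k i → direction true k i ≡ cross →
    outgoing c′ true (not s) (target true k i) (return true k i) ≡ not (outgoing c true s k i)
  outgoing-cross = toWitness {a? = all? λ c → all? λ c′ → all-Bool? λ s → all? λ k → all? λ i → (_ ≟ᵈ _) →-dec (_ ≟ᵇ _)} tt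

  -- In-degrees are colours counted from 1. Such a table is possible because each colour has seven
  -- of the nodes, so that the in-degrees average 2.
  incoming-count : ∀ c h s k → ∣ tabulate (λ i → not (outgoing c h s k i)) ∣ ≡ suc (toℕ (colour c k))
  incoming-count = toWitness {a? = all? λ c → all-Bool? λ h → all-Bool? λ s → all? λ k → _ ≟ _} tt

  colour-near : ∀ c h k i → direction h k i ≢ cross → colour c k ≢ colour c (target h k i)
  colour-near = toWitness {a? = all? λ c → all-Bool? λ h → all? λ k → all? λ i → ¬? (_ ≟ᵈ _) →-dec ¬? (_ ≟ᶠ _)} tt

  colour-cross : ∀ c h k i → direction h k i ≡ cross → colour c k ≡ c × colour c (target h k i) ≡ c
  colour-cross = toWitness {a? = all? λ c → all-Bool? λ h → all? λ k → all? λ i → (_ ≟ᵈ _) →-dec ((_ ≟ᶠ _) ×-dec (_ ≟ᶠ _))} tt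

  -- Between them, `p` and `q` leave just one of three colours.
  diamond : ∀ (z p q z′ : Fin 3) → z ≢ p → z ≢ q → p ≢ q → z′ ≢ p → z′ ≢ q → z ≡ z′
  diamond = toWitness {a? = all? λ z → all? λ p → all? λ q → all? λ z′ →
    ¬? (_ ≟ᶠ _) →-dec (¬? (_ ≟ᶠ _) →-dec (¬? (_ ≟ᶠ _) →-dec (¬? (_ ≟ᶠ _) →-dec (¬? (_ ≟ᶠ _) →-dec (_ ≟ᶠ _)))))} tt

-- From 3-colourings to balanced orientations and back.

module Colourings where

  open Orientations
  open DartGraphs
  open Cells

  succ pred : ∀ {n} → Fin (suc n) → Fin (suc n)
  succ i with view i
  ... | ‵fromℕ     = zero
  ... | ‵inject₁ j = suc j
  pred zero    = fromℕ _
  pred (suc i) = inject₁ i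

  succ-pred : ∀ {n} (i : Fin (suc n)) → succ (pred i) ≡ i
  succ-pred {n} zero    rewrite view-fromℕ n = refl
  succ-pred (suc i) rewrite view-inject₁ i = refl

  pred-succ : ∀ {n} (i : Fin (suc n)) → pred (succ i) ≡ i
  pred-succ i with view i
  ... | ‵fromℕ     = refl
  ... | ‵inject₁ j = refl

  Colouring : ∀ {m} → (Fin m → Fin m → Bool) → Set
  Colouring {m} h = Σ[ col ∈ (Fin m → Fin 3) ] (∀ u v → h u v ≡ true → col u ≢ col v)

  module Gadget (m′ : ℕ) (h : Fin (suc m′) → Fin (suc m′) → Bool)
    (h-symmetric : ∀ u v → h u v ≡ h v u) (h-irreflexive : ∀ u → h u u ≡ false) where

    m : ℕ
    m = suc m′

    Vertex : Set
    Vertex = Fin m × Fin m × Node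

    goto : Direction → Fin m × Fin m → Fin m × Fin m
    goto same  uv      = uv
    goto next  (u , v) = u , succ v
    goto prev  (u , v) = u , pred v
    goto cross (u , v) = v , u

    goto-opposite : ∀ d uv → goto (opposite d) (goto d uv) ≡ uv
    goto-opposite same  uv      = refl
    goto-opposite next  (u , v) = cong (u ,_) (pred-succ v)
    goto-opposite prev  (u , v) = cong (u ,_) (succ-pred v)
    goto-opposite cross uv      = refl

    edge : Fin m × Fin m → Bool
    edge (u , v) = h u v

    edge-far : ∀ d uv → edge (goto d uv) ≡ far d (edge uv) (edge (goto d uv))
    edge-far same  uv      = refl
    edge-far next  uv      = refl
    edge-far prev  uv      = refl
    edge-far cross (u , v) = h-symmetric v u

    neighbour : Vertex → Fin 4 → Vertex
    neighbour (u , v , k) i = let u′ , v′ = goto (direction (h u v) k i) (u , v) in u′ , v′ , target (h u v) k i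

    back : Vertex → Fin 4 → Fin 4
    back (u , v , k) i = return (h u v) k i

    returning : ∀ u v k i → let d = direction (h u v) k i ; u′ , v′ = goto d (u , v) ; k′ = target (h u v) k i ; i′ = return (h u v) k i in
      (direction (h u′ v′) k′ i′ , target (h u′ v′) k′ i′ , return (h u′ v′) k′ i′) ≡ (opposite d , k , i)
    returning u v k i = subst
      (λ b → (direction b (target (h u v) k i) (return (h u v) k i) , target b (target (h u v) k i) (return (h u v) k i) , return b (target (h u v) k i) (return (h u v) k i))
             ≡ (opposite (direction (h u v) k i) , k , i))
      (sym (edge-far (direction (h u v) k i) (u , v)))
      (return-correct (h u v) (edge (goto (direction (h u v) k i) (u , v))) k i)

    darts : Darts Vertex
    darts = record
      { nb             = neighbour
      ; back           = back
      ; nb-back        = nb-back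
      ; back-back      = λ (u , v , k) i → ,-injectiveʳ (,-injectiveʳ (returning u v k i))
      ; nb-injective   = λ (u , v , k) {i} {j} e → target-injective (h u v) k i j (,-injectiveʳ (,-injectiveʳ e))
      ; nb-irreflexive = nb-irreflexive }
      where
      nb-back : ∀ x i → neighbour (neighbour x i) (back x i) ≡ x
      nb-back (u , v , k) i = cong₂ (λ (u , v) k → u , v , k)
        (trans (cong (λ d → goto d (goto (direction (h u v) k i) (u , v))) (,-injectiveˡ (returning u v k i)))
               (goto-opposite (direction (h u v) k i) (u , v)))
        (,-injectiveˡ (,-injectiveʳ (returning u v k i)))

      crossing : ∀ d u v → d ≡ cross → h u v ≡ true → goto d (u , v) ≢ (u , v)
      crossing cross u v refl e eq with refl ← ,-injectiveˡ eq = contradiction (trans (sym e) (h-irreflexive u)) λ ()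

      -- Only a crossing dart can keep the node number; then `u` and `v` are adjacent, hence
      -- different, and swapping them changes the cell.
      nb-irreflexive : ∀ x i → neighbour x i ≢ x
      nb-irreflexive (u , v , k) i e = crossing (direction (h u v) k i) u v c (cross⇒edge (h u v) k i c)
        (cong₂ _,_ (,-injectiveˡ e) (,-injectiveˡ (,-injectiveʳ e)))
        where c = target-irreflexive (h u v) k i (,-injectiveʳ (,-injectiveʳ e))

    numbering : Numbering Vertex (m * (m * 21))
    numbering = record
      { enc     = λ (u , v , k) → combine u (combine v k)
      ; dec     = λ x → let u , y = remQuot (m * 21) x in u , remQuot 21 y
      ; dec-enc = λ (u , v , k) → trans
          (cong (λ (u , y) → u , remQuot 21 y) (remQuot-combine u (combine v k)))
          (cong (u ,_) (remQuot-combine v k))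
      ; enc-dec = λ x → trans
          (cong (combine (proj₁ (remQuot {m} (m * 21) x))) (combine-remQuot {m} 21 (proj₂ (remQuot {m} (m * 21) x))))
          (combine-remQuot {m} (m * 21) x) }

    open Numbering numbering public
    open DartGraph numbering darts public

    adjacency⇔ : ∀ a b → Graph.adj graph (enc a) (enc b) ≡ true ⇔ (∃[ i ] neighbour a i ≡ b)
    adjacency⇔ = adj⇔

    module _ (colouring : Colouring h) where

      col = proj₁ colouring

      -- For adjacent u and v, exactly one of this and its mirror image.
      smaller : Fin m → Fin m → Bool
      smaller u v = does (col u <ᶠ? col v)

      smaller-not : ∀ u v → h u v ≡ true → smaller v u ≡ not (smaller u v)
      smaller-not u v e with <-cmpᶠ (col u) (col v)
      ... | tri< lt _ ¬gt = trans (dec-false (col v <ᶠ? col u) ¬gt) (cong not (sym (dec-true (col u <ᶠ? col v) lt)))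
      ... | tri≈ _ eq _   = contradiction eq (proj₂ colouring u v e)
      ... | tri> ¬lt _ gt = trans (dec-true (col v <ᶠ? col u) gt) (cong not (sym (dec-false (col u <ᶠ? col v) ¬lt)))

      out : Vertex → Fin 4 → Bool
      out (u , v , k) = outgoing (col u) (h u v) (smaller u v) k

      directed : Directed
      directed = record { out = out ; out-back = out-back }
        where
        near : ∀ d u v k i → d ≢ cross → let u′ , v′ = goto d (u , v) in
          out (u′ , v′ , k) i ≡ outgoing (col u) (far d (h u v) (h u′ v′)) (far d (smaller u v) (smaller u′ v′)) k i
        near same  u v k i ne = refl
        near next  u v k i ne = refl
        near prev  u v k i ne = refl
        near cross u v k i ne = contradiction refl ne

        crossing : ∀ d u v k i → d ≡ cross → h u v ≡ true → let u′ , v′ = goto d (u , v) in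
          out (u′ , v′ , k) i ≡ outgoing (col v) true (not (smaller u v)) k i
        crossing cross u v k i refl e =
          cong₂ (λ b s → outgoing (col v) b s k i) (trans (h-symmetric v u) e) (smaller-not u v e)

        outgoing-cross′ : ∀ c c′ s b k i → b ≡ true → direction b k i ≡ cross →
          outgoing c′ true (not s) (target b k i) (return b k i) ≡ not (outgoing c b s k i)
        outgoing-cross′ c c′ s .true k i refl = outgoing-cross c c′ s k i

        out-back : ∀ x i → out (neighbour x i) (back x i) ≡ not (out x i)
        out-back (u , v , k) i with direction (h u v) k i ≟ᵈ cross
        ... | no ne  = trans (near d u v (target (h u v) k i) (return (h u v) k i) ne)
          (outgoing-near (col u) (h u v) (edge (goto d (u , v))) (smaller u v)
            (smaller (proj₁ (goto d (u , v))) (proj₂ (goto d (u , v)))) k i ne)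
          where d = direction (h u v) k i
        ... | yes eq = trans (crossing (direction (h u v) k i) u v (target (h u v) k i) (return (h u v) k i) eq e) (outgoing-cross′ (col u) (col v) (smaller u v) (h u v) k i e eq)
          where e = cross⇒edge (h u v) k i eq

      nodeColour : Vertex → Fin 3
      nodeColour (u , v , k) = colour (col u) k

      nodeColour-proper : ∀ x i → nodeColour x ≢ nodeColour (neighbour x i)
      nodeColour-proper (u , v , k) i = go (direction (h u v) k i) refl
        where
        go : ∀ d → direction (h u v) k i ≡ d → colour (col u) k ≢ colour (col (proj₁ (goto d (u , v)))) (target (h u v) k i)
        go same  eq = colour-near (col u) (h u v) k i (λ e → contradiction (trans (sym eq) e) λ ())
        go next  eq = colour-near (col u) (h u v) k i (λ e → contradiction (trans (sym eq) e) λ ())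
        go prev  eq = colour-near (col u) (h u v) k i (λ e → contradiction (trans (sym eq) e) λ ())
        go cross eq e = proj₂ colouring u v (cross⇒edge (h u v) k i eq)
          (trans (sym (proj₁ (colour-cross (col u) (h u v) k i eq)))
          (trans e (proj₂ (colour-cross (col v) (h u v) k i eq))))

      colouring⇒balanced : Σ[ D ∈ Orientation graph ] Balanced D
      colouring⇒balanced = Directed.orientation directed ,
        Directed.balanced directed (λ x → suc (toℕ (nodeColour x)))
          (λ (u , v , k) → incoming-count (col u) (h u v) (smaller u v) k)
          (λ x → s≤s z≤n , s≤s (toℕ<n (nodeColour x)))
          (λ x i e → nodeColour-proper x i (toℕ-injective (suc-injective e)))

    balanced⇒colouring : (Σ[ D ∈ Orientation graph ] Balanced D) → Colouring h
    -- The colour of `u` is read at `z₀` of the cell `u , zero`. Adjacent vertices differ because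
    -- dart 2 joins `r₀` of the cell `u , v` to `r₀` of the cell `v , u`.
    balanced⇒colouring (D , B@(range , _)) = (λ u → shade (u , zero , # 0)) , λ u v e eq →
      proper (u , v , # 12) (# 2)
        (trans (r-shade u v) (trans eq (trans (sym (r-shade v u)) (cong shade (sym (r-neighbour u v e))))))
      where
      open Orientation D

      pred₃ : ∀ n → 0 < n → n < 4 → Fin 3
      pred₃ (suc n) p (s≤s q) = fromℕ< q

      toℕ-pred₃ : ∀ n (p : 0 < n) (q : n < 4) → suc (toℕ (pred₃ n p q)) ≡ n
      toℕ-pred₃ (suc n) p (s≤s q) = cong suc (toℕ-fromℕ< q)

      shade : Vertex → Fin 3
      shade x = pred₃ (inDegree (enc x)) (proj₁ (range (enc x))) (proj₂ (range (enc x)))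

      proper : ∀ x i → shade x ≢ shade (neighbour x i)
      proper x i e = balanced-proper D B x i
        (trans (sym (toℕ-pred₃ _ _ _)) (trans (cong (suc ∘ toℕ) e) (toℕ-pred₃ _ _ _)))

      z₀≡z₁ : ∀ u v → shade (u , v , # 0) ≡ shade (u , v , # 3)
      z₀≡z₁ u v = diamond _ _ _ _ (proper (u , v , # 0) (# 0)) (proper (u , v , # 0) (# 1)) (proper (u , v , # 1) (# 1))
                                  (proper (u , v , # 3) (# 0)) (proper (u , v , # 3) (# 1))

      z₁≡z₂ : ∀ u v → shade (u , v , # 3) ≡ shade (u , v , # 6)
      z₁≡z₂ u v = diamond _ _ _ _ (proper (u , v , # 3) (# 2)) (proper (u , v , # 3) (# 3)) (proper (u , v , # 4) (# 1))
                                  (proper (u , v , # 6) (# 0)) (proper (u , v , # 6) (# 1))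

      z₂≡z₃ : ∀ u v → shade (u , v , # 6) ≡ shade (u , v , # 9)
      z₂≡z₃ u v = diamond _ _ _ _ (proper (u , v , # 6) (# 2)) (proper (u , v , # 6) (# 3)) (proper (u , v , # 7) (# 1))
                                  (proper (u , v , # 9) (# 0)) (proper (u , v , # 9) (# 1))

      z₃≡z₀ : ∀ u v → shade (u , pred v , # 9) ≡ shade (u , v , # 0)
      z₃≡z₀ u v = diamond _ _ _ _ (proper (u , pred v , # 9) (# 2)) (proper (u , pred v , # 9) (# 3)) (proper (u , pred v , # 10) (# 1))
                                  (proper (u , v , # 0) (# 2)) (proper (u , v , # 0) (# 3))

      z₁≡r₀ : ∀ u v → shade (u , v , # 3) ≡ shade (u , v , # 12)
      z₁≡r₀ u v = diamond _ _ _ _ (proper (u , v , # 3) (# 2)) (proper (u , v , # 3) (# 3)) (proper (u , v , # 4) (# 1))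
                                  (proper (u , v , # 12) (# 0)) (proper (u , v , # 12) (# 1))

      -- Each cell hands the colour on through four diamonds, the last of which ends at `z₀` of the
      -- next cell.
      z-shade : ∀ u v → shade (u , v , # 0) ≡ shade (u , zero , # 0)
      z-shade u = <-weakInduction (λ v → shade (u , v , # 0) ≡ shade (u , zero , # 0)) refl λ i ih →
        trans (sym (z₃≡z₀ u (suc i))) (trans (sym (z₂≡z₃ u (inject₁ i)))
          (trans (sym (z₁≡z₂ u (inject₁ i))) (trans (sym (z₀≡z₁ u (inject₁ i))) ih)))

      r-shade : ∀ u v → shade (u , v , # 12) ≡ shade (u , zero , # 0)
      r-shade u v = trans (sym (z₁≡r₀ u v)) (trans (sym (z₀≡z₁ u v)) (z-shade u v))

      r-neighbour : ∀ u v → h u v ≡ true → neighbour (u , v , # 12) (# 2) ≡ (v , u , # 12)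
      r-neighbour u v = go (h u v)
        where
        go : ∀ b → b ≡ true → (let u′ , v′ = goto (direction b (# 12) (# 2)) (u , v) in
          _≡_ {A = Vertex} (u′ , v′ , target b (# 12) (# 2)) (v , u , # 12))
        go true refl = refl

-- Tilings as 3-colourings.

module Tilings where

  open Encodings using (position<; toNat)
  open Cells using (diamond)
  open Colourings using (succ)
  open import Data.Nat.Divisibility using (divides)
  open import Data.Nat.DivMod using ([m+kn]%n≡m%n; m<n⇒m%n≡m; m<n⇒m/n≡0; m*n/n≡m; +-distrib-/-∣ʳ)

  odd : ℕ → Bool
  odd zero    = false
  odd (suc n) = not (odd n)

  odd-double : ∀ n → odd (n * 2) ≡ false
  odd-double zero    = refl
  odd-double (suc n) = trans (not-involutive _) (odd-double n)

  -- The bound on `k` is that of the quantifier with which the edge formula expresses parity.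
  even-or-odd : ∀ n → (odd n ≡ false × ∃[ k ] k < suc n × n ≡ k * 2) ⊎ (odd n ≡ true × ∃[ k ] k < suc n × n ≡ suc (k * 2))
  even-or-odd zero = inj₁ (refl , 0 , s≤s z≤n , refl)
  even-or-odd (suc n) with even-or-odd n
  ... | inj₁ (e , k , k< , eq) = inj₂ (cong not e , k , m≤n⇒m≤1+n k< , cong suc eq)
  ... | inj₂ (e , k , k< , eq) = inj₁ (cong not e , suc k , s≤s k< , cong suc eq)

  divMod-unique : ∀ n .{{_ : NonZero n}} s {k} → k < n → (n * s + k) % n ≡ k × (n * s + k) / n ≡ s
  divMod-unique n s {k} k<n =
    trans (cong (_% n) eq) (trans ([m+kn]%n≡m%n k s n) (m<n⇒m%n≡m k<n)) ,
    trans (cong (_/ n) eq) (trans (+-distrib-/-∣ʳ k (divides s refl)) (trans (cong₂ _+_ (m<n⇒m/n≡0 k<n) (m*n/n≡m s n)) refl))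
    where
    eq : n * s + k ≡ k + s * n
    eq = trans (+-comm (n * s) k) (cong (k +_) (*-comm n s))

  toℕ-succ : ∀ {n} (i : Fin (suc n)) → (toℕ i ≡ n × toℕ (succ i) ≡ 0) ⊎ (toℕ (succ i) ≡ suc (toℕ i))
  toℕ-succ {n} i with view i
  ... | ‵fromℕ     = inj₁ (toℕ-fromℕ n , refl)
  ... | ‵inject₁ j = inj₂ (cong suc (sym (toℕ-inject₁ j)))

  onNumbers : ∀ {n} → (Fin n → Fin 3) → ℕ → Fin 3
  onNumbers {n} f k with k <? n
  ... | yes k<n = f (fromℕ< k<n)
  ... | no _    = zero

  onNumbers-toℕ : ∀ {n} (f : Fin n → Fin 3) a → onNumbers f (toℕ a) ≡ f a
  onNumbers-toℕ {n} f a with toℕ a <? n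
  ... | yes p = cong f (fromℕ<-toℕ a p)
  ... | no ¬p = contradiction (toℕ<n a) ¬p

  -- Tiles are numbered by Fin L with L odd.  The colours 0, 1, 2 are "true",
  -- "false" and "base"; the last two are exchanged in every other cell, so
  -- that two x of adjacent cells that are not chosen differ in colour.
  module Tiling (K R J′ : ℕ) (Forbidden : ℕ → ℕ → Fin (suc (suc K * 2)) → Set)
    (okH okV : Fin (suc (suc K * 2)) → Fin (suc (suc K * 2)) → Bool) where

    L J width m : ℕ
    L     = suc (suc K * 2)
    J     = suc J′
    width = L + L
    m     = 3 + width * (J * R)

    Valid : (ℕ → ℕ → Fin L) → Set
    Valid τ = ∀ t j → t < R → j < J →
      ¬ Forbidden t j (τ t j) ×
      (suc j < J → okH (τ t j) (τ t (suc j)) ≡ true) ×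
      (suc t < R → okV (τ t j) (τ (suc t) j) ≡ true)

    code : ℕ → ℕ → ℕ → ℕ
    code t j k = 3 + (width * (J * t + j) + k)

    x v : ℕ → ℕ → Fin L → ℕ
    x t j a = code t j (toℕ a)
    v t j a = code t j (L + toℕ a)

    -- In order: `x` avoids the base colour of its cell, held by node 2 or 1 according to parity;
    -- `x` is joined to its `v`; the cycle of the `v`; forbidden tiles are joined to node 0, so that
    -- they are not true; tiles that do not fit beside or below each other. All clauses are bounded
    -- existential statements, so that a formula can express them.
    CellEdge : ℕ → ℕ → ℕ → ℕ → Set
    CellEdge y z t j =
      (∃[ a ] y ≡ x t j a ×
        ((∃[ k ] k < suc (t + j) × t + j ≡ k * 2 × z ≡ 2) ⊎ (∃[ k ] k < suc (t + j) × t + j ≡ suc (k * 2) × z ≡ 1))) ⊎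
      (∃[ a ] y ≡ x t j a × z ≡ v t j a) ⊎
      (∃[ a ] y ≡ v t j a × z ≡ v t j (succ a)) ⊎
      (∃[ a ] Forbidden t j a × y ≡ x t j a × z ≡ 0) ⊎
      (suc j < J × ∃[ a ] ∃[ b ] toNat (okH a b) ≡ 0 × y ≡ x t j a × z ≡ x t (suc j) b) ⊎
      (suc t < R × ∃[ a ] ∃[ b ] toNat (okV a b) ≡ 0 × y ≡ x t j a × z ≡ x (suc t) j b)

    Edge : ℕ → ℕ → Set
    Edge y z = (y ≡ 0 × z ≡ 1) ⊎ (y ≡ 0 × z ≡ 2) ⊎ (y ≡ 1 × z ≡ 2) ⊎
               (∃[ t ] t < R × ∃[ j ] j < J × CellEdge y z t j)

    code<m : ∀ {t j k} → t < R → j < J → k < width → code t j k < m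
    code<m t< j< k< = +-monoʳ-< 3 (position< (position< t< j<) k<)

    x<m : ∀ {t j} → t < R → j < J → ∀ a → x t j a < m
    x<m t< j< a = code<m t< j< (<-≤-trans (toℕ<n a) (m≤m+n L L))

    v<m : ∀ {t j} → t < R → j < J → ∀ a → v t j a < m
    v<m t< j< a = code<m t< j< (+-monoʳ-< L (toℕ<n a))

    code-< : ∀ {s s′ k k′} → s < s′ → k < width → width * s + k < width * s′ + k′
    code-< {s} {s′} {k} s<s′ k< = <-≤-trans (<-≤-trans (+-monoʳ-< (width * s) k<)
      (≤-trans (≤-reflexive (trans (+-comm (width * s) width) (sym (*-suc width s)))) (*-monoʳ-≤ width s<s′))) (m≤m+n _ _)

    edge-irreflexive : ∀ u → ¬ Edge u u
    edge-irreflexive u (inj₁ (refl , ()))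
    edge-irreflexive u (inj₂ (inj₁ (refl , ())))
    edge-irreflexive u (inj₂ (inj₂ (inj₁ (refl , ()))))
    edge-irreflexive u (inj₂ (inj₂ (inj₂ (t , t< , j , j< , e)))) = cell e
      where
      cancel : ∀ {k k′} → code t j k ≡ code t j k′ → k ≡ k′
      cancel eq = +-cancelˡ-≡ (width * (J * t + j)) _ _ (+-cancelˡ-≡ 3 _ _ eq)

      a<width : ∀ (a : Fin L) → toℕ a < width
      a<width a = <-≤-trans (toℕ<n a) (m≤m+n L L)

      cell : CellEdge u u t j → ⊥
      cell (inj₁ (a , refl , inj₁ (_ , _ , _ , ())))
      cell (inj₁ (a , refl , inj₂ (_ , _ , _ , ())))
      cell (inj₂ (inj₁ (a , e , e′))) = <⇒≢ (m<n+m (toℕ a) {L} (s≤s z≤n)) (cancel (trans (sym e) e′))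
      cell (inj₂ (inj₂ (inj₁ (a , e , e′)))) with toℕ-succ a | +-cancelˡ-≡ L _ _ (cancel (trans (sym e) e′))
      ... | inj₁ (last , wrap) | eq = contradiction (trans (sym last) (trans eq wrap)) λ ()
      ... | inj₂ up            | eq = <⇒≢ ≤-refl (trans eq up)
      cell (inj₂ (inj₂ (inj₂ (inj₁ (a , _ , refl , ())))))
      cell (inj₂ (inj₂ (inj₂ (inj₂ (inj₁ (_ , a , b , _ , e , e′)))))) =
        <⇒≢ (code-< {k′ = toℕ b} (+-monoʳ-< (J * t) {j} ≤-refl) (a<width a)) (+-cancelˡ-≡ 3 _ _ (trans (sym e) e′))
      cell (inj₂ (inj₂ (inj₂ (inj₂ (inj₂ (_ , a , b , _ , e , e′)))))) =
        <⇒≢ (code-< {k′ = toℕ b} (+-monoˡ-< j (*-monoʳ-< J {t} ≤-refl)) (a<width a)) (+-cancelˡ-≡ 3 _ _ (trans (sym e) e′))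

    -- From a tiling to a colouring

    pattern 0F = zero
    pattern 1F = suc zero
    pattern 2F = suc (suc zero)

    unchosen other : Bool → Fin 3
    unchosen false = 1F
    unchosen true  = 2F
    other    false = 2F
    other    true  = 1F

    -- The distance from the chosen c along the cycle.
    distance : Fin L → Fin L → ℕ
    distance c a with toℕ c <? toℕ a
    ... | yes _ = toℕ a ∸ toℕ c
    ... | no  _ = toℕ a + (L ∸ toℕ c)

    -- The chosen `x` is true, so its `v` may take the colour of the unchosen `x`. What remains of
    -- the cycle is a path, coloured alternately with 0 and the base colour `other p`.
    xColour vColour : Bool → Fin L → Fin L → Fin 3
    xColour p c a = if does (a ≟ᶠ c) then 0F else unchosen p
    vColour p c a = if does (a ≟ᶠ c) then unchosen p else (if odd (distance c a) then 0F else other p)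

    distance-succ : ∀ c a → a ≢ c → distance c (succ a) ≡ suc (distance c a)
    distance-succ c a a≢c with toℕ-succ a
    ... | inj₁ (last , wrap) with toℕ c <? toℕ (succ a) | toℕ c <? toℕ a
    ...   | yes p | _     with () ← subst (toℕ c <_) wrap p
    ...   | no _  | yes p = trans (cong (_+ (L ∸ toℕ c)) wrap)
                              (trans (+-∸-assoc 1 {suc K * 2} {toℕ c} (s≤s⁻¹ (toℕ<n c))) (cong (λ n → suc (n ∸ toℕ c)) (sym last)))
    ...   | no _  | no ¬p = contradiction (toℕ-injective (≤-antisym (≮⇒≥ ¬p) (subst (toℕ c ≤_) (sym last) (s≤s⁻¹ (toℕ<n c))))) a≢c
    distance-succ c a a≢c | inj₂ up with toℕ c <? toℕ (succ a) | toℕ c <? toℕ a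
    ...   | yes _ | yes p = trans (cong (_∸ toℕ c) up) (+-∸-assoc 1 (<⇒≤ p))
    ...   | yes p | no ¬p = contradiction (toℕ-injective (≤-antisym (≮⇒≥ ¬p) (s≤s⁻¹ (subst (toℕ c <_) up p)))) a≢c
    ...   | no ¬p | yes p = contradiction (subst (toℕ c <_) (sym up) (m<n⇒m<1+n p)) ¬p
    ...   | no _  | no _  = cong (_+ (L ∸ toℕ c)) up

    xv-proper : ∀ p c a → xColour p c a ≢ vColour p c a
    xv-proper p c a with does (a ≟ᶠ c) | odd (distance c a)
    xv-proper false c a | true  | _ = λ ()
    xv-proper true  c a | true  | _ = λ ()
    xv-proper false c a | false | true = λ ()
    xv-proper true  c a | false | true = λ ()
    xv-proper false c a | false | false = λ ()
    xv-proper true  c a | false | false = λ ()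

    unchosen≢ : ∀ p b → unchosen p ≢ (if b then 0F else other p)
    unchosen≢ false true  ()
    unchosen≢ true  true  ()
    unchosen≢ false false ()
    unchosen≢ true  false ()

    0≢other : ∀ p → 0F ≢ other p
    0≢other false ()
    0≢other true  ()

    vv-proper : ∀ p c a → vColour p c a ≢ vColour p c (succ a)
    vv-proper p c a with a ≟ᶠ c | succ a ≟ᶠ c
    ... | yes refl | yes e with toℕ-succ a
    ...   | inj₁ (last , wrap) with () ← trans (sym last) (trans (cong toℕ (sym e)) wrap)
    ...   | inj₂ up = contradiction (trans (cong toℕ (sym e)) up) (<⇒≢ ≤-refl)
    vv-proper p c a | yes _   | no _  = unchosen≢ p (odd (distance c (succ a)))
    vv-proper p c a | no _    | yes _ = unchosen≢ p (odd (distance c a)) ∘ sym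
    vv-proper p c a | no a≢c  | no _ rewrite distance-succ c a a≢c with odd (distance c a)
    ... | true  = 0≢other p
    ... | false = 0≢other p ∘ sym

    x-unchosen : ∀ p c a → a ≢ c → xColour p c a ≡ unchosen p
    x-unchosen p c a ne rewrite dec-false (a ≟ᶠ c) ne = refl

    x≢other : ∀ p c a → xColour p c a ≢ other p
    x≢other p c a with does (a ≟ᶠ c)
    x≢other false c a | true  = λ ()
    x≢other true  c a | true  = λ ()
    x≢other false c a | false = λ ()
    x≢other true  c a | false = λ ()

    unchosen≢0 : ∀ p → unchosen p ≢ 0F
    unchosen≢0 false ()
    unchosen≢0 true  ()

    unchosen-not : ∀ p → unchosen p ≢ unchosen (not p)
    unchosen-not false ()
    unchosen-not true  ()

    -- Neighbouring cells have opposite parity, so two unchosen `x` differ; and an unchosen `x` is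
    -- never true.
    conflict-proper : ∀ p c a c′ a′ → ¬ (a ≡ c × a′ ≡ c′) → xColour p c a ≢ xColour (not p) c′ a′
    conflict-proper p c a c′ a′ ¬both with a ≟ᶠ c | a′ ≟ᶠ c′
    ... | yes e | yes e′ = contradiction (e , e′) ¬both
    ... | yes _ | no _   = unchosen≢0 (not p) ∘ sym
    ... | no _  | yes _  = unchosen≢0 p
    ... | no _  | no _   = unchosen-not p

    module _ (τ : ℕ → ℕ → Fin L) where

      -- The node with number k of the cell in row t and column j.
      cellColour : ℕ → ℕ → ℕ → Fin 3
      cellColour t j k = if does (k <? L) then onNumbers (xColour (odd (t + j)) (τ t j)) k
                                          else onNumbers (vColour (odd (t + j)) (τ t j)) (k ∸ L)

      colour : ℕ → Fin 3
      colour 0 = 0F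
      colour 1 = 1F
      colour 2 = 2F
      colour (suc (suc (suc i))) = cellColour (i / width / J) (i / width % J) (i % width)

      colour-code : ∀ t {j k} → j < J → k < width → colour (code t j k) ≡ cellColour t j k
      colour-code t {j} {k} j< k<
        rewrite proj₁ (divMod-unique width (J * t + j) k<) | proj₂ (divMod-unique width (J * t + j) k<)
              | proj₁ (divMod-unique J t j<) | proj₂ (divMod-unique J t j<) = refl

      colour-x : ∀ t {j} a → j < J → colour (x t j a) ≡ xColour (odd (t + j)) (τ t j) a
      colour-x t {j} a j< = trans (colour-code t j< (<-≤-trans (toℕ<n a) (m≤m+n L L))) cell
        where
        cell : cellColour t j (toℕ a) ≡ xColour (odd (t + j)) (τ t j) a
        cell = trans
          (cong (λ b → if b then onNumbers (xColour (odd (t + j)) (τ t j)) (toℕ a) else onNumbers (vColour (odd (t + j)) (τ t j)) (toℕ a ∸ L))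
                (dec-true (toℕ a <? L) (toℕ<n a)))
          (onNumbers-toℕ (xColour (odd (t + j)) (τ t j)) a)

      colour-v : ∀ t {j} a → j < J → colour (v t j a) ≡ vColour (odd (t + j)) (τ t j) a
      colour-v t {j} a j< = trans (colour-code t j< (+-monoʳ-< L (toℕ<n a))) cell
        where
        cell : cellColour t j (L + toℕ a) ≡ vColour (odd (t + j)) (τ t j) a
        cell = trans
          (cong (λ b → if b then onNumbers (xColour (odd (t + j)) (τ t j)) (L + toℕ a) else onNumbers (vColour (odd (t + j)) (τ t j)) (L + toℕ a ∸ L))
                (dec-false (L + toℕ a <? L) (≤⇒≯ (m≤m+n L (toℕ a)))))
          (trans (cong (onNumbers (vColour (odd (t + j)) (τ t j))) (m+n∸m≡n L (toℕ a)))
                (onNumbers-toℕ (vColour (odd (t + j)) (τ t j)) a))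

      colour-proper : Valid τ → ∀ {y z} → Edge y z → colour y ≢ colour z
      colour-proper valid (inj₁ (refl , refl)) = λ ()
      colour-proper valid (inj₂ (inj₁ (refl , refl))) = λ ()
      colour-proper valid (inj₂ (inj₂ (inj₁ (refl , refl)))) = λ ()
      colour-proper valid {y} {z} (inj₂ (inj₂ (inj₂ (t , t< , j , j< , e)))) = cell e
        where
        p = odd (t + j)
        c = τ t j

        even-parity : ∀ {n k} → n ≡ k * 2 → odd n ≡ false
        even-parity {k = k} refl = odd-double k
        odd-parity : ∀ {n k} → n ≡ suc (k * 2) → odd n ≡ true
        odd-parity {k = k} refl = cong not (odd-double k)

        palette : ∀ {q} a → p ≡ q → colour (x t j a) ≢ other q
        palette a refl eq = x≢other p c a (trans (sym (colour-x t a j<)) eq)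

        cell : CellEdge y z t j → colour y ≢ colour z
        cell (inj₁ (a , refl , inj₁ (k , _ , eq , refl))) = palette a (even-parity {k = k} eq)
        cell (inj₁ (a , refl , inj₂ (k , _ , eq , refl))) = palette a (odd-parity {k = k} eq)
        cell (inj₂ (inj₁ (a , refl , refl))) = subst₂ _≢_ (sym (colour-x t a j<)) (sym (colour-v t a j<)) (xv-proper p c a)
        cell (inj₂ (inj₂ (inj₁ (a , refl , refl)))) =
          subst₂ _≢_ (sym (colour-v t a j<)) (sym (colour-v t (succ a) j<)) (vv-proper p c a)
        cell (inj₂ (inj₂ (inj₂ (inj₁ (a , forbidden , refl , refl))))) =
          subst (_≢ 0F) (sym (trans (colour-x t a j<) (x-unchosen p c a
            (λ e → proj₁ (valid t j t< j<) (subst (Forbidden t j) e forbidden))))) (unchosen≢0 p)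
        cell (inj₂ (inj₂ (inj₂ (inj₂ (inj₁ (sj< , a , b , no-H , refl , refl)))))) =
          subst₂ _≢_ (sym (colour-x t a j<))
            (sym (trans (colour-x t b sj<) (cong (λ s → xColour (odd s) (τ t (suc j)) b) (+-suc t j))))
            (conflict-proper p c a (τ t (suc j)) b λ { (refl , refl) →
              contradiction (trans (cong toNat (sym (proj₁ (proj₂ (valid t j t< j<)) sj<))) no-H) λ () })
        cell (inj₂ (inj₂ (inj₂ (inj₂ (inj₂ (st< , a , b , no-V , refl , refl)))))) =
          subst₂ _≢_ (sym (colour-x t a j<)) (sym (colour-x (suc t) b j<))
            (conflict-proper p c a (τ (suc t) j) b λ { (refl , refl) →
              contradiction (trans (cong toNat (sym (proj₂ (proj₂ (valid t j t< j<)) st<))) no-V) λ () })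

    -- From a colouring to a tiling

    module _ (col : Fin m → Fin 3) (proper : ∀ u w → Edge (toℕ u) (toℕ w) → col u ≢ col w) where

      shade : ∀ {n} → .(n < m) → Fin 3
      shade n< = col (fromℕ< n<)

      shade-proper : ∀ {y z} .(y< : y < m) .(z< : z < m) → Edge y z → shade y< ≢ shade z<
      shade-proper y< z< e = proper (fromℕ< y<) (fromℕ< z<) (subst₂ Edge (sym (toℕ-fromℕ< y<)) (sym (toℕ-fromℕ< z<)) e)

      0<m : 0 < m
      0<m = s≤s z≤n
      1<m : 1 < m
      1<m = s≤s (s≤s z≤n)
      2<m : 2 < m
      2<m = s≤s (s≤s (s≤s z≤n))

      module _ {t j : ℕ} (t< : t < R) (j< : j < J) where

        cell-edge : ∀ {y z} → CellEdge y z t j → Edge y z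
        cell-edge e = inj₂ (inj₂ (inj₂ (t , t< , j , j< , e)))

        xs vs : Fin L → Fin 3
        xs a = shade (x<m t< j< a)
        vs a = shade (v<m t< j< a)

        -- If no x is true, then all x have the same colour and the v
        -- alternate along a cycle of odd length.
        module _ {o u : ℕ} (o<m : o < m) (u<m : u < m) (0≢o : shade 0<m ≢ shade o<m) (0≢u : shade 0<m ≢ shade u<m)
          (o≢u : shade o<m ≢ shade u<m) (x≢o : ∀ a → xs a ≢ shade o<m) (none : ∀ a → xs a ≢ shade 0<m) where

          x≡u : ∀ a → xs a ≡ shade u<m
          x≡u a = diamond (xs a) (shade 0<m) (shade o<m) (shade u<m) (none a) (x≢o a) 0≢o (0≢u ∘ sym) (o≢u ∘ sym)

          v≢u : ∀ a → vs a ≢ shade u<m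
          v≢u a e = shade-proper (x<m t< j< a) (v<m t< j< a) (cell-edge (inj₂ (inj₁ (a , refl , refl)))) (trans (x≡u a) (sym e))

          v≢v : ∀ a → vs a ≢ vs (succ a)
          v≢v a = shade-proper (v<m t< j< a) (v<m t< j< (succ a)) (cell-edge (inj₂ (inj₂ (inj₁ (a , refl , refl)))))

          -- All `v` avoid the colour of `u`, so only two colours are left for them and these
          -- alternate.
          two-steps : ∀ a → vs (succ (succ a)) ≡ vs a
          two-steps a = sym (diamond (vs a) (vs (succ a)) (shade u<m) (vs (succ (succ a)))
            (v≢v a) (v≢u a) (v≢u (succ a)) (v≢v (succ a) ∘ sym) (v≢u (succ (succ a))))

          around : ℕ → Fin L
          around zero    = zero
          around (suc n) = succ (around n)

          toℕ-around : ∀ n → n < L → toℕ (around n) ≡ n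
          toℕ-around zero    n< = refl
          toℕ-around (suc n) n< with toℕ-succ (around n) | toℕ-around n (<-trans ≤-refl n<)
          ... | inj₂ up         | eq = trans up (cong suc eq)
          ... | inj₁ (last , _) | eq = contradiction (trans (sym eq) last) (<⇒≢ (s≤s⁻¹ n<))

          around-closed : succ (around (suc K * 2)) ≡ zero
          around-closed with toℕ-succ (around (suc K * 2))
          ... | inj₁ (_ , wrap) = toℕ-injective wrap
          ... | inj₂ up = contradiction (toℕ<n (succ (around (suc K * 2))))
                            (<⇒≱ (s≤s (≤-reflexive (sym (trans up (cong suc (toℕ-around (suc K * 2) ≤-refl)))))))

          even-steps : ∀ k → vs (around (k * 2)) ≡ vs zero
          even-steps zero    = refl
          even-steps (suc k) = trans (two-steps (around (k * 2))) (even-steps k)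

          absurd : ⊥
          -- The last node of the cycle is an even number of steps from the first, so it has the
          -- same colour, yet the cycle joins the two.
          absurd = v≢v (around (suc K * 2)) (trans (even-steps (suc K)) (cong vs (sym around-closed)))

        some-true : ∃[ a ] xs a ≡ shade 0<m
        some-true with any? (λ a → xs a ≟ᶠ shade 0<m)
        ... | yes found = found
        ... | no ¬any with even-or-odd (t + j)
        ...   | inj₁ (_ , k , k< , eq) = ⊥-elim (absurd 2<m 1<m
                  (shade-proper 0<m 2<m (inj₂ (inj₁ (refl , refl)))) (shade-proper 0<m 1<m (inj₁ (refl , refl)))
                  (shade-proper 1<m 2<m (inj₂ (inj₂ (inj₁ (refl , refl)))) ∘ sym)
                  (λ a → shade-proper (x<m t< j< a) 2<m (cell-edge (inj₁ (a , refl , inj₁ (k , k< , eq , refl)))))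
                  (λ a e → ¬any (a , e)))
        ...   | inj₂ (_ , k , k< , eq) = ⊥-elim (absurd 1<m 2<m
                  (shade-proper 0<m 1<m (inj₁ (refl , refl))) (shade-proper 0<m 2<m (inj₂ (inj₁ (refl , refl))))
                  (shade-proper 1<m 2<m (inj₂ (inj₂ (inj₁ (refl , refl)))))
                  (λ a → shade-proper (x<m t< j< a) 1<m (cell-edge (inj₁ (a , refl , inj₂ (k , k< , eq , refl)))))
                  (λ a e → ¬any (a , e)))

      chosen : ℕ → ℕ → Fin L
      chosen t j with t <? R | j <? J
      ... | yes t< | yes j< = proj₁ (some-true t< j<)
      ... | _      | _      = zero

      chosen-true : ∀ {t j} (t< : t < R) (j< : j < J) → shade (x<m t< j< (chosen t j)) ≡ shade 0<m
      chosen-true {t} {j} t< j< with t <? R | j <? J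
      ... | yes t<′ | yes j<′ = proj₂ (some-true t<′ j<′)
      ... | yes _   | no ¬j<  = contradiction j< ¬j<
      ... | no ¬t<  | _       = contradiction t< ¬t<

      -- A cell may have several true nodes, and any choice works: the edges exclude every forbidden
      -- true node and every conflicting pair of true nodes.
      chosen-valid : Valid chosen
      chosen-valid t j t< j< =
        (λ forbidden → shade-proper (x<m t< j< _) 0<m
          (cell-edge t< j< (inj₂ (inj₂ (inj₂ (inj₁ (chosen t j , forbidden , refl , refl)))))) (chosen-true t< j<)) ,
        (λ sj< → allowed (okH _ _) λ no-H → shade-proper (x<m t< j< _) (x<m t< sj< _)
          (cell-edge t< j< (inj₂ (inj₂ (inj₂ (inj₂ (inj₁ (sj< , chosen t j , chosen t (suc j) , no-H , refl , refl)))))))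
          (trans (chosen-true t< j<) (sym (chosen-true t< sj<)))) ,
        (λ st< → allowed (okV _ _) λ no-V → shade-proper (x<m t< j< _) (x<m st< j< _)
          (cell-edge t< j< (inj₂ (inj₂ (inj₂ (inj₂ (inj₂ (st< , chosen t j , chosen (suc t) j , no-V , refl , refl)))))))
          (trans (chosen-true t< j<) (sym (chosen-true st< j<))))
        where
        allowed : ∀ b → ¬ (toNat b ≡ 0) → b ≡ true
        allowed true  h = refl
        allowed false h = contradiction refl h

-- Runs as histories of the cells around the heads.

module Histories where

  open Machines hiding (State)
  open Expressions using (bitAt)
  open Encodings using (toNat)
  open import Data.Integer.Base using (ℤ; +_; -[1+_])
  open import Data.Vec.Base using (replicate; head; tail)

  Fin-coding : ∀ n → Coding (Fin n)
  Fin-coding n = record { size = n ; code = id ; decode = id ; decode-code = λ _ → refl }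

  ×-coding : ∀ {A B} → Coding A → Coding B → Coding (A × B)
  ×-coding c d = record
    { size        = C.size * D.size
    ; code        = λ (a , b) → combine (C.code a) (D.code b)
    ; decode      = λ i → let j , k = remQuot D.size i in C.decode j , D.decode k
    ; decode-code = λ (a , b) → trans (cong (λ (j , k) → C.decode j , D.decode k) (remQuot-combine (C.code a) (D.code b)))
                                      (cong₂ _,_ (C.decode-code a) (D.decode-code b)) }
    where
    module C = Coding c
    module D = Coding d

  retract-coding : ∀ {A B} (f : A → B) (g : B → A) → (∀ a → g (f a) ≡ a) → Coding B → Coding A
  retract-coding f g gf c = record
    { size = size ; code = code ∘ f ; decode = g ∘ decode
    ; decode-code = λ a → trans (cong g (decode-code (f a))) (gf a) }
    where open Coding c

  Vec-coding : ∀ {A} n → Coding A → Coding (Vec A n)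
  Vec-coding zero    c = retract-coding (λ _ → _) (λ _ → []) (λ { [] → refl }) ⊤-coding
  Vec-coding (suc n) c = retract-coding (λ v → head v , tail v) (λ (a , v) → a ∷ v) (λ { (a ∷ v) → refl })
                                        (×-coding c (Vec-coding n c))

  Symbol-coding : ∀ s → Coding (Symbol s)
  Symbol-coding s = retract-coding f g gf (Fin-coding (3 + s))
    where
    f : Symbol s → Fin (3 + s)
    f blank       = zero
    f (bit false) = suc zero
    f (bit true)  = suc (suc zero)
    f (extra i)   = suc (suc (suc i))
    g : Fin (3 + s) → Symbol s
    g zero                = blank
    g (suc zero)          = bit false
    g (suc (suc zero))    = bit true
    g (suc (suc (suc i))) = extra i
    gf : ∀ a → g (f a) ≡ a
    gf blank       = refl
    gf (bit false) = refl
    gf (bit true)  = refl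
    gf (extra i)   = refl

  coding-≟ : ∀ {A} → Coding A → DecidableEquality A
  coding-≟ c a b = map′ (λ e → trans (sym (decode-code a)) (trans (cong decode e) (decode-code b))) (cong code) (code a ≟ᶠ code b)
    where open Coding c

  -- Numbers that code nothing decode to a default value.
  module Padding {A : Set} (c : Coding A) (default : A) {L : ℕ} (fits : Coding.size c ≤ L) where

    open Coding c

    value : Fin L → A
    value a with toℕ a <? size
    ... | yes p = decode (fromℕ< p)
    ... | no _  = default

    number : A → Fin L
    number a = inject≤ (code a) fits

    value-number : ∀ a → value (number a) ≡ a
    value-number a with toℕ (number a) <? size
    ... | yes p = trans (cong decode (trans (fromℕ<-cong _ _ (toℕ-inject≤ (code a) fits) p (toℕ<n (code a)))
                                            (fromℕ<-toℕ (code a) (toℕ<n (code a))))) (decode-code a)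
    ... | no ¬p = contradiction (subst (_< size) (sym (toℕ-inject≤ (code a) fits)) (toℕ<n (code a))) ¬p

  does-nonzero : ∀ {A : Set} (a? : Dec A) → toNat (does a?) ≢ 0 → A
  does-nonzero (yes a) _ = a
  does-nonzero (no _)  h = contradiction refl h

  vec-ext : ∀ {A : Set} {n} {u v : Vec A n} → (∀ i → lookup u i ≡ lookup v i) → u ≡ v
  vec-ext {u = u} {v} h = trans (sym (tabulate∘lookup u)) (trans (tabulate-cong h) (tabulate∘lookup v))

  module _ {s : ℕ} where

    symbols : List Bool → ℕ → Symbol s
    symbols w = nth (List.map bit w)

    at-input : ∀ w i → at (inputTape {s} w) (+ i) ≡ symbols w i
    at-input []      zero    = refl
    at-input []      (suc i) = refl
    at-input (b ∷ w) zero    = refl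
    at-input (b ∷ w) (suc i) = refl

    at-before-input : ∀ w i → at (inputTape {s} w) -[1+ i ] ≡ blank
    at-before-input []      i = refl
    at-before-input (b ∷ w) i = refl

    at-empty : ∀ z → at (emptyTape {s}) z ≡ blank
    at-empty (+ zero)  = refl
    at-empty (+ suc n) = refl
    at-empty -[1+ n ]  = refl

    symbols-flag : ∀ x y {i} → i < length x → symbols ⟨ x , y ⟩ (i * 2) ≡ bit true
    symbols-flag (b ∷ x) y {zero}  _       = refl
    symbols-flag (b ∷ x) y {suc i} (s≤s h) = symbols-flag x y h

    symbols-first : ∀ x y {i} b → i < length x → bitAt x i ≡ toNat b → symbols ⟨ x , y ⟩ (suc (i * 2)) ≡ bit b
    symbols-first (true  ∷ x) y {zero}  true  _ _ = refl
    symbols-first (false ∷ x) y {zero}  false _ _ = refl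
    symbols-first (true  ∷ x) y {suc i} b (s≤s h) e = symbols-first x y b h e
    symbols-first (false ∷ x) y {suc i} b (s≤s h) e = symbols-first x y b h e

    symbols-delimiter : ∀ x y → symbols ⟨ x , y ⟩ (length x * 2) ≡ bit false
    symbols-delimiter []      y = refl
    symbols-delimiter (b ∷ x) y = symbols-delimiter x y

    symbols-second : ∀ x y i → symbols ⟨ x , y ⟩ (length x * 2 + suc i) ≡ symbols y i
    symbols-second []      y i = refl
    symbols-second (b ∷ x) y i = symbols-second x y i

    symbols-beyond : ∀ w {i} → length w ≤ i → symbols w i ≡ blank
    symbols-beyond []      _       = refl
    symbols-beyond (b ∷ w) (s≤s h) = symbols-beyond w h

    symbols-bits : ∀ w i → (∃[ b ] symbols w i ≡ bit b) ⊎ (symbols w i ≡ blank × symbols w (suc i) ≡ blank)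
    symbols-bits []      i       = inj₂ (refl , refl)
    symbols-bits (b ∷ w) zero    = inj₁ (b , refl)
    symbols-bits (b ∷ w) (suc i) = symbols-bits w i

    spelled : (ℕ → Symbol s) → ℕ → List Bool
    spelled f zero = []
    spelled f (suc n) with f 0
    ... | bit b = b ∷ spelled (f ∘ suc) n
    ... | _     = []

    length-spelled : ∀ f n → length (spelled f n) ≤ n
    length-spelled f zero = z≤n
    length-spelled f (suc n) with f 0
    ... | bit b   = s≤s (length-spelled (f ∘ suc) n)
    ... | blank   = z≤n
    ... | extra _ = z≤n

    -- A certificate may end before the space reserved for it. The hypothesis makes blanks persist
    -- to the right, so the word up to the first blank accounts for all symbols.
    symbols-spelled : ∀ f n → (∀ i → i < n → (∃[ b ] f i ≡ bit b) ⊎ (f i ≡ blank × f (suc i) ≡ blank)) → f n ≡ blank →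
      ∀ i → i ≤ n → symbols (spelled f n) i ≡ f i
    symbols-spelled f zero    h end zero z≤n = sym end
    symbols-spelled f (suc n) h end i i≤n with f 0 in eq
    symbols-spelled f (suc n) h end zero    i≤n       | bit b = sym eq
    symbols-spelled f (suc n) h end (suc i) (s≤s i≤n) | bit b =
      symbols-spelled (f ∘ suc) n (λ i i< → h (suc i) (s≤s i<)) end i i≤n
    symbols-spelled f (suc n) h end i       i≤n       | blank = sym (blanks i i≤n)
      where
      blanks : ∀ i → i ≤ suc n → f i ≡ blank
      blanks zero    _ = eq
      blanks (suc i) i< with h i i< | blanks i (<⇒≤ i<)
      ... | inj₂ (_ , b) | _ = b
      ... | inj₁ (b , e) | e′ with () ← trans (sym e) e′
    symbols-spelled f (suc n) h end i       i≤n       | extra _ with h 0 (s≤s z≤n)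
    ... | inj₁ (b , e) with () ← trans (sym eq) e
    ... | inj₂ (e , _) with () ← trans (sym eq) e

  half : ∀ n {i} → i < n * 2 → ∃[ k ] k < n × (i ≡ k * 2 ⊎ i ≡ suc (k * 2))
  half (suc n) {zero}        _             = 0 , s≤s z≤n , inj₁ refl
  half (suc n) {suc zero}    _             = 0 , s≤s z≤n , inj₂ refl
  half (suc n) {suc (suc i)} (s≤s (s≤s h)) =
    let k , k< , e = half n h in suc k , s≤s k< , Sum.map (cong (λ n → suc (suc n))) (cong (λ n → suc (suc n))) e

  write : ∀ {s} → Symbol s → Tape s → Tape s
  write a (tape ls _ rs) = tape ls a rs

  at-write-0 : ∀ {s} (a : Symbol s) t → at (write a t) (+ 0) ≡ a
  at-write-0 a (tape ls h rs) = refl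

  at-write : ∀ {s} (a : Symbol s) t {z} → z ≢ + 0 → at (write a t) z ≡ at t z
  at-write a t {+ zero}  ne = contradiction refl ne
  at-write a t {+ suc n} ne = refl
  at-write a t { -[1+ n ]} ne = refl

  ⊝-off : ∀ {j n} → j ≢ n → j ⊝ n ≢ + 0
  ⊝-off {zero}  {zero}  ne e = ne refl
  ⊝-off {suc j} {zero}  ne ()
  ⊝-off {zero}  {suc n} ne ()
  ⊝-off {suc j} {suc n} ne e = ⊝-off (ne ∘ cong suc) e

  ⊝-+ : ∀ n i → (n + i) ⊝ n ≡ + i
  ⊝-+ zero    i = refl
  ⊝-+ (suc n) i = ⊝-+ n i

  ⊝-< : ∀ {j n} → j < n → ∃[ i ] j ⊝ n ≡ -[1+ i ]
  ⊝-< {zero}  {suc n} _       = n , refl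
  ⊝-< {suc j} {suc n} (s≤s h) = ⊝-< h

  module History (M : TM) where

    open TM M
    open Run M

    Cell : Set
    Cell = Vec Sym tapes

    scanOf : Config → Cell
    scanOf c = Vec.map Tape.scanned (Config.contents c)

    -- A halted machine stays as it is.
    successor : State → Cell → State
    successor q v = maybe′ proj₁ q (δ q v)

    action : State → Cell → Vec (Sym × Move) tapes
    action q v = maybe′ proj₂ (Vec.map (_, stay) v) (δ q v)

    advance : Config → Config
    advance c = config (successor (Config.state c) (scanOf c)) (zipWith writeMove (action (Config.state c) (scanOf c)) (Config.contents c))

    advance-just : ∀ {c d} → next c ≡ just d → advance c ≡ d
    advance-just {config q ts} eq with δ q (Vec.map Tape.scanned ts)
    advance-just {config q ts} refl | just _ = refl

    advance-nothing : ∀ {c} → next c ≡ nothing → advance c ≡ c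
    advance-nothing {config q ts} eq with δ q (Vec.map Tape.scanned ts)
    ... | nothing = cong (config q) (writeMove-idle ts)

    history : Config → ℕ → Config
    history c zero    = c
    history c (suc t) = advance (history c t)

    history-suc : ∀ c t → history c (suc t) ≡ history (advance c) t
    history-suc c zero    = refl
    history-suc c (suc t) = cong advance (history-suc c t)

    history-halted : ∀ {c} → next c ≡ nothing → ∀ t → history c t ≡ c
    history-halted h zero    = refl
    history-halted h (suc t) = trans (cong advance (history-halted h t)) (advance-nothing h)

    -- Because halted configurations persist, runs of different lengths can all be read at one
    -- common time `t`.
    history-run : ∀ {c s d} → c ⇓[ s ] d → ∀ {t} → s ≤ t → history c t ≡ d
    history-run (halt h)     {t}     _       = history-halted h t
    history-run {c} (step e r) {suc t} (s≤s h) =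
      trans (history-suc c t) (trans (cong (λ c → history c t) (advance-just e)) (history-run r h))

    cell : Config → ℤ → Cell
    cell c z = Vec.map (λ t → at t z) (Config.contents c)

    -- The same after writing, before moving.
    written : Config → ℤ → Cell
    written c z = zipWith (λ a t → at (write (proj₁ a) t) z) (action (Config.state c) (scanOf c)) (Config.contents c)

    pick : Move → Sym → Sym → Sym → Sym
    pick left  l m r = l
    pick stay  l m r = m
    pick right l m r = r

    moved : Vec (Sym × Move) tapes → Cell → Cell → Cell → Cell
    moved a l m r = tabulate λ i → pick (proj₂ (lookup a i)) (lookup l i) (lookup m i) (lookup r i)

    lookup-cell : ∀ c z i → lookup (cell c z) i ≡ at (lookup (Config.contents c) i) z
    lookup-cell c z i = lookup-map i (λ t → at t z) (Config.contents c)

    lookup-written : ∀ c z i → lookup (written c z) i ≡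
      at (write (proj₁ (lookup (action (Config.state c) (scanOf c)) i)) (lookup (Config.contents c) i)) z
    lookup-written c z i = lookup-zipWith (λ a t → at (write (proj₁ a) t) z) i
      (action (Config.state c) (scanOf c)) (Config.contents c)

    cell-0 : ∀ c → cell c (+ 0) ≡ scanOf c
    cell-0 c = vec-ext λ i → trans (lookup-cell c (+ 0) i)
      (trans (at-head (lookup (Config.contents c) i)) (sym (lookup-map i Tape.scanned (Config.contents c))))

    written-0 : ∀ c → written c (+ 0) ≡ Vec.map proj₁ (action (Config.state c) (scanOf c))
    written-0 c = vec-ext λ i → trans (lookup-written c (+ 0) i)
      (trans (at-write-0 (proj₁ (lookup (action (Config.state c) (scanOf c)) i)) (lookup (Config.contents c) i))
             (sym (lookup-map i proj₁ (action (Config.state c) (scanOf c)))))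

    written-off : ∀ c {z} → z ≢ + 0 → written c z ≡ cell c z
    written-off c {z} ne = vec-ext λ i → trans (lookup-written c z i)
      (trans (at-write (proj₁ (lookup (action (Config.state c) (scanOf c)) i)) (lookup (Config.contents c) i) ne)
             (sym (lookup-cell c z i)))

    -- The local rule behind the tableau: each tape slides by its own move, so the new cell takes
    -- from each tape the written symbol of itself or of one neighbour.
    cell-advance : ∀ c z → cell (advance c) z ≡
      moved (action (Config.state c) (scanOf c)) (written c (shift left z)) (written c z) (written c (shift right z))
    cell-advance c z = vec-ext λ i → trans (lookup-cell (advance c) z i)
      (trans (cong (λ t → at t z) (lookup-zipWith writeMove i a ts))
      (trans (tape-advance (proj₁ (lookup a i)) (proj₂ (lookup a i)) (lookup ts i) {z})
      (trans (pick-cong (proj₂ (lookup a i)) (sym (lookup-written c (shift left z) i)) (sym (lookup-written c z i)) (sym (lookup-written c (shift right z) i)))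
             (sym (lookup∘tabulate (λ i → pick (proj₂ (lookup a i)) (lookup (written c (shift left z)) i) (lookup (written c z) i) (lookup (written c (shift right z)) i)) i)))))
      where
      a  = action (Config.state c) (scanOf c)
      ts = Config.contents c
      pick-cong : ∀ m {l l′ n n′ r r′} → l ≡ l′ → n ≡ n′ → r ≡ r′ → pick m l n r ≡ pick m l′ n′ r′
      pick-cong m refl refl refl = refl
      tape-advance : ∀ a m t {z} → at (writeMove (a , m) t) z ≡
        pick m (at (write a t) (shift left z)) (at (write a t) z) (at (write a t) (shift right z))
      tape-advance a left  (tape ls h rs) {z} = at-move left (tape ls a rs) z
      tape-advance a stay  (tape ls h rs) = refl
      tape-advance a right (tape ls h rs) {z} = at-move right (tape ls a rs) z

    cell-initial : ∀ w z → cell (initial w) z ≡ at (inputTape w) z ∷ replicate workTapes blank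
    cell-initial w z = cong (at (inputTape w) z ∷_)
      (trans (map-replicate (λ t → at t z) emptyTape workTapes) (cong (replicate workTapes) (at-empty z)))

-- Tableaux of accepting runs as tilings.

module Tableaux where

  open Machines hiding (State)
  open Expressions using (bitAt; bitAt≤1)
  open Encodings using (toNat; does-true)
  open Tilings using (module Tiling)
  open Histories
  open import Data.Integer.Base using (ℤ)
  open import Data.Vec.Base using (replicate; head; tail)

  -- centre: the head is in column T; beside: elsewhere nothing is written;
  -- final: the last row accepts.  The others describe the first row, which
  -- holds ⟨ x , y ⟩ for some y, starting at column T.
  data Rule : Set where
    centre beside final opening ahead flag one zer delimiter certificate after : Rule

  module Tableau (M : TM) where

    open TM M
    open Run M
    open History M public

    -- The tile of a cell tells the state, the scanned symbols, the symbols
    -- of the cell, and after writing the symbols of its left neighbour, of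
    -- the cell and of its right neighbour.
    record Tile : Set where
      constructor mkTile
      field
        state                    : State
        scanned here before after′ beyond : Cell
    open Tile

    abstract

      cell-coding : Coding Cell
      cell-coding = Vec-coding tapes (Symbol-coding extraSymbols)

      tile-coding : Coding Tile
      tile-coding = retract-coding
        (λ τ → state τ , scanned τ , here τ , before τ , after′ τ , beyond τ)
        (λ (q , s , c , l , m , r) → mkTile q s c l m r) (λ _ → refl)
        (×-coding (Fin-coding states) (×-coding cell-coding (×-coding cell-coding (×-coding cell-coding (×-coding cell-coding cell-coding)))))

    K : ℕ
    K = Coding.size tile-coding

    L : ℕ
    L = suc (suc K * 2)

    abstract

      K≤L : K ≤ L
      K≤L = ≤-trans (m≤m*n K 2) (≤-trans (n≤1+n _) (≤-trans (n≤1+n _) (n≤1+n _)))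

      defaultTile : Tile
      defaultTile = mkTile (TM.start M) blanks blanks blanks blanks blanks
        where
        blanks : Cell
        blanks = replicate tapes blank

      tile : Fin L → Tile
      tile = Padding.value tile-coding defaultTile K≤L

      number : Tile → Fin L
      number = Padding.number tile-coding defaultTile K≤L

      tile-number : ∀ τ → tile (number τ) ≡ τ
      tile-number = Padding.value-number tile-coding defaultTile K≤L

    _≟ˢ_ : DecidableEquality Sym
    _≟ˢ_ = coding-≟ (Symbol-coding extraSymbols)

    _≟ᶜ_ : DecidableEquality Cell
    _≟ᶜ_ = coding-≟ cell-coding

    Requirement : Rule → Tile → Set
    Requirement centre      τ = here τ ≡ scanned τ × after′ τ ≡ Vec.map proj₁ (action (state τ) (scanned τ))
    Requirement beside      τ = after′ τ ≡ here τ
    Requirement final       τ = accepting (state τ) ≡ true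
    Requirement opening       τ = state τ ≡ TM.start M × tail (here τ) ≡ replicate workTapes blank
    Requirement ahead      τ = head (here τ) ≡ blank
    Requirement flag        τ = head (here τ) ≡ bit true
    Requirement one         τ = head (here τ) ≡ bit true
    Requirement zer         τ = head (here τ) ≡ bit false
    Requirement delimiter   τ = head (here τ) ≡ bit false
    Requirement certificate τ = (head (here τ) ≡ bit true ⊎ head (here τ) ≡ bit false) ⊎ (head (here τ) ≡ blank × head (beyond τ) ≡ blank)
    Requirement after       τ = head (here τ) ≡ blank

    requirement? : ∀ r τ → Dec (Requirement r τ)
    requirement? centre      τ = (here τ ≟ᶜ _) ×-dec (after′ τ ≟ᶜ _)
    requirement? beside      τ = after′ τ ≟ᶜ _
    requirement? final       τ = accepting (state τ) ≟ᵇ true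
    requirement? opening       τ = (state τ ≟ᶠ _) ×-dec (coding-≟ (Vec-coding workTapes (Symbol-coding extraSymbols)) _ _)
    requirement? ahead      τ = head (here τ) ≟ˢ _
    requirement? flag        τ = head (here τ) ≟ˢ _
    requirement? one         τ = head (here τ) ≟ˢ _
    requirement? zer         τ = head (here τ) ≟ˢ _
    requirement? delimiter   τ = head (here τ) ≟ˢ _
    requirement? certificate τ = ((head (here τ) ≟ˢ _) ⊎-dec (head (here τ) ≟ˢ _)) ⊎-dec ((head (here τ) ≟ˢ _) ×-dec (head (beyond τ) ≟ˢ _))
    requirement? after       τ = head (here τ) ≟ˢ _

    -- State and scanned symbols are constant along a row: in this way every column learns which
    -- transition is taken at the head.
    record Horizontal (σ τ : Tile) : Set where
      constructor horizontal
      field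
        same-state   : state σ ≡ state τ
        same-scanned : scanned σ ≡ scanned τ
        rightwards   : beyond σ ≡ after′ τ
        leftwards    : after′ σ ≡ before τ

    record Vertical (σ τ : Tile) : Set where
      constructor vertical
      field
        next-state : state τ ≡ successor (state σ) (scanned σ)
        next-cell  : here τ ≡ moved (action (state σ) (scanned σ)) (before σ) (after′ σ) (beyond σ)

    horizontal? : ∀ σ τ → Dec (Horizontal σ τ)
    horizontal? σ τ = map′ (λ (a , b , c , d) → horizontal a b c d) (λ (horizontal a b c d) → a , b , c , d)
      ((state σ ≟ᶠ state τ) ×-dec ((scanned σ ≟ᶜ scanned τ) ×-dec ((beyond σ ≟ᶜ after′ τ) ×-dec (after′ σ ≟ᶜ before τ))))

    vertical? : ∀ σ τ → Dec (Vertical σ τ)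
    vertical? σ τ = map′ (λ (a , b) → vertical a b) (λ (vertical a b) → a , b)
      ((state τ ≟ᶠ successor (state σ) (scanned σ)) ×-dec
       (here τ ≟ᶜ moved (action (state σ) (scanned σ)) (before σ) (after′ σ) (beyond σ)))

    abstract

      ok : Rule → Fin L → Bool
      ok r a = does (requirement? r (tile a))

      okH okV : Fin L → Fin L → Bool
      okH a b = does (horizontal? (tile a) (tile b))
      okV a b = does (vertical? (tile a) (tile b))

      ok-complete : ∀ r a → Requirement r (tile a) → ok r a ≡ true
      ok-complete r a = dec-true (requirement? r (tile a))

      okH-complete : ∀ a b → Horizontal (tile a) (tile b) → okH a b ≡ true
      okH-complete a b = dec-true (horizontal? (tile a) (tile b))

      okV-complete : ∀ a b → Vertical (tile a) (tile b) → okV a b ≡ true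
      okV-complete a b = dec-true (vertical? (tile a) (tile b))

      ok-sound : ∀ r a → ¬ (toNat (ok r a) ≡ 0) → Requirement r (tile a)
      ok-sound r a = does-nonzero (requirement? r (tile a))

      okH-sound : ∀ a b → okH a b ≡ true → Horizontal (tile a) (tile b)
      okH-sound a b = does-true (horizontal? (tile a) (tile b))

      okV-sound : ∀ a b → okV a b ≡ true → Vertical (tile a) (tile b)
      okV-sound a b = does-true (vertical? (tile a) (tile b))

    module Instance (x : List Bool) (P T : ℕ) where

      N : ℕ
      N = length x

      -- In row 0 the flags stand in columns `T + 2i`, the bits of `x` in `T + 2i + 1`, the
      -- delimiter in `T + 2N`, and at most `P` certificate bits from `T + 2N + 1` on.
      Condition : Rule → ℕ → ℕ → Set
      Condition centre      t j = j ≡ T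
      Condition beside      t j = j < T ⊎ T < j
      Condition final       t j = t ≡ T
      Condition opening       t j = t ≡ 0
      Condition ahead      t j = t ≡ 0 × j < T
      Condition flag        t j = t ≡ 0 × ∃[ i ] i < N × j ≡ T + i * 2
      Condition one         t j = t ≡ 0 × ∃[ i ] i < N × j ≡ T + suc (i * 2) × bitAt x i ≡ 1
      Condition zer         t j = t ≡ 0 × ∃[ i ] i < N × j ≡ T + suc (i * 2) × bitAt x i ≡ 0
      Condition delimiter   t j = t ≡ 0 × j ≡ T + N * 2
      Condition certificate t j = t ≡ 0 × ∃[ i ] i < P × j ≡ T + (N * 2 + suc i)
      Condition after       t j = t ≡ 0 × T + (N * 2 + P) < j

      Forbidden : ℕ → ℕ → Fin L → Set
      Forbidden t j a = ∃[ r ] Condition r t j × toNat (ok r a) ≡ 0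

      open Tiling K (suc T) (T + T) Forbidden okH okV public using (Valid)

      -- The tiling of an accepting run

      tileOf : Config → ℤ → Tile
      tileOf c z = mkTile (Config.state c) (scanOf c) (cell c z) (written c (shift left z)) (written c z) (written c (shift right z))

      module _ (y : List Bool) (short : length y ≤ P) (accepted : Accepts (history (initial ⟨ x , y ⟩) T)) where

        conf : ℕ → Config
        conf = history (initial ⟨ x , y ⟩)

        tiling : ℕ → ℕ → Fin L
        tiling t j = number (tileOf (conf t) (j ⊝ T))

        head-cell : ∀ i → head (cell (conf 0) ((T + i) ⊝ T)) ≡ symbols ⟨ x , y ⟩ i
        head-cell i = trans (cong head (cell-initial ⟨ x , y ⟩ ((T + i) ⊝ T)))
          (trans (cong (at (inputTape ⟨ x , y ⟩)) (⊝-+ T i)) (at-input ⟨ x , y ⟩ i))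

        second-head : ∀ i → head (cell (conf 0) ((T + (N * 2 + suc i)) ⊝ T)) ≡ symbols y i
        second-head i = trans (head-cell (N * 2 + suc i)) (symbols-second x y i)

        requirement : ∀ r t j → Condition r t j → Requirement r (tileOf (conf t) (j ⊝ T))
        requirement centre t j refl =
          trans (cong (cell (conf t)) (⊝-diag T)) (cell-0 (conf t)) ,
          trans (cong (written (conf t)) (⊝-diag T)) (written-0 (conf t))
        requirement beside t j (inj₁ j<T) = written-off (conf t) (⊝-off (<⇒≢ j<T))
        requirement beside t j (inj₂ T<j) = written-off (conf t) (⊝-off (<⇒≢ T<j ∘ sym))
        requirement final  t j refl = accepted
        requirement opening  t j refl = refl , cong tail (cell-initial ⟨ x , y ⟩ (j ⊝ T))
        requirement ahead t j (refl , j<T) with i , e ← ⊝-< j<T =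
          trans (cong head (cell-initial ⟨ x , y ⟩ (j ⊝ T)))
                (trans (cong (at (inputTape ⟨ x , y ⟩)) e) (at-before-input ⟨ x , y ⟩ i))
        requirement flag t j (refl , i , i<N , refl) = trans (head-cell (i * 2)) (symbols-flag x y i<N)
        requirement one  t j (refl , i , i<N , refl , e) = trans (head-cell (suc (i * 2))) (symbols-first x y true i<N e)
        requirement zer  t j (refl , i , i<N , refl , e) = trans (head-cell (suc (i * 2))) (symbols-first x y false i<N e)
        requirement delimiter t j (refl , refl) = trans (head-cell (N * 2)) (symbols-delimiter x y)
        requirement certificate t j (refl , i , i<P , refl) with symbols-bits y i
        ... | inj₁ (true  , e) = inj₁ (inj₁ (trans (second-head i) e))
        ... | inj₁ (false , e) = inj₁ (inj₂ (trans (second-head i) e))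
        ... | inj₂ (e , e′)    = inj₂ (trans (second-head i) e ,
          -- `beyond` is taken after writing, but this neighbour lies to the right of the head, so
          -- it still shows the input.
          trans (cong head (trans (cong (written (conf 0)) (trans (shift-right (T + (N * 2 + suc i)) T) (cong (_⊝ T) shifted)))
                                  (written-off (conf 0) (⊝-off λ e → <⇒≢ (m<m+n T (subst (0 <_) (sym (+-suc (N * 2) (suc i))) (s≤s z≤n))) (sym e)))))
                (trans (second-head (suc i)) e′))
          where
          shifted : suc (T + (N * 2 + suc i)) ≡ T + (N * 2 + suc (suc i))
          shifted = trans (sym (+-suc T _)) (cong (T +_) (sym (+-suc (N * 2) (suc i))))
        requirement after t j (refl , far) with k , refl ← m≤n⇒∃[o]m+o≡n far =
          trans (cong (λ j → head (cell (conf 0) (j ⊝ T))) shifted)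
                (trans (second-head (P + k)) (symbols-beyond y (≤-trans short (m≤m+n P k))))
          where
          shifted : suc (T + (N * 2 + P)) + k ≡ T + (N * 2 + suc (P + k))
          shifted = trans (cong suc (trans (+-assoc T (N * 2 + P) k) (cong (T +_) (+-assoc (N * 2) P k))))
            (trans (sym (+-suc T _)) (cong (T +_) (sym (+-suc (N * 2) (P + k)))))

        tiling-valid : Valid tiling
        tiling-valid t j t< j< =
          (λ (r , cond , no-ok) → contradiction (trans (cong toNat (sym (ok-complete r (tiling t j)
            (subst (Requirement r) (sym (tile-number (tileOf (conf t) (j ⊝ T)))) (requirement r t j cond))))) no-ok) λ ()) ,
          (λ sj< → okH-complete (tiling t j) (tiling t (suc j))
            (subst₂ Horizontal (sym (tile-number (tileOf (conf t) (j ⊝ T)))) (sym (tile-number (tileOf (conf t) (suc j ⊝ T))))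
            (horizontal refl refl (cong (written (conf t)) (shift-right j T)) (cong (written (conf t)) (sym (shift-left (suc j) T)))))) ,
          (λ st< → okV-complete (tiling t j) (tiling (suc t) j)
            (subst₂ Vertical (sym (tile-number (tileOf (conf t) (j ⊝ T)))) (sym (tile-number (tileOf (conf (suc t)) (j ⊝ T))))
            (vertical refl (cell-advance (conf t) (j ⊝ T)))))

      -- The run of a tiling

      -- `roomy` lets the columns from `T` to `T + T` hold the longest pair with a blank behind it.
      module _ (roomy : suc (suc (N * 2 + P)) ≤ T) (τ : ℕ → ℕ → Fin L) (valid : Valid τ) where

        private
          J : ℕ
          J = suc (T + T)

        θ : ℕ → ℕ → Tile
        θ t j = tile (τ t j)

        obeys : ∀ r {t j} → t < suc T → j < J → Condition r t j → Requirement r (θ t j)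
        obeys r {t} {j} t< j< cond = ok-sound r (τ t j) λ no-ok → proj₁ (valid t j t< j<) (r , cond , no-ok)

        across : ∀ {t j} → t < suc T → suc j < J → Horizontal (θ t j) (θ t (suc j))
        across {t} {j} t< j< = okH-sound (τ t j) (τ t (suc j)) (proj₁ (proj₂ (valid t j t< (<-trans ≤-refl j<))) j<)

        down : ∀ {t j} → suc t < suc T → j < J → Vertical (θ t j) (θ (suc t) j)
        down {t} {j} t< j< = okV-sound (τ t j) (τ (suc t) j) (proj₂ (proj₂ (valid t j (<-trans ≤-refl t<) j<)) t<)

        T<J : T < J
        T<J = s≤s (m≤m+n T T)

        uniform₀ : ∀ {t} → t < suc T → ∀ j → j < J → state (θ t j) ≡ state (θ t 0) × scanned (θ t j) ≡ scanned (θ t 0)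
        uniform₀ t< zero    j< = refl , refl
        uniform₀ t< (suc j) j< =
          let e , f = uniform₀ t< j (<-trans ≤-refl j<) ; h = across t< j< in
          trans (sym (Horizontal.same-state h)) e , trans (sym (Horizontal.same-scanned h)) f

        uniform : ∀ {t j} → t < suc T → j < J → state (θ t j) ≡ state (θ t T) × scanned (θ t j) ≡ scanned (θ t T)
        uniform t< j< = let e , f = uniform₀ t< _ j< ; e′ , f′ = uniform₀ t< T T<J in trans e (sym e′) , trans f (sym f′)

        column : ℕ → ℕ
        column i = T + (N * 2 + suc i)

        column-suc : ∀ i → suc (column i) ≡ column (suc i)
        column-suc i = trans (sym (+-suc T _)) (cong (T +_) (sym (+-suc (N * 2) (suc i))))

        column<J : ∀ {i} → i ≤ P → column i < J
        column<J {i} i≤P = s≤s (+-monoʳ-≤ T (≤-trans (+-monoʳ-≤ (N * 2) (s≤s i≤P))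
          (≤-trans (≤-reflexive (+-suc (N * 2) P)) (≤-trans (n≤1+n _) roomy))))

        T<column : ∀ i → T < column i
        T<column i = m<m+n T (subst (0 <_) (sym (+-suc (N * 2) i)) (s≤s z≤n))

        spelling : ℕ → Sym
        spelling i = head (here (θ 0 (column i)))

        y : List Bool
        y = spelled spelling P

        length-y : length y ≤ P
        length-y = length-spelled spelling P

        beyond-spelling : ∀ {i} → i < P → head (beyond (θ 0 (column i))) ≡ spelling (suc i)
        beyond-spelling {i} i<P = cong head (trans
          (trans (Horizontal.rightwards (across (s≤s z≤n) (subst (_< J) (sym (column-suc i)) (column<J i<P))))
                 (cong (λ j → after′ (θ 0 j)) (column-suc i)))
          (obeys beside (s≤s z≤n) (column<J i<P) (inj₂ (T<column (suc i)))))

        symbols-y : ∀ i → i ≤ P → symbols y i ≡ spelling i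
        symbols-y = symbols-spelled spelling P cert end
          where
          cert : ∀ i → i < P → (∃[ b ] spelling i ≡ bit b) ⊎ (spelling i ≡ blank × spelling (suc i) ≡ blank)
          cert i i<P with obeys certificate (s≤s z≤n) (column<J (<⇒≤ i<P)) (refl , i , i<P , refl)
          ... | inj₁ (inj₁ e)  = inj₁ (true , e)
          ... | inj₁ (inj₂ e)  = inj₁ (false , e)
          ... | inj₂ (e , e′) = inj₂ (e , trans (sym (beyond-spelling i<P)) e′)
          end : spelling P ≡ blank
          end = obeys after (s≤s z≤n) (column<J ≤-refl) (refl , +-monoʳ-< T (+-monoʳ-< (N * 2) ≤-refl))

        w : List Bool
        w = ⟨ x , y ⟩

        conf′ : ℕ → Config
        conf′ = history (initial w)

        -- A position is a flag, a bit of `x`, the delimiter, or belongs to `y` and what follows it;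
        -- separate rules settle these cases.
        first-head : ∀ i → T + i < J → head (here (θ 0 (T + i))) ≡ symbols w i
        first-head i i< with <-cmp i (N * 2)
        ... | tri≈ _ refl _ = trans (obeys delimiter (s≤s z≤n) i< (refl , refl)) (sym (symbols-delimiter x y))
        ... | tri< lt _ _ with half N lt
        ...   | k , k< , inj₁ refl = trans (obeys flag (s≤s z≤n) i< (refl , k , k< , refl)) (sym (symbols-flag x y k<))
        ...   | k , k< , inj₂ refl with bitAt x k in e | bitAt≤1 x k
        ...     | .0 | z≤n     = trans (obeys zer (s≤s z≤n) i< (refl , k , k< , refl , e)) (sym (symbols-first x y false k< e))
        ...     | .1 | s≤s z≤n = trans (obeys one (s≤s z≤n) i< (refl , k , k< , refl , e)) (sym (symbols-first x y true k< e))
        first-head i i< | tri> _ _ gt with k , refl ← m≤n⇒∃[o]m+o≡n gt = trans (cong (λ i → head (here (θ 0 (T + i)))) (sym (+-suc (N * 2) k)))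
          (trans (later k (subst (λ i → T + i < J) (sym (+-suc (N * 2) k)) i<))
          (trans (sym (symbols-second x y k)) (cong (symbols w) (+-suc (N * 2) k))))
          where
          later : ∀ k → column k < J → spelling k ≡ symbols y k
          later k k< with k ≤? P
          ... | yes k≤P = sym (symbols-y k k≤P)
          ... | no ¬k≤P = trans
            (obeys after (s≤s z≤n) k< (refl , +-monoʳ-< T (+-monoʳ-< (N * 2) (m≤n⇒m≤1+n (≰⇒> ¬k≤P)))))
            (sym (symbols-beyond y (≤-trans length-y (<⇒≤ (≰⇒> ¬k≤P)))))

        -- Information travels one column per row, so row t is known to be
        -- right from column t to column 2 T - t.
        record Agrees (t : ℕ) : Set where
          field
            state-agrees : state (θ t T) ≡ Config.state (conf′ t)
            cell-agrees  : ∀ j → t ≤ j → j + t ≤ T + T → here (θ t j) ≡ cell (conf′ t) (j ⊝ T)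

        head-tail : ∀ {u v : Cell} → head u ≡ head v → tail u ≡ tail v → u ≡ v
        head-tail {a ∷ u} {b ∷ v} refl refl = refl

        agrees-initially : Agrees 0
        agrees-initially = record
          { state-agrees = proj₁ (obeys opening (s≤s z≤n) T<J refl)
          ; cell-agrees  = λ j _ j≤ → let j< = s≤s (subst (_≤ T + T) (+-identityʳ j) j≤) in
              head-tail (trans (first j j<) (sym (cong head (cell-initial w (j ⊝ T)))))
                        (trans (proj₂ (obeys opening (s≤s z≤n) j< refl)) (sym (cong tail (cell-initial w (j ⊝ T))))) }
          where
          first : ∀ j → j < J → head (here (θ 0 j)) ≡ at (inputTape w) (j ⊝ T)
          first j j< with T ≤? j
          ... | yes T≤j with i , refl ← m≤n⇒∃[o]m+o≡n T≤j =
                trans (first-head i j<) (sym (trans (cong (at (inputTape w)) (⊝-+ T i)) (at-input w i)))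
          ... | no ¬T≤j with i , e ← ⊝-< (≰⇒> ¬T≤j) =
                trans (obeys ahead (s≤s z≤n) j< (refl , ≰⇒> ¬T≤j))
                      (sym (trans (cong (at (inputTape w)) e) (at-before-input w i)))

        agrees-next : ∀ {t} → t < T → Agrees t → Agrees (suc t)
        agrees-next {t} t<T A = record
          { state-agrees = trans (Vertical.next-state (down (s≤s t<T) T<J)) (cong₂ successor state-agrees scanned-agrees)
          ; cell-agrees  = onwards }
          where
          open Agrees A
          t< : t < suc T
          t< = m≤n⇒m≤1+n t<T
          c = conf′ t

          -- `centre` ties the scanned symbols to the cell in column `T`, which is in the range
          -- known to be right because `t ≤ T`.
          scanned-agrees : scanned (θ t T) ≡ scanOf c
          scanned-agrees = trans (sym (proj₁ (obeys centre t< T<J refl)))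
            (trans (cell-agrees T (<⇒≤ t<T) (+-monoʳ-≤ T (<⇒≤ t<T))) (trans (cong (cell c) (⊝-diag T)) (cell-0 c)))

          inside : ∀ {j} → j + t ≤ T + T → j < J
          inside {j} h = s≤s (≤-trans (m≤m+n j t) h)

          written-agrees : ∀ j → t ≤ j → j + t ≤ T + T → after′ (θ t j) ≡ written c (j ⊝ T)
          written-agrees j t≤j h with <-cmp j T
          ... | tri≈ _ refl _ = trans (proj₂ (obeys centre t< (inside h) refl))
            (trans (cong (Vec.map proj₁) (cong₂ action state-agrees scanned-agrees))
            (trans (sym (written-0 c)) (cong (written c) (sym (⊝-diag T)))))
          ... | tri< lt _ _ = trans (obeys beside t< (inside h) (inj₁ lt))
            (trans (cell-agrees j t≤j h) (sym (written-off c (⊝-off (<⇒≢ lt)))))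
          ... | tri> _ _ gt = trans (obeys beside t< (inside h) (inj₂ gt))
            (trans (cell-agrees j t≤j h) (sym (written-off c (⊝-off (<⇒≢ gt ∘ sym)))))

          onwards : ∀ j → suc t ≤ j → j + suc t ≤ T + T → here (θ (suc t) j) ≡ cell (advance c) (j ⊝ T)
          onwards (suc j) (s≤s t≤j) h = trans (Vertical.next-cell (down (s≤s t<T) sj<))
            (trans (cong-moved (cong₂ action (trans (proj₁ same) state-agrees) (trans (proj₂ same) scanned-agrees)) before≡ after≡ beyond≡)
                   (sym (cell-advance c (suc j ⊝ T))))
            where
            h′ : suc (suc j) + t ≤ T + T
            h′ = subst (_≤ T + T) (cong suc (+-suc j t)) h
            sj< : suc j < J
            sj< = inside (≤-trans (n≤1+n _) h′)
            same = uniform t< sj<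
            before≡ : before (θ t (suc j)) ≡ written c (shift left (suc j ⊝ T))
            before≡ = trans (sym (Horizontal.leftwards (across t< sj<)))
              (trans (written-agrees j t≤j (≤-trans (≤-trans (n≤1+n _) (n≤1+n _)) h′)) (cong (written c) (sym (shift-left (suc j) T))))
            after≡ : after′ (θ t (suc j)) ≡ written c (suc j ⊝ T)
            after≡ = written-agrees (suc j) (m≤n⇒m≤1+n t≤j) (≤-trans (n≤1+n _) h′)
            beyond≡ : beyond (θ t (suc j)) ≡ written c (shift right (suc j ⊝ T))
            beyond≡ = trans (Horizontal.rightwards (across t< (inside h′)))
              (trans (written-agrees (suc (suc j)) (m≤n⇒m≤1+n (m≤n⇒m≤1+n t≤j)) h′) (cong (written c) (sym (shift-right (suc j) T))))
            cong-moved : ∀ {a a′ l l′ m m′ r r′} → a ≡ a′ → l ≡ l′ → m ≡ m′ → r ≡ r′ → moved a l m r ≡ moved a′ l′ m′ r′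
            cong-moved refl refl refl refl = refl

        agrees : ∀ t → t ≤ T → Agrees t
        agrees zero    _   = agrees-initially
        agrees (suc t) t<T = agrees-next t<T (agrees t (<⇒≤ t<T))

        accepts : Accepts (conf′ T)
        accepts = trans (cong accepting (sym (Agrees.state-agrees (agrees T ≤-refl)))) (obeys final ≤-refl T<J refl)

-- Comparing encodings; the edges of the tiling graph as a formula.

module Reductions where

  open Expressions
  open Commands
  open Formulas
  open Encodings
  open Orientations
  open Membership
  open DartGraphs
  open Colourings
  open Tilings using (module Tiling)
  open Tableaux

  encoding-size : ∀ {n n′} f f′ → encoding n f ≡ encoding n′ f′ → n ≡ n′
  encoding-size {n} {n′} f f′ eq with <-cmp n n′
  ... | tri≈ _ e _ = e
  ... | tri< lt _ _ with () ← trans (sym (encoding-zero n f)) (trans (cong (λ x → bitAt x n) eq) (encoding-one n′ f′ lt))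
  ... | tri> _ _ gt with () ← trans (sym (encoding-zero n′ f′)) (trans (cong (λ x → bitAt x n′) (sym eq)) (encoding-one n f gt))

  encode-extend : ∀ {n} (G : Graph n) → encode G ≡ encoding n (extend (Graph.adj G))
  encode-extend G = encode-encoding G _ (λ u v → sym (extend-toℕ (Graph.adj G) u v))

  encode-adj : ∀ {n} (G H : Graph n) → encode G ≡ encode H → ∀ u v → Graph.adj G u v ≡ Graph.adj H u v
  encode-adj {n} G H eq u v = toNat-injective (trans (entry G) (trans (cong (λ x → bitAt x _) eq) (sym (entry H))))
    where
    entry : (G : Graph n) → toNat (Graph.adj G u v) ≡ bitAt (encode G) (n + suc (n * toℕ u + toℕ v))
    entry G = sym (trans (cong (λ x → bitAt x (n + suc (n * toℕ u + toℕ v))) (encode-extend G))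
      (trans (encoding-entry n _ (toℕ<n u) (toℕ<n v)) (cong toNat (extend-toℕ (Graph.adj G) u v))))

  transfer : ∀ {n} (G H : Graph n) → (∀ u v → Graph.adj G u v ≡ Graph.adj H u v) →
    (Σ[ D ∈ Orientation G ] Balanced D) → Σ[ D ∈ Orientation H ] Balanced D
  transfer G H eq (D , range , distinct) =
    record { arc        = arc
           ; arc⇒edge   = λ u v a → trans (sym (eq u v)) (arc⇒edge u v a)
           ; exactlyOne = λ u v e → exactlyOne u v (trans (eq u v) e) } ,
    range , λ u v e → distinct u v (trans (eq u v) e)
    where open Orientation D

  -- `Target` speaks of some graph with the given encoding. It has the size of `G` and pointwise the
  -- same adjacency, so `transfer` carries its orientations over.
  target-encode : ∀ {n} (G : Graph n) → Regular 4 G → Target (encode G) ⇔ (Σ[ D ∈ Orientation G ] Balanced D)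
  target-encode {n} G regular = mk⇔ to λ b → n , G , regular , proj₂ (balanced⇔ regular) b , refl
    where
    to : Target (encode G) → Σ[ D ∈ Orientation G ] Balanced D
    to (n′ , G′ , regular′ , number , eq)
      with refl ← encoding-size (extend (Graph.adj G′)) (extend (Graph.adj G)) (trans (sym (encode-extend G′)) (trans (sym eq) (encode-extend G)))
      = transfer G′ G (encode-adj G′ G (sym eq)) (proj₁ (balanced⇔ regular′) number)

  target-darts : ∀ {V n} (numbering : Numbering V n) (darts : Darts V) → let open DartGraph numbering darts in
    Target (encode graph) ⇔ (Σ[ D ∈ Orientation graph ] Balanced D)
  target-darts numbering darts = target-encode _ (DartGraph.regular numbering darts)

  polynomial : ∀ {n} → Polynomial → Expr n → Expr n
  polynomial X        e = e
  polynomial (con k)  e = con k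
  polynomial (p :+ q) e = polynomial p e ⊕ polynomial q e
  polynomial (p :* q) e = polynomial p e ⊗ polynomial q e

  eval-polynomial : ∀ {n} w p (e : Expr n) ρ → eval w (polynomial p e) ρ ≡ ⟦ p ⟧ (eval w e ρ)
  eval-polynomial w X        e ρ = refl
  eval-polynomial w (con k)  e ρ = refl
  eval-polynomial w (p :+ q) e ρ = cong₂ _+_ (eval-polynomial w p e ρ) (eval-polynomial w q e ρ)
  eval-polynomial w (p :* q) e ρ = cong₂ _*_ (eval-polynomial w p e ρ) (eval-polynomial w q e ρ)

  polynomial-mono : ∀ p {m n} → m ≤ n → ⟦ p ⟧ m ≤ ⟦ p ⟧ n
  polynomial-mono X        h = h
  polynomial-mono (con k)  h = ≤-refl
  polynomial-mono (p :+ q) h = +-mono-≤ (polynomial-mono p h) (polynomial-mono q h)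
  polynomial-mono (p :* q) h = *-mono-≤ (polynomial-mono p h) (polynomial-mono q h)

  true? : ∀ w {n} (φ : Formula n) ρ → Dec (True w φ ρ)
  true? w φ ρ = map′ (Equivalence.to (truth-correct w φ ρ)) (Equivalence.from (truth-correct w φ ρ)) (0 <? eval w (truth φ) ρ)

  positive-truth : ∀ w {n} (φ : Formula n) ρ → positive (eval w (truth φ) ρ) ≡ true ⇔ True w φ ρ
  positive-truth w φ ρ = mk⇔
    (λ e → Equivalence.to (truth-correct w φ ρ) (>0 (eval w (truth φ) ρ) e))
    (λ t → positive-> (Equivalence.from (truth-correct w φ ρ) t))
    where
    >0 : ∀ n → positive n ≡ true → 0 < n
    >0 (suc n) e = s≤s z≤n
    positive-> : ∀ {n} → 0 < n → positive n ≡ true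
    positive-> (s≤s z≤n) = refl

  bool-ext : ∀ {a b : Bool} → (a ≡ true ⇔ b ≡ true) → a ≡ b
  bool-ext {false} {false} e = refl
  bool-ext {true}  {true}  e = refl
  bool-ext {false} {true}  e = Equivalence.from e refl
  bool-ext {true}  {false} e = sym (Equivalence.to e refl)

  rule : Fin 11 → Rule
  rule = lookup (centre ∷ beside ∷ final ∷ opening ∷ ahead ∷ flag ∷ one ∷ zer ∷ delimiter ∷ certificate ∷ after ∷ [])

  rule-index : ∀ r → ∃[ i ] rule i ≡ r
  rule-index centre      = # 0 , refl
  rule-index beside      = # 1 , refl
  rule-index final       = # 2 , refl
  rule-index opening     = # 3 , refl
  rule-index ahead       = # 4 , refl
  rule-index flag        = # 5 , refl
  rule-index one         = # 6 , refl
  rule-index zer         = # 7 , refl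
  rule-index delimiter   = # 8 , refl
  rule-index certificate = # 9 , refl
  rule-index after       = # 10 , refl

  module Reduction (M : TM) where

    open Tableau M using (K; ok; okH; okV; module Instance)

    -- Variables for the length of the input, the bound on the certificate
    -- and the number of steps.
    module _ {k} (N P T t j : Fin k) where

      condition : Rule → Formula k
      condition centre      = var j ≐ var T
      condition beside      = var j ≺ var T ∨ var T ≺ var j
      condition final       = var t ≐ var T
      condition opening     = var t ≐ con 0
      condition ahead       = var t ≐ con 0 ∧ var j ≺ var T
      condition flag        = var t ≐ con 0 ∧ ∃< (var N) (var (suc j) ≐ var (suc T) ⊕ v₀ ⊗ con 2)
      condition one         = var t ≐ con 0 ∧ ∃< (var N) (var (suc j) ≐ var (suc T) ⊕ (con 1 ⊕ v₀ ⊗ con 2) ∧ inp v₀ ≐ con 1)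
      condition zer         = var t ≐ con 0 ∧ ∃< (var N) (var (suc j) ≐ var (suc T) ⊕ (con 1 ⊕ v₀ ⊗ con 2) ∧ inp v₀ ≐ con 0)
      condition delimiter   = var t ≐ con 0 ∧ var j ≐ var T ⊕ var N ⊗ con 2
      condition certificate = var t ≐ con 0 ∧ ∃< (var P) (var (suc j) ≐ var (suc T) ⊕ (var (suc N) ⊗ con 2 ⊕ (con 1 ⊕ v₀)))
      condition after       = var t ≐ con 0 ∧ var T ⊕ (var N ⊗ con 2 ⊕ var P) ≺ var j

    L width : ℕ
    L     = suc (suc K * 2)
    width = L + L

    columns : ∀ {k} → Fin k → Expr k
    columns T = con 1 ⊕ (var T ⊕ var T)

    codeE : ∀ {k} → Fin k → Expr k → Expr k → ℕ → Expr k
    codeE T t j a = con 3 ⊕ (con width ⊗ (columns T ⊗ t ⊕ j) ⊕ con a)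

    Edge : List Bool → ℕ → ℕ → ℕ → ℕ → Set
    Edge x P T = Tiling.Edge K (suc T) (T + T) (Instance.Forbidden x P T) okH okV

    -- Truth of these formulas unfolds literally to the conditions once the variable for the length
    -- has its value; hence an equality of types.
    condition-true : ∀ x {k} (ρ : Vec ℕ k) N P T t j → lookup ρ N ≡ length x → ∀ r →
      True x (condition N P T t j r) ρ ≡ Instance.Condition x (lookup ρ P) (lookup ρ T) r (lookup ρ t) (lookup ρ j)
    condition-true x ρ N P T t j N≡ centre      = refl
    condition-true x ρ N P T t j N≡ beside      = refl
    condition-true x ρ N P T t j N≡ final       = refl
    condition-true x ρ N P T t j N≡ opening     = refl
    condition-true x ρ N P T t j N≡ ahead       = refl
    condition-true x ρ N P T t j N≡ flag        rewrite N≡ = refl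
    condition-true x ρ N P T t j N≡ one         rewrite N≡ = refl
    condition-true x ρ N P T t j N≡ zer         rewrite N≡ = refl
    condition-true x ρ N P T t j N≡ delimiter   rewrite N≡ = refl
    condition-true x ρ N P T t j N≡ certificate rewrite N≡ = refl
    condition-true x ρ N P T t j N≡ after       rewrite N≡ = refl

    abstract

      edgeF : ∀ {k} (N P T u v : Fin k) → Formula k
      edgeF {k} N P T u v =
        var u ≐ con 0 ∧ var v ≐ con 1 ∨ var u ≐ con 0 ∧ var v ≐ con 2 ∨ var u ≐ con 1 ∧ var v ≐ con 2 ∨
        ∃< (con 1 ⊕ var T) (∃< (columns (suc T)) cellF)
        where
        y z : Expr (2 + k)
        y = var (suc (suc u))
        z = var (suc (suc v))
        T′ : Fin (2 + k)
        T′ = suc (suc T)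
        xF vF : Expr (2 + k) → Expr (2 + k) → Fin L → Expr (2 + k)
        xF t j a = codeE T′ t j (toℕ a)
        vF t j a = codeE T′ t j (L + toℕ a)

        cellF : Formula (2 + k)
        cellF =
          ⋁ L (λ a → y ≐ xF v₁ v₀ a ∧
            (∃< (con 1 ⊕ (v₁ ⊕ v₀)) (v₂ ⊕ v₁ ≐ v₀ ⊗ con 2 ∧ var (suc (suc (suc v))) ≐ con 2) ∨
             ∃< (con 1 ⊕ (v₁ ⊕ v₀)) (v₂ ⊕ v₁ ≐ con 1 ⊕ v₀ ⊗ con 2 ∧ var (suc (suc (suc v))) ≐ con 1))) ∨
          ⋁ L (λ a → y ≐ xF v₁ v₀ a ∧ z ≐ vF v₁ v₀ a) ∨
          ⋁ L (λ a → y ≐ vF v₁ v₀ a ∧ z ≐ vF v₁ v₀ (succ a)) ∨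
          ⋁ L (λ a → ⋁ 11 (λ i → condition (suc (suc N)) (suc (suc P)) T′ (suc zero) zero (rule i) ∧
                                 con (toNat (ok (rule i) a)) ≐ con 0) ∧
                     y ≐ xF v₁ v₀ a ∧ z ≐ con 0) ∨
          con 1 ⊕ v₀ ≺ columns T′ ∧ ⋁ L (λ a → ⋁ L (λ b → con (toNat (okH a b)) ≐ con 0 ∧
            y ≐ xF v₁ v₀ a ∧ z ≐ xF v₁ (con 1 ⊕ v₀) b)) ∨
          con 1 ⊕ v₁ ≺ con 1 ⊕ var T′ ∧ ⋁ L (λ a → ⋁ L (λ b → con (toNat (okV a b)) ≐ con 0 ∧
            y ≐ xF v₁ v₀ a ∧ z ≐ xF (con 1 ⊕ v₁) v₀ b))

      -- The clauses unfold to those of the tiling graph, where conflicts are stated as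
      -- `toNat b ≡ 0` to this end. Only the forbidden tiles take work, since the formula ranges
      -- over rules by their index.
      edge-true : ∀ x {k} (ρ : Vec ℕ k) N P T u v → lookup ρ N ≡ length x →
        True x (edgeF N P T u v) ρ ⇔ Edge x (lookup ρ P) (lookup ρ T) (lookup ρ u) (lookup ρ v)
      edge-true x ρ N P T u v N≡ = mk⇔
        (Sum.map₂ (Sum.map₂ (Sum.map₂ λ (t , t< , j , j< , e) → t , t< , j , j< ,
          Sum.map₂ (Sum.map₂ (Sum.map₂ (Sum.map₁ λ (a , (i , c , bad) , e) →
            a , (rule i , subst id (condition-true x (j ∷ t ∷ ρ) _ _ _ _ _ N≡ (rule i)) c , bad) , e))) e)))
        (Sum.map₂ (Sum.map₂ (Sum.map₂ λ (t , t< , j , j< , e) → t , t< , j , j< ,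
          Sum.map₂ (Sum.map₂ (Sum.map₂ (Sum.map₁ λ (a , (r , c , bad) , e) →
            a , forbidden t j r c bad , e))) e)))
        where
        forbidden : ∀ t j {a} r → Instance.Condition x (lookup ρ P) (lookup ρ T) r t j → toNat (ok r a) ≡ 0 →
          True x (⋁ 11 (λ i → condition (suc (suc N)) (suc (suc P)) (suc (suc T)) (suc zero) zero (rule i) ∧
                              con (toNat (ok (rule i) a)) ≐ con 0)) (j ∷ t ∷ ρ)
        forbidden t j r c bad with i , refl ← rule-index r =
          i , subst id (sym (condition-true x (j ∷ t ∷ ρ) _ _ _ _ _ N≡ (rule i))) c , bad

-- The reduction and its correctness.

module Hardness where

  open Expressions
  open Commands
  open Formulas
  open Encodings
  open Orientations
  open Membership
  open DartGraphs
  open Cells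
  open Colourings
  open Tilings using (module Tiling; toℕ-succ)
  open Tableaux
  open Reductions

  -- The cyclic successor in arithmetic terms, with `m` the length of the cycle.
  IsSucc : ℕ → ℕ → ℕ → Set
  IsSucc m a b = (b ≡ 0 × suc a ≡ m) ⊎ b ≡ suc a

  succ⇔ : ∀ {m} (a b : Fin (suc m)) → IsSucc (suc m) (toℕ a) (toℕ b) ⇔ b ≡ succ a
  succ⇔ {m} a b = mk⇔ to from
    where
    to : IsSucc (suc m) (toℕ a) (toℕ b) → b ≡ succ a
    to h with toℕ-succ a
    to (inj₁ (b≡0 , _)) | inj₁ (_ , wrap) = toℕ-injective (trans b≡0 (sym wrap))
    to (inj₁ (_ , e))   | inj₂ up = contradiction (trans up e) (<⇒≢ (toℕ<n (succ a)))
    to (inj₂ e)         | inj₁ (last , _) = contradiction (trans e (cong suc last)) (<⇒≢ (toℕ<n b))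
    to (inj₂ e)         | inj₂ up = toℕ-injective (trans e (sym up))
    from : b ≡ succ a → IsSucc (suc m) (toℕ a) (toℕ b)
    from refl with toℕ-succ a
    ... | inj₁ (last , wrap) = inj₁ (wrap , cong suc last)
    ... | inj₂ up            = inj₂ up

  repeat-Fin : ∀ {A : Set} n (f g : ℕ → List A) → (∀ (i : Fin n) → f (toℕ i) ≡ g (toℕ i)) → repeat n f ≡ repeat n g
  repeat-Fin n f g h = repeat-cong n λ i i<n →
    subst (λ i → f i ≡ g i) (toℕ-fromℕ< i<n) (h (fromℕ< i<n))

  module _ (m c : ℕ) where

    position : ℕ → ℕ → ℕ → ℕ
    position u v k = (m * c) * u + (c * v + k)

    repeat³ : (ℕ → ℕ → ℕ → List Bool) → List Bool
    repeat³ f = repeat m λ u → repeat m λ v → repeat c λ k → f u v k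

    repeat³-cong : ∀ f g → (∀ (u v : Fin m) (k : Fin c) → f (toℕ u) (toℕ v) (toℕ k) ≡ g (toℕ u) (toℕ v) (toℕ k)) →
      repeat³ f ≡ repeat³ g
    repeat³-cong f g eq =
      repeat-Fin m (λ u → repeat m λ v → repeat c λ k → f u v k) (λ u → repeat m λ v → repeat c λ k → g u v k) λ u →
      repeat-Fin m (λ v → repeat c λ k → f (toℕ u) v k) (λ v → repeat c λ k → g (toℕ u) v k) λ v →
      repeat-Fin c (f (toℕ u) (toℕ v)) (g (toℕ u) (toℕ v)) (eq u v)

    repeat-position : (f : ℕ → List Bool) → repeat (m * (m * c)) f ≡ repeat³ λ u v k → f (position u v k)
    repeat-position f =
      trans (cong (λ n → repeat n f) (*-comm m (m * c)))
      (trans (repeat-* (m * c) m f)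
      (repeat-cong m λ u _ → trans (cong (λ n → repeat n λ j → f ((m * c) * u + j)) (*-comm m c))
        (repeat-* c m λ j → f ((m * c) * u + j))))

    module _ (f : ℕ → ℕ → Bool) (g : ℕ → ℕ → ℕ → ℕ → ℕ → ℕ → Bool)
      (eq : ∀ (u v : Fin m) (k : Fin c) (u′ v′ : Fin m) (k′ : Fin c) →
        f (position (toℕ u) (toℕ v) (toℕ k)) (position (toℕ u′) (toℕ v′) (toℕ k′)) ≡
        g (toℕ u) (toℕ v) (toℕ k) (toℕ u′) (toℕ v′) (toℕ k′)) where

      -- Both vertices of a matrix entry are split into coordinates, so six nested loops print the
      -- matrix.
      rows-repeat : rows (m * (m * c)) f ≡ repeat³ λ u v k → repeat³ λ u′ v′ k′ → g u v k u′ v′ k′ ∷ []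
      rows-repeat = trans
        (repeat-position (λ a → repeat (m * (m * c)) λ b → f a b ∷ []))
        (repeat³-cong (λ u v k → repeat (m * (m * c)) λ b → f (position u v k) b ∷ [])
                      (λ u v k → repeat³ λ u′ v′ k′ → g u v k u′ v′ k′ ∷ []) λ u v k →
          trans (repeat-position (λ b → f (position (toℕ u) (toℕ v) (toℕ k)) b ∷ []))
          (repeat³-cong (λ u′ v′ k′ → f (position (toℕ u) (toℕ v) (toℕ k)) (position u′ v′ k′) ∷ [])
                        (λ u′ v′ k′ → g (toℕ u) (toℕ v) (toℕ k) u′ v′ k′ ∷ [])
                        (λ u′ v′ k′ → cong (_∷ []) (eq u v k u′ v′ k′))))

  module Construction (M : TM) (p q : Polynomial) where

    open Tableau M using (K; okH; okV; module Instance)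
    open Reduction M

    certificateE : Expr 1
    certificateE = polynomial p v₀

    -- The time bound at the length `2N + 1 + P` of the longest pair, plus the room that `roomy`
    -- demands beside column `T`.
    timeE : Expr 2
    timeE = polynomial q (v₁ ⊗ con 2 ⊕ (con 1 ⊕ v₀)) ⊕ (con 2 ⊕ (v₁ ⊗ con 2 ⊕ v₀))

    -- The size of the tiling graph: a triangle, and `width` nodes for each of `2T + 1` columns in
    -- `T + 1` rows.
    verticesE : Expr 3
    verticesE = con 3 ⊕ con width ⊗ (columns zero ⊗ (con 1 ⊕ v₀))

    SymEdge : List Bool → ℕ → ℕ → ℕ → ℕ → Set
    SymEdge x P T u v = Edge x P T u v ⊎ Edge x P T v u

    abstract

      -- Edges are listed in one direction, hence the symmetric closure. It is decidable because
      -- formulas express both directions.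
      symEdge? : ∀ x P T u v → Dec (SymEdge x P T u v)
      symEdge? x P T u v = map′
        (Sum.map (Equivalence.to (edge-true x ρ (# 4) (# 3) (# 2) (# 1) (# 0) refl)) (Equivalence.to (edge-true x ρ (# 4) (# 3) (# 2) (# 0) (# 1) refl)))
        (Sum.map (Equivalence.from (edge-true x ρ (# 4) (# 3) (# 2) (# 1) (# 0) refl)) (Equivalence.from (edge-true x ρ (# 4) (# 3) (# 2) (# 0) (# 1) refl)))
        (true? x (edgeF (# 4) (# 3) (# 2) (# 1) (# 0) ∨ edgeF (# 4) (# 3) (# 2) (# 0) (# 1)) ρ)
        where
        ρ : Vec ℕ 5
        ρ = v ∷ u ∷ T ∷ P ∷ length x ∷ []

    isSuccF : ∀ {k} (m a b : Fin k) → Formula k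
    isSuccF m a b = var b ≐ con 0 ∧ con 1 ⊕ var a ≐ var m ∨ var b ≐ con 1 ⊕ var a

    -- The context of the adjacency formula consists of the coordinates k,
    -- v, u of two vertices, m, T, P and N.
    gotoF : Direction → Formula 10
    gotoF same  = v₂ ≐ v₅ ∧ v₁ ≐ v₄
    gotoF next  = v₂ ≐ v₅ ∧ isSuccF (# 6) (# 4) (# 1)
    gotoF prev  = v₂ ≐ v₅ ∧ isSuccF (# 6) (# 1) (# 4)
    gotoF cross = v₂ ≐ v₄ ∧ v₁ ≐ v₅

    neighbourF : Bool → Node → Fin 4 → Formula 10
    neighbourF b k i = gotoF (direction b k i) ∧ v₀ ≐ con (toℕ (target b k i))

    hF : Formula 10
    hF = edgeF (# 9) (# 8) (# 7) (# 5) (# 4) ∨ edgeF (# 9) (# 8) (# 7) (# 4) (# 5)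

    abstract

      adjacentF : Formula 10
      adjacentF = ⋁ 21 λ k → v₃ ≐ con (toℕ k) ∧ ⋁ 4 λ i →
        -- The kind of the cell is known only from the input, so both tables occur;
        -- `hF ⇒ con 0 ≐ con 1` is the negation of `hF`.
        hF ∧ neighbourF true k i ∨ (hF ⇒ con 0 ≐ con 1) ∧ neighbourF false k i

    bits : List Bool → (m T P u v k u′ v′ k′ : ℕ) → Bool
    bits x m T P u v k u′ v′ k′ =
      positive (eval x (truth adjacentF) (k′ ∷ v′ ∷ u′ ∷ k ∷ v ∷ u ∷ m ∷ T ∷ P ∷ length x ∷ []))

    abstract

      encodingC : ℕ → Command 4
      encodingC c =
        for (v₀ ⊗ (v₀ ⊗ con c)) (print (con 1)) ⨟ print (con 0) ⨟
        for v₀ (for v₁ (for (con c) (for v₃ (for v₄ (for (con c) (print (truth adjacentF)))))))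

      printed-encoding : ∀ x c m T P f →
        (∀ (u v : Fin m) (k : Fin c) (u′ v′ : Fin m) (k′ : Fin c) →
          f (position m c (toℕ u) (toℕ v) (toℕ k)) (position m c (toℕ u′) (toℕ v′) (toℕ k′)) ≡
          bits x m T P (toℕ u) (toℕ v) (toℕ k) (toℕ u′) (toℕ v′) (toℕ k′)) →
        printed x (encodingC c) (m ∷ T ∷ P ∷ length x ∷ []) ≡ encoding (m * (m * c)) f
      printed-encoding x c m T P f eq = cong₂ (λ a b → a ++ false ∷ b) (repeat-true (m * (m * c)))
        (sym (rows-repeat m c f (bits x m T P) eq))

    program : Command 1
    program = bind certificateE (bind timeE (bind verticesE (encodingC 21)))

    module Printing (x : List Bool) (P T m′ : ℕ) (h : Fin (suc m′) → Fin (suc m′) → Bool)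
      (h-symmetric : ∀ u v → h u v ≡ h v u) (h-irreflexive : ∀ u → h u u ≡ false)
      (h⇔ : ∀ u v → h u v ≡ true ⇔ SymEdge x P T (toℕ u) (toℕ v)) where

      open Gadget m′ h h-symmetric h-irreflexive renaming (to to hop)

      goto-true : ∀ d (u v u′ v′ : Fin m) k k′ →
        True x (gotoF d) (k′ ∷ toℕ v′ ∷ toℕ u′ ∷ k ∷ toℕ v ∷ toℕ u ∷ m ∷ T ∷ P ∷ length x ∷ []) ⇔ goto d (u , v) ≡ (u′ , v′)
      goto-true same u v u′ v′ k k′ = mk⇔
        (λ (e , e′) → cong₂ _,_ (toℕ-injective (sym e)) (toℕ-injective (sym e′)))
        (λ { refl → refl , refl })
      goto-true next u v u′ v′ k k′ = mk⇔
        (λ (e , e′) → cong₂ _,_ (toℕ-injective (sym e)) (sym (Equivalence.to (succ⇔ v v′) e′)))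
        (λ { refl → refl , Equivalence.from (succ⇔ v v′) refl })
      goto-true prev u v u′ v′ k k′ = mk⇔
        (λ (e , e′) → cong₂ _,_ (toℕ-injective (sym e)) (trans (cong pred (Equivalence.to (succ⇔ v′ v) e′)) (pred-succ v′)))
        (λ { refl → refl , Equivalence.from (succ⇔ v′ v) (sym (succ-pred v)) })
      goto-true cross u v u′ v′ k k′ = mk⇔
        (λ (e , e′) → cong₂ _,_ (toℕ-injective (sym e)) (toℕ-injective (sym e′)))
        (λ { refl → refl , refl })

      module _ (u v u′ v′ : Fin m) (k k′ : Node) where

        private
          ρ : Vec ℕ 10
          ρ = toℕ k′ ∷ toℕ v′ ∷ toℕ u′ ∷ toℕ k ∷ toℕ v ∷ toℕ u ∷ m ∷ T ∷ P ∷ length x ∷ []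

        hF-true : True x hF ρ ⇔ h u v ≡ true
        hF-true = mk⇔
          (λ e → Equivalence.from (h⇔ u v) (Sum.map (Equivalence.to there) (Equivalence.to back′) e))
          (λ e → Sum.map (Equivalence.from there) (Equivalence.from back′) (Equivalence.to (h⇔ u v) e))
          where
          there : True x (edgeF (# 9) (# 8) (# 7) (# 5) (# 4)) ρ ⇔ Edge x P T (toℕ u) (toℕ v)
          there = edge-true x ρ (# 9) (# 8) (# 7) (# 5) (# 4) refl
          back′ : True x (edgeF (# 9) (# 8) (# 7) (# 4) (# 5)) ρ ⇔ Edge x P T (toℕ v) (toℕ u)
          back′ = edge-true x ρ (# 9) (# 8) (# 7) (# 4) (# 5) refl

        Adjacent : Set
        Adjacent = ∃[ i ] neighbour (u , v , k) i ≡ (u′ , v′ , k′)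

        neighbour-true : ∀ b i → h u v ≡ b → True x (neighbourF b k i) ρ ⇔ neighbour (u , v , k) i ≡ (u′ , v′ , k′)
        neighbour-true .(h u v) i refl = mk⇔
          (λ (e , e′) → cong₂ (λ (u , v) k → u , v , k) (Equivalence.to g e) (toℕ-injective (sym e′)))
          (λ e → Equivalence.from g (cong (λ (u , v , k) → u , v) e) , cong (λ (u , v , k) → toℕ k) (sym e))
          where g = goto-true (direction (h u v) k i) u v u′ v′ (toℕ k) (toℕ k′)

        abstract

          adjacent-true : True x adjacentF ρ ⇔ Adjacent
          adjacent-true = mk⇔ to from
            where
            Case : Node → Fin 4 → Set
            Case κ i = (True x hF ρ × True x (neighbourF true κ i) ρ) ⊎
                       ((True x hF ρ → 0 ≡ 1) × True x (neighbourF false κ i) ρ)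

            case : ∀ κ i → k ≡ κ → Case κ i → Adjacent
            case .k i refl (inj₁ (e , nb)) = i , Equivalence.to (neighbour-true true i (Equivalence.to hF-true e)) nb
            case .k i refl (inj₂ (¬e , nb)) = i , Equivalence.to (neighbour-true false i (no-edge (h u v) refl)) nb
              where
              no-edge : ∀ b → h u v ≡ b → h u v ≡ false
              no-edge false eq = eq
              no-edge true  eq = contradiction (¬e (Equivalence.from hF-true eq)) λ ()

            to : True x adjacentF ρ → Adjacent
            to (κ , e , i , a) = case κ i (toℕ-injective e) a

            from : Adjacent → True x adjacentF ρ
            from (i , nb) = k , refl , i , go (h u v) refl
              where
              go : ∀ b → h u v ≡ b → Case k i
              go true  eq = inj₁ (Equivalence.from hF-true eq , Equivalence.from (neighbour-true true i eq) nb)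
              go false eq = inj₂ ((λ e → contradiction (trans (sym eq) (Equivalence.to hF-true e)) λ ()) ,
                                  Equivalence.from (neighbour-true false i eq) nb)

        private
          adjacency : Bool
          adjacency = Graph.adj graph (enc (u , v , k)) (enc (u′ , v′ , k′))

        bit-value : Bool
        bit-value = bits x m T P (toℕ u) (toℕ v) (toℕ k) (toℕ u′) (toℕ v′) (toℕ k′)

        bits⇔ : bit-value ≡ true ⇔ Adjacent
        bits⇔ = ⇔-trans (positive-truth x adjacentF ρ) adjacent-true

        adj-bits : adjacency ≡ bit-value
        adj-bits = bool-ext {adjacency} {bit-value} (⇔-trans (adjacency⇔ (u , v , k) (u′ , v′ , k′)) (⇔-sym bits⇔))

      position-enc : ∀ u v k → toℕ (enc (u , v , k)) ≡ position m 21 (toℕ u) (toℕ v) (toℕ k)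
      position-enc u v k = trans (toℕ-combine u (combine v k)) (cong ((m * 21) * toℕ u +_) (toℕ-combine v k))

      entry-bits : ∀ u v k u′ v′ k′ →
        extend (Graph.adj graph) (position m 21 (toℕ u) (toℕ v) (toℕ k)) (position m 21 (toℕ u′) (toℕ v′) (toℕ k′)) ≡
        bits x m T P (toℕ u) (toℕ v) (toℕ k) (toℕ u′) (toℕ v′) (toℕ k′)
      entry-bits u v k u′ v′ k′ =
        trans (cong₂ (extend (Graph.adj graph)) (sym (position-enc u v k)) (sym (position-enc u′ v′ k′)))
        (trans (extend-toℕ (Graph.adj graph) (enc (u , v , k)) (enc (u′ , v′ , k′)))
               (adj-bits u v u′ v′ k k′))

      printed-encode : printed x (encodingC 21) (m ∷ T ∷ P ∷ length x ∷ []) ≡ encode graph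
      printed-encode = trans (printed-encoding x 21 m T P (extend (Graph.adj graph)) entry-bits) (sym (encode-extend graph))

      target-graph : Target (encode graph) ⇔ Colouring h
      target-graph = ⇔-trans (target-darts numbering darts) (mk⇔ balanced⇒colouring colouring⇒balanced)

      target-printed : Target (printed x (encodingC 21) (m ∷ T ∷ P ∷ length x ∷ [])) ⇔ Colouring h
      target-printed = subst (λ w → Target w ⇔ Colouring h) (sym printed-encode) target-graph

    module Correctness (x : List Bool) (P T m′ : ℕ)
      (m≡ : suc m′ ≡ Tiling.m K (suc T) (T + T) (Instance.Forbidden x P T) okH okV) where

      private
        N : ℕ
        N = length x

        module I = Instance x P T
        module C = Tiling K (suc T) (T + T) I.Forbidden okH okV

      h : Fin (suc m′) → Fin (suc m′) → Bool
      h u v = does (symEdge? x P T (toℕ u) (toℕ v))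

      h-symmetric : ∀ u v → h u v ≡ h v u
      h-symmetric u v = does-⇔ (mk⇔ Sum.swap Sum.swap) (symEdge? x P T (toℕ u) (toℕ v)) (symEdge? x P T (toℕ v) (toℕ u))

      h-irreflexive : ∀ u → h u u ≡ false
      h-irreflexive u = dec-false (symEdge? x P T (toℕ u) (toℕ u))
        Sum.[ C.edge-irreflexive (toℕ u) , C.edge-irreflexive (toℕ u) ]

      h⇔ : ∀ u v → h u v ≡ true ⇔ SymEdge x P T (toℕ u) (toℕ v)
      h⇔ u v = mk⇔ (does-true (symEdge? x P T (toℕ u) (toℕ v))) (dec-true (symEdge? x P T (toℕ u) (toℕ v)))

      colouring⇒valid : Colouring h → ∃[ τ ] C.Valid τ
      colouring⇒valid (col , proper) = C.chosen col′ proper′ , C.chosen-valid col′ proper′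
        where
        col′ : Fin C.m → Fin 3
        col′ u = col (cast (sym m≡) u)
        proper′ : ∀ u w → C.Edge (toℕ u) (toℕ w) → col′ u ≢ col′ w
        proper′ u w e = proper (cast (sym m≡) u) (cast (sym m≡) w) (Equivalence.from (h⇔ _ _)
          (inj₁ (subst₂ C.Edge (sym (toℕ-cast (sym m≡) u)) (sym (toℕ-cast (sym m≡) w)) e)))

      valid⇒colouring : (∃[ τ ] C.Valid τ) → Colouring h
      valid⇒colouring (τ , valid) = (λ u → C.colour τ (toℕ u)) , λ u w e eq →
        Sum.[ (λ e → C.colour-proper τ valid e eq) , (λ e → C.colour-proper τ valid e (sym eq)) ] (Equivalence.to (h⇔ u w) e)

      encoding-correct : Target (printed x (encodingC 21) (suc m′ ∷ T ∷ P ∷ N ∷ [])) ⇔ (∃[ τ ] C.Valid τ)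
      encoding-correct = ⇔-trans
        (Printing.target-printed x P T m′ h h-symmetric h-irreflexive h⇔) (mk⇔ colouring⇒valid valid⇒colouring)

      module _ (P≡ : P ≡ ⟦ p ⟧ N) (T≡ : T ≡ ⟦ q ⟧ (N * 2 + suc P) + suc (suc (N * 2 + P)))
        (V : Language) (halts : HaltsInTime M q (λ w c → Run.Accepts M c ⇔ V w)) where

        open Run M using (initial; Accepts)
        open Tableau M using (history; history-run)

        roomy : suc (suc (N * 2 + P)) ≤ T
        roomy = subst (suc (suc (N * 2 + P)) ≤_) (sym T≡) (m≤n+m _ (⟦ q ⟧ (N * 2 + suc P)))

        -- `T` is at least the running time on every pair with a short certificate, so by row `T`
        -- the verifier has halted with its decision.
        final-accepts : ∀ y → length y ≤ P → Accepts (history (initial ⟨ x , y ⟩) T) ⇔ V ⟨ x , y ⟩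
        final-accepts y short =
          let t , c , run , t≤ , decides = halts ⟨ x , y ⟩
              length≤ = ≤-trans (≤-reflexive (length-pair x y)) (+-monoʳ-≤ (N * 2) (s≤s short))
              t≤T = ≤-trans t≤ (≤-trans (polynomial-mono q length≤) (≤-trans (m≤m+n _ _) (≤-reflexive (sym T≡))))
          in subst (λ c → Accepts c ⇔ V ⟨ x , y ⟩) (sym (history-run run t≤T)) decides

        valid⇔ : (∃[ τ ] C.Valid τ) ⇔ (∃[ y ] length y ≤ ⟦ p ⟧ N × V ⟨ x , y ⟩)
        valid⇔ = mk⇔
          (λ (τ , valid) → let short = I.length-y roomy τ valid in
            I.y roomy τ valid , subst (length (I.y roomy τ valid) ≤_) P≡ short ,
            Equivalence.to (final-accepts (I.y roomy τ valid) short) (I.accepts roomy τ valid))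
          (λ (y , short , v) → let short′ = subst (length y ≤_) (sym P≡) short
                                   accepted = Equivalence.from (final-accepts y short′) v in
            I.tiling y short′ accepted , I.tiling-valid y short′ accepted)

        target⇔ : Target (printed x (encodingC 21) (suc m′ ∷ T ∷ P ∷ N ∷ [])) ⇔ (∃[ y ] length y ≤ ⟦ p ⟧ N × V ⟨ x , y ⟩)
        target⇔ = ⇔-trans encoding-correct valid⇔

    program-correct : (V : Language) → HaltsInTime M q (λ w c → Run.Accepts M c ⇔ V w) → ∀ x →
      Target (printed x program (length x ∷ [])) ⇔ (∃[ y ] length y ≤ ⟦ p ⟧ (length x) × V ⟨ x , y ⟩)
    -- `m′` is one less than the value of `verticesE`, and the values bound by `program` satisfy the
    -- equations for `P` and `T`.
    program-correct V halts x = Correctness.target⇔ x P T (2 + width * (suc (T + T) * suc T)) refl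
      (eval-polynomial x p v₀ (length x ∷ []))
      (cong (_+ (2 + (length x * 2 + P))) (eval-polynomial x q (v₁ ⊗ con 2 ⊕ (con 1 ⊕ v₀)) (P ∷ length x ∷ [])))
      V halts
      where
      P T : ℕ
      P = eval x certificateE (length x ∷ [])
      T = eval x timeE (P ∷ length x ∷ [])

  Target-NPHard : NPHard Target
  Target-NPHard L (V , p , (M , q , halts) , certified) =
    (λ x → printed x program (length x ∷ [])) , command-PolyTime program ,
    λ x → ⇔-trans (certified x) (⇔-sym (program-correct V halts x))
    where open Construction M p q

open Membership using (Target-InNP)
open Hardness using (Target-NPHard)

theorem5 : NPComplete (RegularInOutProperOrientation 4 2)
theorem5 = Target-InNP , Target-NPHard
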